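{- Let $\mathcal{C}$ be a small addable class of graphs and let $\phi$ be a sentence of monadic second-order logic (MSO) in the language of graphs. Let $p_n$ denote the probability that $R_n(\mathcal{C} \cap \mathrm{Conn})$ satisfies $\phi$, where $\mathrm{Conn}$ is the class of connected graphs. Then $\lim_{n\to\infty} p_n$ exists and is equal to either $0$ or $1$.
   Context: Graphs are finite, simple and undirected; a class of graphs is closed under isomorphism. For a class $\mathcal{C}$, $\mathcal{C}_n$ is the set of graphs in $\mathcal{C}$ with vertex set $[n]=\{1,\ldots,n\}$, and $R_n(\mathcal{C})$ is a random graph drawn from the uniform distribution on $\mathcal{C}_n$. $\mathcal{C}$ is decomposable if a graph $G$ is in $\mathcal{C}$ if and only if every connected component of $G$ is in $\mathcal{C}$. $\mathcal{C}$ is bridge-addable if for every $G\in\mathcal{C}$ and vertices $u,v$ in distinct connected components of $G$, the graph obtained by adding the edge $\{u,v\}$ is in $\mathcal{C}$. $\mathcal{C}$ is addable if it is decomposable and bridge-addable. $\mathcal{C}$ is small if $|\mathcal{C}_n| \le d^n n!$ for all $n$, for some real $d$. MSO formulas are built from atomic formulas $x\in X$ and $E(x,y)$ (first-order variables $x,y$ ranging over vertices, second-order variables $X$ ranging over sets of vertices) using $\wedge,\vee,\neg$ and first- and second-order quantifiers. -}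

module Defs where

open import Data.Nat using (ℕ; zero; suc; _≤_; _*_; _^_; _!)

open import Data.Fin using (Fin; _≟_)
open import Data.Bool using (Bool; true; false; _∨_; _∧_)
open import Data.List using (List; []; _∷_; map; concatMap)
import Data.Vec.Functional as VF
open import Data.Product using (Σ; _×_; _,_)
open import Data.Sum using (_⊎_)
open import Data.Empty using (⊥)
open import Relation.Nullary using (¬_)
open import Relation.Nullary.Decidable using (⌊_⌋)
open import Relation.Binary.PropositionalEquality using (_≡_)
open import Function.Bundles using (_↔_; Inverse)
open import Function.Definitions using (Injective)
open import Data.Rational using (ℚ; _/_; _-_; ∣_∣; _<_; Positive)
open import Data.Integer using (+_)

Adj : ℕ → Set
Adj n = Fin n → Fin n → Bool

IsGraph : {n : ℕ} → Adj n → Set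
IsGraph {n} G = (∀ i j → G i j ≡ G j i) × (∀ i → G i i ≡ false)

allFuns : {A : Set} → List A → (m : ℕ) → List (Fin m → A)
allFuns xs zero = (λ ()) ∷ []
allFuns xs (suc m) = concatMap (λ x → map (λ f → x VF.∷ f) (allFuns xs m)) xs

allAdj : (n : ℕ) → List (Adj n)
allAdj n = allFuns (allFuns (true ∷ false ∷ []) n) n

data CountIs {A : Set} (P : A → Set) : List A → ℕ → Set where
  cnil  : CountIs P [] 0
  cyes  : ∀ {x xs k} → P x → CountIs P xs k → CountIs P (x ∷ xs) (suc k)
  cno   : ∀ {x xs k} → ¬ P x → CountIs P xs k → CountIs P (x ∷ xs) k

data Reachable {n : ℕ} (G : Adj n) : Fin n → Fin n → Set where
  here : ∀ {i} → Reachable G i i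
  step : ∀ {i j k} → G i j ≡ true → Reachable G j k → Reachable G i k

Connected : {n : ℕ} → Adj n → Set
Connected {n} G = Fin n × (∀ i j → Reachable G i j)

addEdge : {n : ℕ} → Adj n → Fin n → Fin n → Adj n
addEdge G u v i j = G i j ∨ (⌊ i ≟ u ⌋ ∧ ⌊ j ≟ v ⌋) ∨ (⌊ i ≟ v ⌋ ∧ ⌊ j ≟ u ⌋)

induced : {n k : ℕ} → Adj n → (Fin k → Fin n) → Adj k
induced G e i j = G (e i) (e j)

IsComponentEmb : {n k : ℕ} → Adj n → (Fin k → Fin n) → Set
IsComponentEmb {n} {k} G e =
  Injective _≡_ _≡_ e × Connected (induced G e) ×
  (∀ (i : Fin k) (w : Fin n) → G (e i) w ≡ true → Σ (Fin k) λ j → e j ≡ w)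

-- Classes of graphs: C n G means the graph G on [n] is in C
-- (only meaningful for G with IsGraph G).

Class : Set₁
Class = (n : ℕ) → Adj n → Set

IsoClosed : Class → Set
IsoClosed C = ∀ n (G H : Adj n) (π : Fin n ↔ Fin n) → IsGraph G →
  (∀ i j → H (Inverse.to π i) (Inverse.to π j) ≡ G i j) → C n G → C n H

Decomposable : Class → Set
Decomposable C = ∀ n (G : Adj n) → IsGraph G →
  (C n G → ∀ k (e : Fin (suc k) → Fin n) → IsComponentEmb G e → C (suc k) (induced G e))
  × ((∀ k (e : Fin (suc k) → Fin n) → IsComponentEmb G e → C (suc k) (induced G e)) → C n G)

BridgeAddable : Class → Set
BridgeAddable C = ∀ n (G : Adj n) (u v : Fin n) → IsGraph G → C n G →
  ¬ Reachable G u v → C n (addEdge G u v)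

Addable : Class → Set
Addable C = Decomposable C × BridgeAddable C

InClass : Class → (n : ℕ) → Adj n → Set
InClass C n G = IsGraph G × C n G

-- Small: |C_n| ≤ d^n n! for all n (d may be taken natural w.l.o.g.).
Small : Class → Set
Small C = Σ ℕ λ d → ∀ n k → CountIs (InClass C n) (allAdj n) k → k ≤ d ^ n * n !

-- Monadic second-order logic, de Bruijn indexed:
-- MSO a b has a free first-order and b free second-order variables.

data MSO (a b : ℕ) : Set where
  mem  : Fin a → Fin b → MSO a b
  edge : Fin a → Fin a → MSO a b
  and  : MSO a b → MSO a b → MSO a b
  or   : MSO a b → MSO a b → MSO a b
  neg  : MSO a b → MSO a b
  ex1  : MSO (suc a) b → MSO a b
  all1 : MSO (suc a) b → MSO a b
  ex2  : MSO a (suc b) → MSO a b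
  all2 : MSO a (suc b) → MSO a b

Sentence : Set
Sentence = MSO 0 0

Sat : {n a b : ℕ} → Adj n → (Fin a → Fin n) → (Fin b → (Fin n → Bool)) → MSO a b → Set
Sat G ρ σ (mem x X) = σ X (ρ x) ≡ true
Sat G ρ σ (edge x y) = G (ρ x) (ρ y) ≡ true
Sat G ρ σ (and φ ψ) = Sat G ρ σ φ × Sat G ρ σ ψ
Sat G ρ σ (or φ ψ) = Sat G ρ σ φ ⊎ Sat G ρ σ ψ
Sat G ρ σ (neg φ) = ¬ Sat G ρ σ φ
Sat {n} G ρ σ (ex1 φ) = Σ (Fin n) λ v → Sat G (v VF.∷ ρ) σ φ
Sat {n} G ρ σ (all1 φ) = ∀ (v : Fin n) → Sat G (v VF.∷ ρ) σ φ
Sat {n} G ρ σ (ex2 φ) = Σ (Fin n → Bool) λ S → Sat G ρ (S VF.∷ σ) φ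
Sat {n} G ρ σ (all2 φ) = ∀ (S : Fin n → Bool) → Sat G ρ (S VF.∷ σ) φ

Models : {n : ℕ} → Adj n → Sentence → Set
Models G φ = Sat G (λ ()) (λ ()) φ

-- p_n = Prob[R_n(C ∩ Conn) ⊨ φ] = m / k where k = |(C ∩ Conn)_n| and
-- m = |{G ∈ (C ∩ Conn)_n : G ⊨ φ}|.  The limit is taken over those n
-- with (C ∩ Conn)_n ≠ ∅ (where R_n is defined).

InConn : Class → (n : ℕ) → Adj n → Set
InConn C n G = InClass C n G × Connected G

InConnSat : Class → Sentence → (n : ℕ) → Adj n → Set
InConnSat C φ n G = InConn C n G × Models G φ

ProbConvergesTo : Class → Sentence → ℚ → Set
ProbConvergesTo C φ L = ∀ (ε : ℚ) → Positive ε → Σ ℕ λ N → ∀ n → N ≤ n →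
  ∀ k m → CountIs (InConn C n) (allAdj n) (suc k) →
  CountIs (InConnSat C φ n) (allAdj n) m →
  ∣ ((+ m) / suc k) - L ∣ < ε

{-# OPTIONS --safe #-}
module Submission where

-- Sketch. Let q be the quantifier rank of φ and write x ⊕ y for the graph obtained from two rooted graphs by joining
-- their roots by an edge, rooted like x. Rank-q MSO equivalence is a congruence of finite index for ⊕, and sufficiently
-- many equal branches at a root absorb one more of the same kind. So some connected rooted H in C satisfies H ⊕ x ≡ H
-- for every rooted connected x in C, and then all connected graphs in C with a pendant copy of H satisfy the same
-- sentences of rank q, namely those of H.
-- It remains to see that few connected graphs in C have no pendant copy of H. Let f(n) be the number of rooted connected
-- graphs of C on [n], divided by n!. Joining by an edge gives f(a + b) ≥ f(a) f(b) for b < a, and smallness bounds f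
-- exponentially, so f grows like γⁿ up to an arbitrarily small exponential factor. Attaching j copies of H at arbitrary
-- vertices of a graph on [n] that has none is injective up to the order of the copies, since pendant sets of equal size
-- are disjoint. With j proportional to n this produces so many graphs that those without a pendant copy of H have a
-- strictly smaller exponential growth rate.
-- The class is not decidable, so counts and types exist only up to double negation; the convergence bound N(ε) is
-- therefore explicit in finitely many constants obtained that way.

-- Fekete's lemma does not apply as it stands: the product inequality needs b < a, f may vanish for
-- infinitely many n, and a supremum of roots need not be rational. A tolerance x > 1 is therefore
-- fixed beforehand, and a rational γ is found with γ^m ≤ f(m) for one m ≥ 1 and f(n) ≤ (xγ)^n for
-- all n ≥ 1. The matching lower bound, up to a constant, is proved only where f(n) is not 0, one
-- residue class modulo m at a time. The condition b < a comes from decoding. A joined graph is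
-- recorded together with one vertex, the root of the attached part, and the attached part has to be
-- recovered from it. Two pendant sets of the same size that meet are equal as soon as they cannot
-- cover the whole graph. The gain in the last count is explicit. If jE ≤ n, then j copies can be
-- placed in at least n^j / j! ≥ E^j ways, whereas the additional jb vertices and the tolerance cost
-- at most (2 b! D^b)^j, where D bounds the growth. With E four times this base, graphs without a
-- pendant copy make up a fraction of at most K n / 4^j; as j may be of order n, this tends to 0.

-- The double-negation monad.

module DoubleNegation where
  open import Relation.Nullary using (¬_; Dec; ¬¬-excluded-middle)

  infixl 1 _>>=_
  _>>=_ : ∀ {a b} {A : Set a} {B : Set b} → ¬ ¬ A → (A → ¬ ¬ B) → ¬ ¬ B
  (m >>= f) k = m (λ a → f a k)

  pure : ∀ {a} {A : Set a} → A → ¬ ¬ A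
  pure a k = k a

  em : ∀ {a} {A : Set a} → ¬ ¬ Dec A
  em = ¬¬-excluded-middle

-- Ehrenfeucht-Fraïssé games on sets, composition and absorption.

module Game where
  open DoubleNegation
  open import Data.Nat using (ℕ; zero; suc; _≤_; _<_; _*_; _+_; s≤s)
  import Data.Nat.Properties as ℕ
  open import Data.Fin using (Fin; zero; suc; combine; remQuot; toℕ)
  open import Data.Fin.Properties using (remQuot-combine; toℕ<n; toℕ-injective)
  open import Data.Bool using (Bool; true)
  import Data.Vec.Functional as VF
  open import Data.Product using (Σ; _×_; _,_; proj₁; proj₂)
  open import Data.Sum using (_⊎_; inj₁; inj₂; [_,_]′)
  open import Data.Sum.Properties using (inj₁-injective; inj₂-injective)
  open import Data.Empty using (⊥; ⊥-elim)
  open import Data.Unit using (⊤; tt)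
  open import Data.List using (List; []; _∷_; map; foldl; replicate; length; _++_)
  import Data.List.Properties as List
  open import Data.List.Relation.Binary.Permutation.Propositional
    using (_↭_; refl; prep; swap; trans; ↭-sym; ↭-reflexive; ↭-trans)
  open import Data.List.Relation.Binary.Permutation.Propositional.Properties
    using (map⁺; shift; ++⁺ˡ; ++-comm; ↭-length)
  open import Data.List.Relation.Unary.All as All using (All; []; _∷_)
  open import Relation.Nullary using (¬_; Dec; yes; no)
  open import Relation.Binary.PropositionalEquality as ≡ using (_≡_; _≢_; cong; subst; subst₂)
  open import Function using (_∘_; id)

  -- The roots form a set `R`, so that a structure can lose its root altogether. The vertices form
  -- an arbitrary type, so that sums and parts of graphs are structures too.
  record Str (b : ℕ) : Set₁ where
    field
      V : Set
      E : V → V → Set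
      R : V → Set
      σ : Fin b → V → Bool
  open Str public

  infixl 6 _▸_ _⊕_
  _▸_ : ∀ {b} (x : Str b) → (V x → Bool) → Str (suc b)
  x ▸ S = record { V = V x ; E = E x ; R = R x ; σ = S VF.∷ σ x }

  -- The clause `rooted` makes atomic equivalence a congruence for `⊕`: two sets on different sides
  -- are linked exactly when each contains a root.
  record Imp {b} (x y : Str b) : Set where
    field
      meets : ∀ i j → (Σ (V x) λ v → σ x i v ≡ true × σ x j v ≡ true)
                    → (Σ (V y) λ v → σ y i v ≡ true × σ y j v ≡ true)
      linked : ∀ i j → (Σ (V x) λ v → Σ (V x) λ w → σ x i v ≡ true × σ x j w ≡ true × E x v w)
                     → (Σ (V y) λ v → Σ (V y) λ w → σ y i v ≡ true × σ y j w ≡ true × E y v w)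
      many : ∀ i → (Σ (V x) λ v → Σ (V x) λ w → σ x i v ≡ true × σ x i w ≡ true × v ≢ w)
                 → (Σ (V y) λ v → Σ (V y) λ w → σ y i v ≡ true × σ y i w ≡ true × v ≢ w)
      rooted : ∀ i → (Σ (V x) λ v → σ x i v ≡ true × R x v)
                   → (Σ (V y) λ v → σ y i v ≡ true × R y v)
  open Imp

  -- Only sets are played: a vertex is played as a singleton, which [many] recognises.
  Eq : ∀ {b} → ℕ → Str b → Str b → Set
  Forth : ∀ {b} → ℕ → Str b → Str b → Set
  Eq zero x y = Imp x y × Imp y x
  Eq (suc q) x y = Eq q x y × Forth q x y × Forth q y x
  Forth q x y = ∀ S → ¬ ¬ Σ (V y → Bool) λ S' → Eq q (x ▸ S) (y ▸ S')

  infix 4 _≅_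
  _≅_ : ∀ {b} → Str b → Str b → Set
  x ≅ y = ∀ q → Eq q x y

  Imp-trans : ∀ {b} {x y z : Str b} → Imp x y → Imp y z → Imp x z
  Imp-trans f g = record
    { meets = λ i j → meets g i j ∘ meets f i j ; linked = λ i j → linked g i j ∘ linked f i j
    ; many = λ i → many g i ∘ many f i ; rooted = λ i → rooted g i ∘ rooted f i }

  Eq-sym : ∀ {b} q {x y : Str b} → Eq q x y → Eq q y x
  Eq-sym zero (f , g) = g , f
  Eq-sym (suc q) (e , f , g) = Eq-sym q e , g , f

  Eq-trans : ∀ {b} q {x y z : Str b} → Eq q x y → Eq q y z → Eq q x z
  Eq-trans zero (f , g) (f' , g') = Imp-trans f f' , Imp-trans g' g
  Eq-trans {b} (suc q) (e , f , g) (e' , f' , g') = Eq-trans q e e' , comp f f' , comp g' g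
    where
    comp : ∀ {x y z : Str b} → Forth q x y → Forth q y z → Forth q x z
    comp f f' S = do
      S₁ , e₁ ← f S
      S₂ , e₂ ← f' S₁
      pure (S₂ , Eq-trans q e₁ e₂)

  record Iso {b} (x y : Str b) : Set where
    field
      to : V x → V y
      from : V y → V x
      to-from : ∀ v → to (from v) ≡ v
      from-to : ∀ v → from (to v) ≡ v
      E⇒ : ∀ {v w} → E x v w → E y (to v) (to w)
      E⇐ : ∀ {v w} → E y v w → E x (from v) (from w)
      R⇒ : ∀ {v} → R x v → R y (to v)
      R⇐ : ∀ {v} → R y v → R x (from v)
      σ⇒ : ∀ i v → σ y i (to v) ≡ σ x i v

  Iso-sym : ∀ {b} {x y : Str b} → Iso x y → Iso y x
  Iso-sym {x = x} {y} f = record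
    { to = from ; from = to ; to-from = from-to ; from-to = to-from
    ; E⇒ = E⇐ ; E⇐ = E⇒ ; R⇒ = R⇐ ; R⇐ = R⇒
    ; σ⇒ = λ i v → ≡.trans (≡.sym (σ⇒ i (from v))) (cong (σ y i) (to-from v)) }
    where open Iso f

  Iso-▸ : ∀ {b} {x y : Str b} (f : Iso x y) S → Iso (x ▸ S) (y ▸ (S ∘ Iso.from f))
  Iso-▸ f S = record
    { to = to ; from = from ; to-from = to-from ; from-to = from-to
    ; E⇒ = E⇒ ; E⇐ = E⇐ ; R⇒ = R⇒ ; R⇐ = R⇐
    ; σ⇒ = λ { zero v → cong S (from-to v) ; (suc i) v → σ⇒ i v } }
    where open Iso f

  Iso⇒≅ : ∀ {b} {x y : Str b} → Iso x y → x ≅ y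
  Iso⇒≅ f zero = imp f , imp (Iso-sym f)
    where
    imp : ∀ {b} {x y : Str b} → Iso x y → Imp x y
    imp f = record
      { meets = λ { i j (v , p , q) → to v , ≡.trans (σ⇒ i v) p , ≡.trans (σ⇒ j v) q }
      ; linked = λ { i j (v , w , p , q , e) → to v , to w , ≡.trans (σ⇒ i v) p , ≡.trans (σ⇒ j w) q , E⇒ e }
      ; many = λ { i (v , w , p , q , v≢w) → to v , to w , ≡.trans (σ⇒ i v) p , ≡.trans (σ⇒ i w) q ,
          λ eq → v≢w (≡.trans (≡.sym (from-to v)) (≡.trans (cong from eq) (from-to w))) }
      ; rooted = λ { i (v , p , r) → to v , ≡.trans (σ⇒ i v) p , R⇒ r } }
      where open Iso f
  Iso⇒≅ f (suc q) = Iso⇒≅ f q , forth f , forth (Iso-sym f)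
    where
    forth : ∀ {x y} → Iso x y → Forth q x y
    forth f S = pure (S ∘ Iso.from f , Iso⇒≅ (Iso-▸ f S) q)

  Eq-refl : ∀ {b} q {x : Str b} → Eq q x x
  Eq-refl q = Iso⇒≅ (record
    { to = id ; from = id ; to-from = λ _ → ≡.refl ; from-to = λ _ → ≡.refl
    ; E⇒ = id ; E⇐ = id ; R⇒ = id ; R⇐ = id ; σ⇒ = λ _ _ → ≡.refl }) q

  module _ {b : ℕ} (x y : Str b) where
    EdgeSum : V x ⊎ V y → V x ⊎ V y → Set
    EdgeSum (inj₁ v) (inj₁ w) = E x v w
    EdgeSum (inj₁ v) (inj₂ w) = R x v × R y w
    EdgeSum (inj₂ v) (inj₁ w) = R x w × R y v
    EdgeSum (inj₂ v) (inj₂ w) = E y v w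

    RootSum : V x ⊎ V y → Set
    RootSum (inj₁ v) = R x v
    RootSum (inj₂ _) = ⊥

  _⊕_ : ∀ {b} → Str b → Str b → Str b
  x ⊕ y = record { V = V x ⊎ V y ; E = EdgeSum x y ; R = RootSum x y ; σ = λ i → [ σ x i , σ y i ]′ }

  ⊕-▸ : ∀ {b} (x y : Str b) S → Iso ((x ⊕ y) ▸ S) ((x ▸ (S ∘ inj₁)) ⊕ (y ▸ (S ∘ inj₂)))
  ⊕-▸ x y S = record
    { to = id ; from = id ; to-from = λ _ → ≡.refl ; from-to = λ _ → ≡.refl
    ; E⇒ = λ {v w} → e v w ; E⇐ = λ {v w} → e' v w ; R⇒ = λ {v} → r v ; R⇐ = λ {v} → r' v
    ; σ⇒ = λ { zero (inj₁ v) → ≡.refl ; zero (inj₂ v) → ≡.refl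
             ; (suc i) (inj₁ v) → ≡.refl ; (suc i) (inj₂ v) → ≡.refl } }
    where
    z = (x ▸ (S ∘ inj₁)) ⊕ (y ▸ (S ∘ inj₂))
    e : ∀ v w → E (x ⊕ y) v w → E z v w
    e (inj₁ _) (inj₁ _) p = p
    e (inj₁ _) (inj₂ _) p = p
    e (inj₂ _) (inj₁ _) p = p
    e (inj₂ _) (inj₂ _) p = p
    e' : ∀ v w → E z v w → E (x ⊕ y) v w
    e' (inj₁ _) (inj₁ _) p = p
    e' (inj₁ _) (inj₂ _) p = p
    e' (inj₂ _) (inj₁ _) p = p
    e' (inj₂ _) (inj₂ _) p = p
    r : ∀ v → R (x ⊕ y) v → R z v
    r (inj₁ _) p = p
    r' : ∀ v → R z v → R (x ⊕ y) v
    r' (inj₁ _) p = p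

  Imp-⊕ : ∀ {b} {x x' y y' : Str b} → Imp x x' → Imp y y' → Imp (x ⊕ y) (x' ⊕ y')
  Imp-⊕ {b} {x} {x'} {y} {y'} f g = record { meets = me ; linked = li ; many = ma ; rooted = ro }
    where
    z = x ⊕ y
    z' = x' ⊕ y'
    me : ∀ i j → (Σ (V z) λ v → σ z i v ≡ true × σ z j v ≡ true)
               → (Σ (V z') λ v → σ z' i v ≡ true × σ z' j v ≡ true)
    me i j (inj₁ v , p) with w , q ← meets f i j (v , p) = inj₁ w , q
    me i j (inj₂ v , p) with w , q ← meets g i j (v , p) = inj₂ w , q
    li : ∀ i j → (Σ (V z) λ v → Σ (V z) λ w → σ z i v ≡ true × σ z j w ≡ true × E z v w)
               → (Σ (V z') λ v → Σ (V z') λ w → σ z' i v ≡ true × σ z' j w ≡ true × E z' v w)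
    li i j (inj₁ v , inj₁ w , p) with v' , w' , q ← linked f i j (v , w , p) = inj₁ v' , inj₁ w' , q
    li i j (inj₂ v , inj₂ w , p) with v' , w' , q ← linked g i j (v , w , p) = inj₂ v' , inj₂ w' , q
    li i j (inj₁ v , inj₂ w , p , q , r , s)
      with v' , p' , r' ← rooted f i (v , p , r) | w' , q' , s' ← rooted g j (w , q , s)
      = inj₁ v' , inj₂ w' , p' , q' , r' , s'
    li i j (inj₂ v , inj₁ w , p , q , r , s)
      with v' , p' , r' ← rooted g i (v , p , s) | w' , q' , s' ← rooted f j (w , q , r)
      = inj₂ v' , inj₁ w' , p' , q' , s' , r'
    ma : ∀ i → (Σ (V z) λ v → Σ (V z) λ w → σ z i v ≡ true × σ z i w ≡ true × v ≢ w)
             → (Σ (V z') λ v → Σ (V z') λ w → σ z' i v ≡ true × σ z' i w ≡ true × v ≢ w)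
    ma i (inj₁ v , inj₁ w , p , q , n)
      with v' , w' , p' , q' , n' ← many f i (v , w , p , q , n ∘ cong inj₁)
      = inj₁ v' , inj₁ w' , p' , q' , n' ∘ inj₁-injective
    ma i (inj₂ v , inj₂ w , p , q , n)
      with v' , w' , p' , q' , n' ← many g i (v , w , p , q , n ∘ cong inj₂)
      = inj₂ v' , inj₂ w' , p' , q' , n' ∘ inj₂-injective
    ma i (inj₁ v , inj₂ w , p , q , n)
      with v' , p' , _ ← meets f i i (v , p , p) | w' , q' , _ ← meets g i i (w , q , q)
      = inj₁ v' , inj₂ w' , p' , q' , λ ()
    ma i (inj₂ v , inj₁ w , p , q , n)
      with v' , p' , _ ← meets g i i (v , p , p) | w' , q' , _ ← meets f i i (w , q , q)
      = inj₂ v' , inj₁ w' , p' , q' , λ ()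
    ro : ∀ i → (Σ (V z) λ v → σ z i v ≡ true × R z v) → (Σ (V z') λ v → σ z' i v ≡ true × R z' v)
    ro i (inj₁ v , p) with w , q ← rooted f i (v , p) = inj₁ w , q

  -- A set in a sum is a pair of sets, one on each side, so the replies of the two separate games
  -- combine to a reply in the sum.
  Eq-⊕ : ∀ {b} q {x x' y y' : Str b} → Eq q x x' → Eq q y y' → Eq q (x ⊕ y) (x' ⊕ y')
  Eq-⊕ zero (f , f') (g , g') = Imp-⊕ f g , Imp-⊕ f' g'
  Eq-⊕ {b} (suc q) (e , f , f') (e' , g , g') = Eq-⊕ q e e' , forth f g , forth f' g'
    where
    forth : ∀ {x x' y y' : Str b} → Forth q x x' → Forth q y y' → Forth q (x ⊕ y) (x' ⊕ y')
    forth {x} {x'} {y} {y'} f g S = do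
      S₁ , e₁ ← f (S ∘ inj₁)
      S₂ , e₂ ← g (S ∘ inj₂)
      pure ([ S₁ , S₂ ]′ ,
        Eq-trans q (Iso⇒≅ (⊕-▸ x y S) q)
          (Eq-trans q (Eq-⊕ q e₁ e₂) (Eq-sym q (Iso⇒≅ (⊕-▸ x' y' [ S₁ , S₂ ]′) q))))

  ⊕-swap : ∀ {b} (a x y : Str b) → a ⊕ x ⊕ y ≅ a ⊕ y ⊕ x
  ⊕-swap {b} a x y = Iso⇒≅ (record
    { to = f a x y ; from = f a y x ; to-from = inv a y x ; from-to = inv a x y
    ; E⇒ = λ {v w} → e a x y v w ; E⇐ = λ {v w} → e a y x v w
    ; R⇒ = λ {v} → r a x y v ; R⇐ = λ {v} → r a y x v
    ; σ⇒ = λ { i (inj₁ (inj₁ v)) → ≡.refl ; i (inj₁ (inj₂ v)) → ≡.refl ; i (inj₂ v) → ≡.refl } })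
    where
    f : ∀ (a x y : Str b) → V (a ⊕ x ⊕ y) → V (a ⊕ y ⊕ x)
    f a x y (inj₁ (inj₁ v)) = inj₁ (inj₁ v)
    f a x y (inj₁ (inj₂ v)) = inj₂ v
    f a x y (inj₂ v) = inj₁ (inj₂ v)
    inv : ∀ a x y v → f a y x (f a x y v) ≡ v
    inv a x y (inj₁ (inj₁ v)) = ≡.refl
    inv a x y (inj₁ (inj₂ v)) = ≡.refl
    inv a x y (inj₂ v) = ≡.refl
    e : ∀ a x y v w → E (a ⊕ x ⊕ y) v w → E (a ⊕ y ⊕ x) (f a x y v) (f a x y w)
    e a x y (inj₁ (inj₁ v)) (inj₁ (inj₁ w)) p = p
    e a x y (inj₁ (inj₁ v)) (inj₁ (inj₂ w)) p = p
    e a x y (inj₁ (inj₁ v)) (inj₂ w) p = p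
    e a x y (inj₁ (inj₂ v)) (inj₁ (inj₁ w)) p = p
    e a x y (inj₁ (inj₂ v)) (inj₁ (inj₂ w)) p = p
    e a x y (inj₂ v) (inj₁ (inj₁ w)) p = p
    e a x y (inj₂ v) (inj₂ w) p = p
    r : ∀ a x y v → R (a ⊕ x ⊕ y) v → R (a ⊕ y ⊕ x) (f a x y v)
    r a x y (inj₁ (inj₁ v)) p = p

  hang : ∀ {b} → Str b → List (Str b) → Str b
  hang = foldl _⊕_

  hang-cong : ∀ {b} q {x y : Str b} l → Eq q x y → Eq q (hang x l) (hang y l)
  hang-cong q [] e = e
  hang-cong q (z ∷ l) e = hang-cong q l (Eq-⊕ q e (Eq-refl q))

  hang-↭ : ∀ {b} q {l m : List (Str b)} (a : Str b) → l ↭ m → Eq q (hang a l) (hang a m)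
  hang-↭ q a refl = Eq-refl q
  hang-↭ q a (prep x p) = hang-↭ q (a ⊕ x) p
  hang-↭ q a (swap {xs} x y p) = Eq-trans q (hang-cong q xs (⊕-swap a x y q)) (hang-↭ q (a ⊕ y ⊕ x) p)
  hang-↭ q a (trans p p') = Eq-trans q (hang-↭ q a p) (hang-↭ q a p')

  -- A finite colouring instead of a quotient: elements of one colour are related, while related
  -- elements may differ in colour. `Has` is a relation because the colour of a structure is known
  -- only up to double negation.
  record FinIdx {X : Set₁} (_~_ : X → X → Set) : Set₁ where
    field
      size : ℕ
      Has : X → Fin size → Set
      total : ∀ x → ¬ ¬ Σ (Fin size) (Has x)
      sound : ∀ {x y c} → Has x c → Has y c → x ~ y

  module _ {X : Set₁} where
    FinIdx-map : {R S : X → X → Set} → (∀ {x y} → R x y → S x y) → FinIdx R → FinIdx S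
    FinIdx-map f r = record { size = size ; Has = Has ; total = total ; sound = λ p q → f (sound p q) }
      where open FinIdx r

    FinIdx-prop : (P : X → Set) → FinIdx (λ x y → (P x → P y) × (P y → P x))
    FinIdx-prop P = record
      { size = 2 ; Has = Has
      ; total = λ x → em >>= λ { (yes p) → pure (zero , p) ; (no n) → pure (suc zero , n) }
      ; sound = λ {x} {y} {c} → sound x y c }
      where
      Has : X → Fin 2 → Set
      Has x zero = P x
      Has x (suc zero) = ¬ P x
      sound : ∀ x y c → Has x c → Has y c → (P x → P y) × (P y → P x)
      sound x y zero p q = (λ _ → q) , (λ _ → p)
      sound x y (suc zero) p q = ⊥-elim ∘ p , ⊥-elim ∘ q

    FinIdx-× : {R S : X → X → Set} → FinIdx R → FinIdx S → FinIdx (λ x y → R x y × S x y)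
    FinIdx-× {R} {S} r s = record
      { size = r.size * s.size
      ; Has = λ x c → r.Has x (proj₁ (remQuot s.size c)) × s.Has x (proj₂ (remQuot {r.size} s.size c))
      ; total = λ x → do
          c , p ← r.total x
          d , q ← s.total x
          pure (combine c d , subst (r.Has x ∘ proj₁) (≡.sym (remQuot-combine c d)) p
                            , subst (s.Has x ∘ proj₂) (≡.sym (remQuot-combine c d)) q)
      ; sound = λ { (p , q) (p' , q') → r.sound p p' , s.sound q q' } }
      where
      module r = FinIdx r
      module s = FinIdx s

    FinIdx-∀ : ∀ {n} {R : Fin n → X → X → Set} → (∀ i → FinIdx (R i)) → FinIdx (λ x y → ∀ i → R i x y)
    FinIdx-∀ {zero} r = record { size = 1 ; Has = λ _ _ → ⊤ ; total = λ _ → pure (zero , tt) ; sound = λ _ _ () }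
    FinIdx-∀ {suc n} r = FinIdx-map (λ { (p , q) → λ { zero → p ; (suc i) → q i } })
      (FinIdx-× (r zero) (FinIdx-∀ (r ∘ suc)))

  -- Hintikka types: the behaviour at rank `suc q` is fixed by the type at rank `q` together with
  -- the set of rank-`q` colours realised by adding one set. There are finitely many such sets of
  -- colours.
  Eq-finIdx : ∀ q b → FinIdx {Str b} (Eq q)
  Eq-finIdx zero b = FinIdx-map
    (λ h → record { meets = λ i j → proj₁ (proj₁ (h i j)) ; linked = λ i j → proj₁ (proj₁ (proj₂ (h i j)))
                  ; many = λ i → proj₁ (proj₁ (proj₂ (proj₂ (h i i)))) ; rooted = λ i → proj₁ (proj₂ (proj₂ (proj₂ (h i i)))) }
         , record { meets = λ i j → proj₂ (proj₁ (h i j)) ; linked = λ i j → proj₂ (proj₁ (proj₂ (h i j)))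
                  ; many = λ i → proj₂ (proj₁ (proj₂ (proj₂ (h i i)))) ; rooted = λ i → proj₂ (proj₂ (proj₂ (proj₂ (h i i)))) })
    (FinIdx-∀ {n = b} λ i → FinIdx-∀ {n = b} λ j →
      FinIdx-× (FinIdx-prop λ x → Σ (V x) λ v → σ x i v ≡ true × σ x j v ≡ true)
      (FinIdx-× (FinIdx-prop λ x → Σ (V x) λ v → Σ (V x) λ w → σ x i v ≡ true × σ x j w ≡ true × E x v w)
      (FinIdx-× (FinIdx-prop λ x → Σ (V x) λ v → Σ (V x) λ w → σ x i v ≡ true × σ x i w ≡ true × v ≢ w)
                (FinIdx-prop λ x → Σ (V x) λ v → σ x i v ≡ true × R x v))))
  Eq-finIdx (suc q) b = FinIdx-map
    (λ { (e , h) → e , forth (λ c → proj₁ (h c)) , forth (λ c → proj₂ (h c)) })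
    (FinIdx-× (Eq-finIdx q b) (FinIdx-∀ λ c → FinIdx-prop λ x → Σ (V x → Bool) λ S → Has (x ▸ S) c))
    where
    open FinIdx (Eq-finIdx q (suc b))
    forth : ∀ {x y} → (∀ c → (Σ (V x → Bool) λ S → Has (x ▸ S) c) → (Σ (V y → Bool) λ S → Has (y ▸ S) c)) → Forth q x y
    forth {x} h S = do
      c , p ← total (x ▸ S)
      let S' , p' = h c (S , p)
      pure (S' , sound p p')

  partition : ∀ {a} {A : Set a} (f : A → ℕ) K l → All (λ x → f x < suc K) l →
    Σ (List A) λ p → Σ (List A) λ r → (l ↭ p ++ r) × All (λ x → f x ≡ K) p × All (λ x → f x < K) r
  partition f K [] [] = [] , [] , refl , [] , []
  partition f K (x ∷ l) (h ∷ hs) with partition f K l hs | f x ℕ.≟ K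
  ... | p , r , e , ps , rs | yes eq = x ∷ p , r , prep x e , eq ∷ ps , rs
  ... | p , r , e , ps , rs | no neq =
    p , x ∷ r , ↭-trans (prep x e) (↭-sym (shift x p r)) , ps , ℕ.≤∧≢⇒< (ℕ.≤-pred h) neq ∷ rs

  -- The element `d` stands apart because it is the one to be dropped: at least `M` others of its
  -- colour remain in `p`. The induction splits off the largest colour.
  pigeonhole : ∀ {a} {A : Set a} K M (f : A → ℕ) l → All (λ x → f x < K) l → K * M < length l →
    Σ A λ d → Σ (List A) λ p → Σ (List A) λ r → Σ ℕ λ c →
      (l ↭ d ∷ p ++ r) × M ≤ length p × f d ≡ c × All (λ x → f x ≡ c) p
  pigeonhole zero M f (x ∷ l) (() ∷ _) h
  pigeonhole (suc K) M f l hs h with partition f K l hs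
  ... | p , r , e , ps , rs with M ℕ.<? length p
  pigeonhole (suc K) M f l hs h | d ∷ p , r , e , q ∷ ps , rs | yes m = d , p , r , K , e , ℕ.≤-pred m , q , ps
  ... | no m with pigeonhole K M f r rs
        (ℕ.+-cancelˡ-< M _ _ (ℕ.≤-trans h (ℕ.≤-trans
          (ℕ.≤-reflexive (≡.trans (↭-length e) (List.length-++ p)))
          (ℕ.+-monoˡ-≤ (length r) (ℕ.≮⇒≥ m)))))
  ... | d , p' , r' , c , e' , le , q , qs = d , p' , r' ++ p , c ,
    ↭-trans e (↭-trans (++⁺ˡ p e') (↭-trans (++-comm p (d ∷ p' ++ r'))
      (↭-reflexive (cong (d ∷_) (List.++-assoc p' r' p))))) , le , q , qs

  module _ {b : ℕ} (c : Str b) where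
    -- A set played on equal branches makes them different from each other, so the copies of `c`
    -- turn into a list of expansions of `c`.
    decompose : ∀ n (a : Str b) (S : V (hang a (replicate n c)) → Bool) →
      Σ (V a → Bool) λ S₀ → Σ (List (V c → Bool)) λ Ss → length Ss ≡ n ×
        (hang a (replicate n c) ▸ S ≅ hang (a ▸ S₀) (map (c ▸_) Ss))
    decompose zero a S = S , [] , ≡.refl , λ q → Eq-refl q
    decompose (suc n) a S with decompose n (a ⊕ c) S
    ... | S₁ , Ss , l , e = S₁ ∘ inj₁ , (S₁ ∘ inj₂) ∷ Ss , cong suc l ,
      λ q → Eq-trans q (e q) (hang-cong q (map (c ▸_) Ss) (Iso⇒≅ (⊕-▸ a c S₁) q))

    compose : ∀ (a : Str b) (S₀ : V a → Bool) (Ss : List (V c → Bool)) →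
      Σ (V (hang a (replicate (length Ss) c)) → Bool) λ S →
        hang a (replicate (length Ss) c) ▸ S ≅ hang (a ▸ S₀) (map (c ▸_) Ss)
    compose a S₀ [] = S₀ , λ q → Eq-refl q
    compose a S₀ (S₁ ∷ Ss) with compose (a ⊕ c) [ S₀ , S₁ ]′ Ss
    ... | S , e = S , λ q → Eq-trans q (e q) (hang-cong q (map (c ▸_) Ss) (Iso⇒≅ (⊕-▸ a c [ S₀ , S₁ ]′) q))

  -- Three equal branches satisfy the same atomic facts as two; two branches are needed for [many].
  Imp-fold : ∀ {b} (a c : Str b) → Imp (a ⊕ c ⊕ c ⊕ c) (a ⊕ c ⊕ c)
  Imp-fold {b} a c = record
    { meets = λ { i j (v , p , q) → f v , σf i v p , σf j v q }
    ; linked = λ { i j (v , w , p , q , e) → f v , f w , σf i v p , σf j w q , ef v w e }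
    ; many = λ { i (v , w , p , q , n) → two i v w p q n }
    ; rooted = λ { i (inj₁ v , p) → v , p } }
    where
    z = a ⊕ c ⊕ c ⊕ c
    z' = a ⊕ c ⊕ c
    f : V z → V z'
    f (inj₁ v) = v
    f (inj₂ v) = inj₂ v
    σf : ∀ i v → σ z i v ≡ true → σ z' i (f v) ≡ true
    σf i (inj₁ v) p = p
    σf i (inj₂ v) p = p
    ef : ∀ v w → E z v w → E z' (f v) (f w)
    ef (inj₁ v) (inj₁ w) p = p
    ef (inj₁ (inj₁ v)) (inj₂ w) p = p
    ef (inj₂ v) (inj₁ (inj₁ w)) p = p
    ef (inj₂ v) (inj₂ w) p = p
    Many : Fin b → Set
    Many i = Σ (V z') λ v → Σ (V z') λ w → σ z' i v ≡ true × σ z' i w ≡ true × v ≢ w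
    twins : ∀ i (v : V c) → σ c i v ≡ true → Many i
    twins i v p = inj₁ (inj₂ v) , inj₂ v , p , p , λ ()
    two : ∀ i v w → σ z i v ≡ true → σ z i w ≡ true → v ≢ w → Many i
    two i (inj₁ v) (inj₁ w) p q n = v , w , p , q , n ∘ cong inj₁
    two i (inj₂ v) w p q n = twins i v p
    two i v (inj₂ w) p q n = twins i w q

  Imp-inj₁ : ∀ {b} (x y : Str b) → Imp x (x ⊕ y)
  Imp-inj₁ x y = record
    { meets = λ { i j (v , p) → inj₁ v , p } ; linked = λ { i j (v , w , p) → inj₁ v , inj₁ w , p }
    ; many = λ { i (v , w , p , q , n) → inj₁ v , inj₁ w , p , q , n ∘ inj₁-injective }
    ; rooted = λ { i (v , p) → inj₁ v , p } }

  replicate-≈ : ∀ {b} q {A : Set} (g : A → Str b) d p → All (λ x → Eq q (g x) (g d)) p → ∀ a →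
    Eq q (hang a (map g p)) (hang a (replicate (length p) (g d)))
  replicate-≈ q g d [] [] a = Eq-refl q
  replicate-≈ q g d (x ∷ p) (e ∷ es) a =
    Eq-trans q (hang-cong q (map g p) (Eq-⊕ q (Eq-refl q) e)) (replicate-≈ q g d p es (a ⊕ g d))

  -- By induction on `q`: a played set sorts the copies of `c` into finitely many types of rank `q`.
  -- Among more than `size * M` copies one type occurs more than `M` times, and absorption at rank
  -- `q` with one more set allows the reply to duplicate or to delete a branch of this type.
  absorption : ∀ q b → Σ ℕ λ M → ∀ (a c : Str b) n → M ≤ n →
    Eq q (hang a (replicate n c)) (hang a (replicate (suc n) c))
  absorption zero b = 2 , λ { a c (suc zero) (s≤s ()) ; a c (suc (suc n)) _ →
    hang-cong 0 (replicate n c) (Imp-inj₁ (a ⊕ c ⊕ c) c , Imp-fold a c) }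
  absorption (suc q) b with absorption q (suc b) | absorption q b
  -- The first summand serves the moves in both directions, `M'` the component `Eq q` of
  -- `Eq (suc q)`.
  ... | M , abs | M' , abs' = suc (size * M) + M' , λ a c n h →
      abs' a c n (ℕ.≤-trans (ℕ.m≤n+m M' _) h) ,
      forth a c n (ℕ.≤-trans (ℕ.m≤m+n _ M') h) , back a c n (ℕ.≤-trans (ℕ.m≤m+n _ M') h)
    where
    open FinIdx (Eq-finIdx q (suc b))

    -- Among many branches of finitely many types one type repeats often, so one of its branches is redundant.
    redundant : ∀ (c : Str b) (Ss : List (V c → Bool)) → size * M < length Ss →
      ¬ ¬ Σ (V c → Bool) λ d → Σ (List (V c → Bool)) λ Ss' → (Ss ↭ d ∷ Ss') ×
        (∀ a → Eq q (hang a (map (c ▸_) (d ∷ Ss'))) (hang a (map (c ▸_) Ss')))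
    redundant c Ss h = do
      L , eq ← typed Ss
      let d , p , r , k , e , le , dk , pk = pigeonhole size M code L (All.universal (toℕ<n ∘ proj₁ ∘ proj₂) L)
                        (subst (size * M <_) (≡.trans (cong length (≡.sym eq)) (List.length-map proj₁ L)) h)
      pure (proj₁ d , map proj₁ (p ++ r) , subst (_↭ proj₁ d ∷ map proj₁ (p ++ r)) eq (map⁺ proj₁ e) , λ a →
        subst₂ (Eq q) (hang-map a (d ∷ p) r) (hang-map a p r)
          (hang-cong q (map g r) (drop a d p le (All.map (λ {x} e' → same {x} {d} (≡.trans e' (≡.sym dk))) pk))))
      where
      -- Each set carries a chosen colour, so that the pigeonhole principle works with a genuine
      -- function to numbers.
      Typed = Σ (V c → Bool) λ S → Σ (Fin size) (Has (c ▸ S))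
      code : Typed → ℕ
      code = toℕ ∘ proj₁ ∘ proj₂
      g : Typed → Str (suc b)
      g = (c ▸_) ∘ proj₁
      typed : ∀ Ss → ¬ ¬ Σ (List Typed) λ L → map proj₁ L ≡ Ss
      typed [] = pure ([] , ≡.refl)
      typed (S ∷ Ss) = do
        t ← total (c ▸ S)
        L , e ← typed Ss
        pure ((S , t) ∷ L , cong (S ∷_) e)
      same : ∀ {x y : Typed} → code x ≡ code y → Eq q (g x) (g y)
      same {_ , i , p} {_ , j , p'} e with ≡.refl ← toℕ-injective e = sound p p'
      hang-map : ∀ a p r → hang (hang a (map g p)) (map g r) ≡ hang a (map (c ▸_) (map proj₁ (p ++ r)))
      hang-map a [] r = cong (hang a) (List.map-∘ r)
      hang-map a (x ∷ p) r = hang-map (a ⊕ g x) p r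
      drop : ∀ a d p → M ≤ length p → All (λ x → Eq q (g x) (g d)) p →
        Eq q (hang a (map g (d ∷ p))) (hang a (map g p))
      drop a d p le es = Eq-trans q (replicate-≈ q g d p es (a ⊕ g d))
        (Eq-trans q (Eq-sym q (abs a (g d) (length p) le)) (Eq-sym q (replicate-≈ q g d p es a)))

    forth : ∀ a c n → size * M < n → Forth q (hang a (replicate n c)) (hang a (replicate (suc n) c))
    forth a c n h S with decompose c n a S
    ... | S₀ , Ss , ≡.refl , e = do
      d , Ss' , p , r ← redundant c Ss h
      -- The extra branch is coloured like the redundant branch `d`; in the opposite direction `d`
      -- is deleted.
      let S' , e' = compose c a S₀ (d ∷ Ss)
      pure (S' , Eq-trans q (e q) (Eq-sym q (Eq-trans q (e' q)
        (Eq-trans q (hang-↭ q _ (map⁺ (c ▸_) (prep d p)))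
        (Eq-trans q (r ((a ▸ S₀) ⊕ (c ▸ d)))
          (hang-↭ q _ (map⁺ (c ▸_) (↭-sym p))))))))

    back : ∀ a c n → size * M < n → Forth q (hang a (replicate (suc n) c)) (hang a (replicate n c))
    back a c n h S with decompose c (suc n) a S
    ... | S₀ , Ss , l , e = do
      d , Ss' , p , r ← redundant c Ss (ℕ.≤-trans h (ℕ.≤-trans (ℕ.n≤1+n n) (ℕ.≤-reflexive (≡.sym l))))
      let S' , e' = compose c a S₀ Ss'
          l' = ℕ.suc-injective (≡.trans (≡.sym (↭-length p)) l)
      pure (subst (λ m → Σ (V (hang a (replicate m c)) → Bool) λ S' →
                     Eq q (hang a (replicate (suc n) c) ▸ S) (hang a (replicate m c) ▸ S')) l'
        (S' , Eq-trans q (e q) (Eq-trans q (hang-↭ q _ (map⁺ (c ▸_) p)) (Eq-trans q (r (a ▸ S₀)) (Eq-sym q (e' q))))))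

  hang-⊕ : ∀ {b} q (a y : Str b) l → Eq q (hang a l ⊕ y) (hang (a ⊕ y) l)
  hang-⊕ q a y [] = Eq-refl q
  hang-⊕ q a y (z ∷ l) = Eq-trans q (hang-⊕ q (a ⊕ z) y l) (hang-cong q l (⊕-swap a z y q))

  module _ {b : ℕ} (q : ℕ) (P : Str b → Set) (P-⊕ : ∀ {x y : Str b} → P x → P y → P (x ⊕ y)) where
    open FinIdx (Eq-finIdx q b)

    P-replicate : ∀ n {a c} → P a → P c → P (hang a (replicate n c))
    P-replicate zero pa pc = pa
    P-replicate (suc n) pa pc = P-replicate n (P-⊕ pa pc) pc

    -- The colours are treated one by one. If some `y` with `P y` has the current colour, `M` copies
    -- of `y` are hung on the structure built so far; it then absorbs everything of that colour,
    -- because such an `x` can be replaced by one more `y`. Absorption of earlier colours survives,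
    -- since `x` can be moved past the new branches.
    universal : ∀ a → P a → ¬ ¬ Σ (Str b) λ h → P h × (∀ x → P x → ¬ ¬ Eq q (h ⊕ x) h)
    universal a pa = do
      h , ph , abs ← build size
      pure (h , ph , λ x px → do
        c , hc ← total x
        pure (abs x c px hc (toℕ<n c)))
      where
      M = proj₁ (absorption q b)
      build : ∀ k → ¬ ¬ Σ (Str b) λ h → P h × (∀ x c → P x → Has x c → toℕ c < k → Eq q (h ⊕ x) h)
      build zero = pure (a , pa , λ _ _ _ _ ())
      build (suc k) = do
        h , ph , abs ← build k
        yes (y , c , py , hc , eq) ← em {A = Σ (Str b) λ y → Σ (Fin size) λ c → P y × Has y c × toℕ c ≡ k}
          where no none → pure (h , ph , λ x c px hc lt → abs x c px hc
                  (ℕ.≤∧≢⇒< (ℕ.≤-pred lt) λ e → none (x , c , px , hc , e)))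
        pure (hang h (replicate M y) , P-replicate M ph py , λ x c' px hc' lt →
          Eq-trans q (hang-⊕ q h x (replicate M y)) (case x c' hc' (toℕ c' ℕ.≟ k) (abs x c' px hc') lt y c hc eq))
        where
        case : ∀ {h} x c' → Has x c' → Dec (toℕ c' ≡ k) → (toℕ c' < k → Eq q (h ⊕ x) h) → toℕ c' < suc k →
          ∀ y c → Has y c → toℕ c ≡ k → Eq q (hang (h ⊕ x) (replicate M y)) (hang h (replicate M y))
        case {h} x c' hc' (no neq) abs lt y c hc eq = hang-cong q (replicate M y) (abs (ℕ.≤∧≢⇒< (ℕ.≤-pred lt) neq))
        case {h} x c' hc' (yes eq') abs lt y c hc eq with ≡.refl ← toℕ-injective (≡.trans eq' (≡.sym eq)) =
          Eq-trans q (hang-cong q (replicate M y) (Eq-⊕ q (Eq-refl q) (sound hc' hc)))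
            (Eq-sym q (proj₂ (absorption q b) h y M ℕ.≤-refl))

-- Satisfaction of MSO formulas and its invariance under the game.

module Logic where
  open import Defs
  open DoubleNegation
  open Game
  open import Data.Nat using (ℕ; zero; suc; _≤_; _⊔_; s≤s)
  import Data.Nat.Properties as ℕ
  open import Data.Fin using (Fin; zero; suc; _≟_)
  open import Data.Fin.Properties using (any?; all?)
  open import Data.Fin.Subset.Properties using (anySubset?)
  open import Data.Bool using (Bool; true)
  import Data.Bool as Bool
  import Data.Vec.Functional as VF
  import Data.Vec as Vec
  open import Data.Vec.Properties using (lookup∘tabulate)
  open import Data.Product using (Σ; _×_; _,_)
  open import Data.Sum using (inj₁; inj₂)
  open import Data.Empty using (⊥-elim)
  open import Relation.Nullary using (¬_; Dec; yes; no; ⌊_⌋; _×-dec_; _⊎-dec_; ¬?; map′; decidable-stable)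
  open import Relation.Binary.PropositionalEquality as ≡ using (_≡_)
  open import Function using (_∘_)

  ∷-cong : ∀ {A B : Set} {b} (S : A → B) {σ σ' : Fin b → A → B} → (∀ i v → σ i v ≡ σ' i v) →
    ∀ i v → (S VF.∷ σ) i v ≡ (S VF.∷ σ') i v
  ∷-cong S h zero v = ≡.refl
  ∷-cong S h (suc i) v = h i v

  Sat-resp : ∀ {n a b} {G : Adj n} {ρ : Fin a → Fin n} (φ : MSO a b) {σ σ' : Fin b → Fin n → Bool} →
    (∀ i v → σ i v ≡ σ' i v) → Sat G ρ σ φ → Sat G ρ σ' φ
  Sat-resp (mem x X) h p = ≡.trans (≡.sym (h X _)) p
  Sat-resp (edge x y) h p = p
  Sat-resp (and φ ψ) h (p , q) = Sat-resp φ h p , Sat-resp ψ h q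
  Sat-resp (or φ ψ) h (inj₁ p) = inj₁ (Sat-resp φ h p)
  Sat-resp (or φ ψ) h (inj₂ q) = inj₂ (Sat-resp ψ h q)
  Sat-resp (neg φ) h p q = p (Sat-resp φ (λ i v → ≡.sym (h i v)) q)
  Sat-resp (ex1 φ) h (v , p) = v , Sat-resp φ h p
  Sat-resp (all1 φ) h p v = Sat-resp φ h (p v)
  Sat-resp (ex2 φ) h (S , p) = S , Sat-resp φ (∷-cong S h) p
  Sat-resp (all2 φ) h p S = Sat-resp φ (∷-cong S h) (p S)

  -- Sets are searched as vectors, and tabulating a set returns it only up to pointwise equality;
  -- hence the condition that `P` respects it.
  any-Bool? : ∀ {n} (P : (Fin n → Bool) → Set) → (∀ {S T} → (∀ v → S v ≡ T v) → P S → P T) →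
    (∀ S → Dec (P S)) → Dec (Σ (Fin n → Bool) P)
  any-Bool? P resp P? = map′
    (λ { (s , p) → Vec.lookup s , p })
    (λ { (S , p) → Vec.tabulate S , resp (λ v → ≡.sym (lookup∘tabulate S v)) p })
    (anySubset? λ s → P? (Vec.lookup s))

  -- Decidability on a finite graph discharges the double negations of the game whenever the goal is
  -- satisfaction in a given graph.
  Sat? : ∀ {n a b} (G : Adj n) (ρ : Fin a → Fin n) (σ : Fin b → Fin n → Bool) φ → Dec (Sat G ρ σ φ)
  Sat-∃2? : ∀ {n a b} (G : Adj n) (ρ : Fin a → Fin n) (σ : Fin b → Fin n → Bool) (φ : MSO a (suc b)) →
    Dec (Σ (Fin n → Bool) λ S → ¬ Sat G ρ (S VF.∷ σ) φ)
  Sat? G ρ σ (mem x X) = σ X (ρ x) Bool.≟ true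
  Sat? G ρ σ (edge x y) = G (ρ x) (ρ y) Bool.≟ true
  Sat? G ρ σ (and φ ψ) = Sat? G ρ σ φ ×-dec Sat? G ρ σ ψ
  Sat? G ρ σ (or φ ψ) = Sat? G ρ σ φ ⊎-dec Sat? G ρ σ ψ
  Sat? G ρ σ (neg φ) = ¬? (Sat? G ρ σ φ)
  Sat? G ρ σ (ex1 φ) = any? λ v → Sat? G (v VF.∷ ρ) σ φ
  Sat? G ρ σ (all1 φ) = all? λ v → Sat? G (v VF.∷ ρ) σ φ
  Sat? G ρ σ (ex2 φ) = any-Bool? _ (λ h → Sat-resp φ λ { zero v → h v ; (suc i) v → ≡.refl })
    (λ S → Sat? G ρ (S VF.∷ σ) φ)
  Sat? G ρ σ (all2 φ) = map′
    (λ h S → decidable-stable (Sat? G ρ (S VF.∷ σ) φ) (λ n → h (S , n)))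
    (λ h → λ { (S , n) → n (h S) })
    (¬? (Sat-∃2? G ρ σ φ))
  Sat-∃2? G ρ σ φ = any-Bool? _
    (λ h n p → n (Sat-resp φ (λ { zero v → ≡.sym (h v) ; (suc i) v → ≡.refl }) p))
    (λ S → ¬? (Sat? G ρ (S VF.∷ σ) φ))

  rank : ∀ {a b} → MSO a b → ℕ
  rank (mem _ _) = 0
  rank (edge _ _) = 0
  rank (and φ ψ) = rank φ ⊔ rank ψ
  rank (or φ ψ) = rank φ ⊔ rank ψ
  rank (neg φ) = rank φ
  rank (ex1 φ) = suc (rank φ)
  rank (all1 φ) = suc (rank φ)
  rank (ex2 φ) = suc (rank φ)
  rank (all2 φ) = suc (rank φ)

  graph : ∀ {n b} → Adj n → (Fin n → Set) → (Fin b → Fin n → Bool) → Str b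
  graph {n} G R τ = record { V = Fin n ; E = λ v w → G v w ≡ true ; R = R ; σ = τ }

  Eq⇒Imp : ∀ {b} q {x y : Str b} → Eq q x y → Imp x y
  Eq⇒Imp zero (f , _) = f
  Eq⇒Imp (suc q) (e , _) = Eq⇒Imp q e

  -- A first-order variable is represented among the sets τ by a singleton.
  record Env {n a b c} (ρ : Fin a → Fin n) (σ : Fin b → Fin n → Bool)
             (τ : Fin c → Fin n → Bool) (α : Fin a → Fin c) (β : Fin b → Fin c) : Set where
    field
      only : ∀ i v → τ (α i) v ≡ true → v ≡ ρ i
      holds : ∀ i → τ (α i) (ρ i) ≡ true
      sets : ∀ j v → τ (β j) v ≡ σ j v
  open Env

  module _ {a c : ℕ} where
    α⁺ : (Fin a → Fin c) → Fin (suc a) → Fin (suc c)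
    α⁺ α zero = zero
    α⁺ α (suc i) = suc (α i)

  Env-ex1 : ∀ {n a b c ρ σ τ α β} → Env {n} {a} {b} {c} ρ σ τ α β → ∀ S v →
    (∀ w → S w ≡ true → w ≡ v) → S v ≡ true → Env (v VF.∷ ρ) σ (S VF.∷ τ) (α⁺ α) (suc ∘ β)
  Env-ex1 e S v o h = record
    { only = λ { zero w p → o w p ; (suc i) w p → only e i w p }
    ; holds = λ { zero → h ; (suc i) → holds e i }
    ; sets = sets e }

  Env-ex2 : ∀ {n a b c ρ σ τ α β} → Env {n} {a} {b} {c} ρ σ τ α β → ∀ S →
    Env ρ (S VF.∷ σ) (S VF.∷ τ) (suc ∘ α) (α⁺ β)
  Env-ex2 e S = record
    { only = only e ; holds = holds e
    ; sets = λ { zero v → ≡.refl ; (suc j) v → sets e j v } }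

  singleton : ∀ {n} → Fin n → Fin n → Bool
  singleton v w = ⌊ w ≟ v ⌋

  singleton-only : ∀ {n} (v w : Fin n) → singleton v w ≡ true → w ≡ v
  singleton-only v w p with yes eq ← w ≟ v = eq

  singleton-here : ∀ {n} (v : Fin n) → singleton v v ≡ true
  singleton-here v with v ≟ v
  ... | yes _ = ≡.refl
  ... | no n = ⊥-elim (n ≡.refl)

  -- By `meets` the reply is not empty, and two different members of it would, by `many` in the
  -- reverse direction, give two different members of a singleton. Thus a move by a vertex is
  -- answered by a vertex.
  reply : ∀ {n n' c q} {G : Adj n} {G' : Adj n'} {R R'} {τ : Fin c → Fin n → Bool} {τ' : Fin c → Fin n' → Bool} v S' →
    Eq q (graph G R τ ▸ singleton v) (graph G' R' τ' ▸ S') →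
    Σ (Fin n') λ v' → (∀ w → S' w ≡ true → w ≡ v') × S' v' ≡ true
  reply {q = q} v S' e with Imp.meets (Eq⇒Imp q e) zero zero (v , singleton-here v , singleton-here v)
  ... | v' , h , _ = v' , o , h
    where
    o : ∀ w → S' w ≡ true → w ≡ v'
    o w p with w ≟ v'
    ... | yes eq = eq
    ... | no neq with x , y , p' , q' , n ← Imp.many (Eq⇒Imp q (Eq-sym q e)) zero (w , v' , p , h , neq)
      = ⊥-elim (n (≡.trans (singleton-only v x p') (≡.sym (singleton-only v y q'))))

  -- Every quantifier of either order costs one move by a set. Negation exchanges the two graphs,
  -- and a universal quantifier plays the reverse game: the challenge is made in `G'` and answered
  -- in `G`.
  transfer : ∀ {a b c} (φ : MSO a b) q → rank φ ≤ q → ∀ {n n'} {G : Adj n} {G' : Adj n'} {R R' ρ ρ' σ σ' τ τ'}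
    {α : Fin a → Fin c} {β : Fin b → Fin c} → Env ρ σ τ α β → Env ρ' σ' τ' α β →
    Eq q (graph G R τ) (graph G' R' τ') → Sat G ρ σ φ → Sat G' ρ' σ' φ
  transfer (mem x X) q le {ρ = ρ} {α = α} {β} e e' E p
    with v , p' , q' ← Imp.meets (Eq⇒Imp q E) (α x) (β X) (ρ x , holds e x , ≡.trans (sets e X (ρ x)) p)
    with ≡.refl ← only e' x v p' = ≡.trans (≡.sym (sets e' X v)) q'
  transfer (edge x y) q le {ρ = ρ} {α = α} e e' E p
    with v , w , p' , q' , r ← Imp.linked (Eq⇒Imp q E) (α x) (α y) (ρ x , ρ y , holds e x , holds e y , p)
    with ≡.refl ← only e' x v p' | ≡.refl ← only e' y w q' = r
  transfer (and φ ψ) q le e e' E (p , p') =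
    transfer φ q (ℕ.m⊔n≤o⇒m≤o _ _ le) e e' E p , transfer ψ q (ℕ.m⊔n≤o⇒n≤o (rank φ) _ le) e e' E p'
  transfer (or φ ψ) q le e e' E (inj₁ p) = inj₁ (transfer φ q (ℕ.m⊔n≤o⇒m≤o _ _ le) e e' E p)
  transfer (or φ ψ) q le e e' E (inj₂ p) = inj₂ (transfer ψ q (ℕ.m⊔n≤o⇒n≤o (rank φ) _ le) e e' E p)
  transfer (neg φ) q le e e' E p p' = p (transfer φ q le e' e (Eq-sym q E) p')
  transfer (ex1 φ) (suc q) (s≤s le) {G' = G'} e e' (_ , E , _) (v , p) =
    decidable-stable (Sat? G' _ _ (ex1 φ)) do
      S' , E' ← E (singleton v)
      let v' , o , h = reply {q = q} v S' E'
      pure (v' , transfer φ q le (Env-ex1 e _ v (singleton-only v) (singleton-here v)) (Env-ex1 e' S' v' o h) E' p)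
  transfer (all1 φ) (suc q) (s≤s le) {G' = G'} e e' (_ , _ , E) p v' =
    decidable-stable (Sat? G' _ _ φ) do
      S , E' ← E (singleton v')
      let v , o , h = reply {q = q} v' S E'
      pure (transfer φ q le (Env-ex1 e S v o h) (Env-ex1 e' _ v' (singleton-only v') (singleton-here v')) (Eq-sym q E') (p v))
  transfer (ex2 φ) (suc q) (s≤s le) {G' = G'} e e' (_ , E , _) (S , p) =
    decidable-stable (Sat? G' _ _ (ex2 φ)) do
      S' , E' ← E S
      pure (S' , transfer φ q le (Env-ex2 e S) (Env-ex2 e' S') E' p)
  transfer (all2 φ) (suc q) (s≤s le) {G' = G'} e e' (_ , _ , E) p S' =
    decidable-stable (Sat? G' _ _ φ) do
      S , E' ← E S'
      pure (transfer φ q le (Env-ex2 e S) (Env-ex2 e' S') (Eq-sym q E') (p S))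

  Eq-models : ∀ {n n'} {G : Adj n} {G' : Adj n'} {R R'} φ →
    Eq (rank φ) (graph G R λ ()) (graph G' R' λ ()) → Models G φ → Models G' φ
  Eq-models φ = transfer φ (rank φ) ℕ.≤-refl {α = λ ()} {β = λ ()} noVars noVars
    where
    noVars : ∀ {n} → Env {n} {0} {0} {0} (λ ()) (λ ()) (λ ()) (λ ()) (λ ())
    noVars = record { only = λ () ; holds = λ () ; sets = λ () }

-- Shuffles of vertex sets and graphs joined by a bridge.

module Join where
  open import Defs
  open import Data.Nat using (ℕ; zero; suc; _+_; _*_; _!)
  import Data.Nat.Properties as ℕ
  open import Data.Nat.Tactic.RingSolver using (solve-∀)
  open import Data.Fin using (Fin; zero; suc; _≟_; splitAt; join)
  open import Data.Fin.Properties using (any?; injective⇒≤; join-splitAt)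
  open import Data.Bool using (Bool; true; false; _∧_)
  open import Data.Bool.Properties using (∧-comm; ∨-identityʳ; ∧-zeroʳ)
  open import Data.Product using (Σ; _×_; _,_; proj₁)
  open import Data.Sum as Sum using (_⊎_; inj₁; inj₂; [_,_]′)
  open import Data.Sum.Properties using (inj₁-injective; inj₂-injective)
  open import Data.Empty using (⊥-elim)
  open import Relation.Nullary using (¬_; Dec; yes; no; ⌊_⌋)
  open import Relation.Binary.PropositionalEquality using (_≡_; _≢_; refl; cong; cong₂; sym; trans)

  open import Function.Definitions using (Injective)

  -- The ways to place [a] and [b] on complementary subsets of [n], preserving both orders.
  data Shuffle : ℕ → ℕ → ℕ → Set where
    []    : Shuffle 0 0 0
    left  : ∀ {a b n} → Shuffle a b n → Shuffle (suc a) b (suc n)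
    right : ∀ {a b n} → Shuffle a b n → Shuffle a (suc b) (suc n)

  inl : ∀ {a b n} → Shuffle a b n → Fin a → Fin n
  inl (left s) zero = zero
  inl (left s) (suc x) = suc (inl s x)
  inl (right s) x = suc (inl s x)

  inr : ∀ {a b n} → Shuffle a b n → Fin b → Fin n
  inr (left s) y = suc (inr s y)
  inr (right s) zero = zero
  inr (right s) (suc y) = suc (inr s y)

  split : ∀ {a b n} → Shuffle a b n → Fin n → Fin a ⊎ Fin b
  split (left s) zero = inj₁ zero
  split (left s) (suc i) = Sum.map₁ suc (split s i)
  split (right s) zero = inj₂ zero
  split (right s) (suc i) = Sum.map₂ suc (split s i)

  split-inl : ∀ {a b n} (s : Shuffle a b n) x → split s (inl s x) ≡ inj₁ x
  split-inl (left s) zero = refl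
  split-inl (left s) (suc x) = cong (Sum.map₁ suc) (split-inl s x)
  split-inl (right s) x = cong (Sum.map₂ suc) (split-inl s x)

  split-inr : ∀ {a b n} (s : Shuffle a b n) y → split s (inr s y) ≡ inj₂ y
  split-inr (left s) y = cong (Sum.map₁ suc) (split-inr s y)
  split-inr (right s) zero = refl
  split-inr (right s) (suc y) = cong (Sum.map₂ suc) (split-inr s y)

  data View {a b n} (s : Shuffle a b n) : Fin n → Set where
    isL : ∀ x → View s (inl s x)
    isR : ∀ y → View s (inr s y)

  view : ∀ {a b n} (s : Shuffle a b n) i → View s i
  view (left s) zero = isL zero
  view (left s) (suc i) with view s i
  ... | isL x = isL (suc x)
  ... | isR y = isR y
  view (right s) zero = isR zero
  view (right s) (suc i) with view s i
  ... | isL x = isL x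
  ... | isR y = isR (suc y)

  inl-injective : ∀ {a b n} (s : Shuffle a b n) {x y} → inl s x ≡ inl s y → x ≡ y
  inl-injective s {x} {y} e = inj₁-injective (trans (sym (split-inl s x)) (trans (cong (split s) e) (split-inl s y)))

  inr-injective : ∀ {a b n} (s : Shuffle a b n) {x y} → inr s x ≡ inr s y → x ≡ y
  inr-injective s {x} {y} e = inj₂-injective (trans (sym (split-inr s x)) (trans (cong (split s) e) (split-inr s y)))

  inl≢inr : ∀ {a b n} (s : Shuffle a b n) {x y} → inl s x ≢ inr s y
  inl≢inr s {x} {y} e with () ← trans (sym (split-inl s x)) (trans (cong (split s) e) (split-inr s y))

  isRight : ∀ {a b n} → Shuffle a b n → Fin n → Bool
  isRight s i = [ (λ _ → false) , (λ _ → true) ]′ (split s i)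

  isRight-map₁ : ∀ {a a' b : ℕ} (f : Fin a → Fin a') (z : Fin a ⊎ Fin b) →
    [ (λ _ → false) , (λ _ → true) ]′ (Sum.map₁ f z) ≡ [ (λ _ → false) , (λ _ → true) ]′ z
  isRight-map₁ f (inj₁ _) = refl
  isRight-map₁ f (inj₂ _) = refl

  isRight-map₂ : ∀ {a b b' : ℕ} (f : Fin b → Fin b') (z : Fin a ⊎ Fin b) →
    [ (λ _ → false) , (λ _ → true) ]′ (Sum.map₂ f z) ≡ [ (λ _ → false) , (λ _ → true) ]′ z
  isRight-map₂ f (inj₁ _) = refl
  isRight-map₂ f (inj₂ _) = refl

  shuffle-ext : ∀ {a b n} (s s' : Shuffle a b n) → (∀ i → isRight s i ≡ isRight s' i) → s ≡ s'
  shuffle-ext [] [] h = refl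
  shuffle-ext (left s) (left s') h = cong left (shuffle-ext s s' λ i →
    trans (sym (isRight-map₁ suc (split s i))) (trans (h (suc i)) (isRight-map₁ suc (split s' i))))
  shuffle-ext (left s) (right s') h with () ← h zero
  shuffle-ext (right s) (left s') h with () ← h zero
  shuffle-ext (right s) (right s') h = cong right (shuffle-ext s s' λ i →
    trans (sym (isRight-map₂ suc (split s i))) (trans (h (suc i)) (isRight-map₂ suc (split s' i))))

  -- The binomial coefficient by Pascal's rule, for `a + b ≡ n`, and 0 otherwise.
  #shuffles : ℕ → ℕ → ℕ → ℕ
  #left : ℕ → ℕ → ℕ → ℕ
  #right : ℕ → ℕ → ℕ → ℕ
  #shuffles zero zero zero = 1
  #shuffles zero zero (suc b) = 0
  #shuffles zero (suc a) b = 0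
  #shuffles (suc n) a b = #left n a b + #right n a b
  #left n zero b = 0
  #left n (suc a) b = #shuffles n a b
  #right n a zero = 0
  #right n a (suc b) = #shuffles n a b

  -- Multiplied by `a ! * b !`, the two terms of Pascal's rule give `a * n !` and `b * n !`, which
  -- add up to `suc n` times `n !`.
  #shuffles-! : ∀ n a b → a + b ≡ n → #shuffles n a b * (a ! * b !) ≡ n !
  #left-! : ∀ n a b → a + b ≡ suc n → #left n a b * (a ! * b !) ≡ a * n !
  #right-! : ∀ n a b → a + b ≡ suc n → #right n a b * (a ! * b !) ≡ b * n !
  #shuffles-! zero zero zero e = refl
  #shuffles-! (suc n) a b e = trans (ℕ.*-distribʳ-+ (a ! * b !) (#left n a b) (#right n a b))
    (trans (cong₂ _+_ (#left-! n a b e) (#right-! n a b e))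
      (trans (sym (ℕ.*-distribʳ-+ (n !) a b)) (cong (_* n !) e)))
  #left-! n zero b e = refl
  #left-! n (suc a) b e = trans (lemma (#shuffles n a b) (suc a) (a !) (b !))
    (cong (suc a *_) (#shuffles-! n a b (ℕ.suc-injective e)))
    where
    lemma : ∀ c m x y → c * (m * x * y) ≡ m * (c * (x * y))
    lemma = solve-∀
  #right-! n a zero e = refl
  #right-! n a (suc b) e = trans (lemma (#shuffles n a b) (suc b) (a !) (b !))
    (cong (suc b *_) (#shuffles-! n a b (ℕ.suc-injective (trans (sym (ℕ.+-suc a b)) e))))
    where
    lemma : ∀ c m x y → c * (x * (m * y)) ≡ m * (c * (x * y))
    lemma = solve-∀

  shuffle : ∀ n a b → Fin (#shuffles n a b) → Shuffle a b n
  leftShuffle : ∀ n a b → Fin (#left n a b) → Shuffle a b (suc n)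
  rightShuffle : ∀ n a b → Fin (#right n a b) → Shuffle a b (suc n)
  shuffle zero zero zero i = []
  shuffle (suc n) a b i = [ leftShuffle n a b , rightShuffle n a b ]′ (splitAt (#left n a b) i)
  leftShuffle n (suc a) b i = left (shuffle n a b i)
  rightShuffle n a (suc b) i = right (shuffle n a b i)

  shuffle-injective : ∀ n a b {i j} → shuffle n a b i ≡ shuffle n a b j → i ≡ j
  shuffle-injective zero zero zero {zero} {zero} e = refl
  shuffle-injective (suc n) a b {i} {j} e =
    trans (sym (join-splitAt (#left n a b) (#right n a b) i))
      (trans (cong (join (#left n a b) (#right n a b)) (go a b (splitAt (#left n a b) i) (splitAt (#left n a b) j) e))
        (join-splitAt (#left n a b) (#right n a b) j))
    where
    left-inj : ∀ {a b n} {s s' : Shuffle a b n} → left s ≡ left s' → s ≡ s'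
    left-inj refl = refl
    right-inj : ∀ {a b n} {s s' : Shuffle a b n} → right s ≡ right s' → s ≡ s'
    right-inj refl = refl
    go : ∀ a b → (p q : Fin (#left n a b) ⊎ Fin (#right n a b)) →
      [ leftShuffle n a b , rightShuffle n a b ]′ p ≡ [ leftShuffle n a b , rightShuffle n a b ]′ q → p ≡ q
    go (suc a) b (inj₁ x) (inj₁ y) e = cong inj₁ (shuffle-injective n a b (left-inj e))
    go (suc a) (suc b) (inj₁ x) (inj₂ y) ()
    go (suc a) (suc b) (inj₂ x) (inj₁ y) ()
    go a (suc b) (inj₂ x) (inj₂ y) e = cong inj₂ (shuffle-injective n a b (right-inj e))

  module _ {n : ℕ} {G : Adj n} where
    Reachable-trans : ∀ {i j k} → Reachable G i j → Reachable G j k → Reachable G i k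
    Reachable-trans here q = q
    Reachable-trans (step e p) q = step e (Reachable-trans p q)

    Reachable-closed : ∀ (P : Fin n → Set) → (∀ {i j} → G i j ≡ true → P i → P j) →
      ∀ {i j} → Reachable G i j → P i → P j
    Reachable-closed P c here p = p
    Reachable-closed P c (step e r) p = Reachable-closed P c r (c e p)

    crossing : ∀ {P : Fin n → Set} → (∀ i → Dec (P i)) → ∀ {i j} → Reachable G i j → P i → ¬ P j →
      Σ (Fin n) λ k → Σ (Fin n) λ l → G k l ≡ true × P k × ¬ P l
    crossing P? here p ¬p = ⊥-elim (¬p p)
    crossing P? (step {i} {j} e r) p ¬p with P? j
    ... | yes q = crossing P? r q ¬p
    ... | no ¬q = i , j , e , p , ¬q

  Reachable-map : ∀ {m n} {G : Adj m} {H : Adj n} (f : Fin m → Fin n) →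
    (∀ {i j} → G i j ≡ true → H (f i) (f j) ≡ true) → ∀ {i j} → Reachable G i j → Reachable H (f i) (f j)
  Reachable-map f h here = here
  Reachable-map f h (step e r) = step (h e) (Reachable-map f h r)

  injective⇒surjective : ∀ {n} {f : Fin n → Fin n} → Injective _≡_ _≡_ f → ∀ i → Σ (Fin n) λ j → f j ≡ i
  injective⇒surjective {n} {f} inj i with any? (λ j → f j ≟ i)
  ... | yes p = p
  ... | no ¬p = ⊥-elim (ℕ.1+n≰n (injective⇒≤ {f = g} g-inj))
    where
    g : Fin (suc n) → Fin n
    g zero = i
    g (suc j) = f j
    g-inj : Injective _≡_ _≡_ g
    g-inj {zero} {zero} e = refl
    g-inj {zero} {suc y} e = ⊥-elim (¬p (y , sym e))
    g-inj {suc x} {zero} e = ⊥-elim (¬p (x , e))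
    g-inj {suc x} {suc y} e = cong suc (inj e)

  edgeSum : ∀ {a b} → Adj a → Adj b → (Fin a → Fin b → Bool) → Fin a ⊎ Fin b → Fin a ⊎ Fin b → Bool
  edgeSum G H B (inj₁ x) (inj₁ y) = G x y
  edgeSum G H B (inj₁ x) (inj₂ y) = B x y
  edgeSum G H B (inj₂ x) (inj₁ y) = B y x
  edgeSum G H B (inj₂ x) (inj₂ y) = H x y

  module _ {a b n : ℕ} (s : Shuffle a b n) (G : Adj a) (H : Adj b) where
    combine : (Fin a → Fin b → Bool) → Adj n
    combine B i j = edgeSum G H B (split s i) (split s j)

    module _ (B : Fin a → Fin b → Bool) where
      combine-ll : ∀ x y → combine B (inl s x) (inl s y) ≡ G x y
      combine-ll x y = cong₂ (edgeSum G H B) (split-inl s x) (split-inl s y)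
      combine-lr : ∀ x y → combine B (inl s x) (inr s y) ≡ B x y
      combine-lr x y = cong₂ (edgeSum G H B) (split-inl s x) (split-inr s y)
      combine-rl : ∀ x y → combine B (inr s y) (inl s x) ≡ B x y
      combine-rl x y = cong₂ (edgeSum G H B) (split-inr s y) (split-inl s x)
      combine-rr : ∀ x y → combine B (inr s x) (inr s y) ≡ H x y
      combine-rr x y = cong₂ (edgeSum G H B) (split-inr s x) (split-inr s y)

      combine-isGraph : IsGraph G → IsGraph H → IsGraph (combine B)
      combine-isGraph (sG , lG) (sH , lH) = symm , loop
        where
        symm : ∀ i j → combine B i j ≡ combine B j i
        symm i j with split s i | split s j
        ... | inj₁ x | inj₁ y = sG x y
        ... | inj₁ x | inj₂ y = refl
        ... | inj₂ x | inj₁ y = refl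
        ... | inj₂ x | inj₂ y = sH x y
        loop : ∀ i → combine B i i ≡ false
        loop i with split s i
        ... | inj₁ x = lG x
        ... | inj₂ x = lH x

    disjoint : Adj n
    disjoint = combine (λ _ _ → false)

    bridge : Fin a → Fin b → Adj n
    bridge v u = combine (λ x y → ⌊ x ≟ v ⌋ ∧ ⌊ y ≟ u ⌋)

  ≟-true : ∀ {n} {x v : Fin n} → ⌊ x ≟ v ⌋ ≡ true → x ≡ v
  ≟-true {x = x} {v} e with yes p ← x ≟ v = p

  ≟-refl : ∀ {n} (x : Fin n) → ⌊ x ≟ x ⌋ ≡ true
  ≟-refl x with x ≟ x
  ... | yes _ = refl
  ... | no n = ⊥-elim (n refl)

  ≟-cong : ∀ {m n} {x v : Fin m} {f : Fin m → Fin n} → Injective _≡_ _≡_ f → ⌊ f x ≟ f v ⌋ ≡ ⌊ x ≟ v ⌋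
  ≟-cong {x = x} {v} {f} inj with x ≟ v | f x ≟ f v
  ... | yes _ | yes _ = refl
  ... | no _ | no _ = refl
  ... | yes e | no n = ⊥-elim (n (cong f e))
  ... | no n | yes e = ⊥-elim (n (inj e))

  ≟-false : ∀ {n} {x v : Fin n} → x ≢ v → ⌊ x ≟ v ⌋ ≡ false
  ≟-false {x = x} {v} n with x ≟ v
  ... | yes e = ⊥-elim (n e)
  ... | no _ = refl

  ∧-true : ∀ {x y} → x ∧ y ≡ true → x ≡ true × y ≡ true
  ∧-true {true} {true} e = refl , refl

  module _ {a b n : ℕ} (s : Shuffle a b n) (G : Adj a) (H : Adj b) (v : Fin a) (u : Fin b) where
    private J = bridge s G H v u ; D = disjoint s G H

    bridge-edge : J (inl s v) (inr s u) ≡ true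
    bridge-edge = trans (combine-lr s G H _ v u) (cong₂ _∧_ (≟-refl v) (≟-refl u))

    bridge-edge⁻¹ : ∀ x y → J (inl s x) (inr s y) ≡ true → x ≡ v × y ≡ u
    bridge-edge⁻¹ x y e with p , q ← ∧-true (trans (sym (combine-lr s G H _ x y)) e) = ≟-true p , ≟-true q

    bridge-sym : IsGraph G → IsGraph H → ∀ i j → J i j ≡ J j i
    bridge-sym g h = proj₁ (combine-isGraph s G H _ g h)

    bridge-connected : IsGraph G → IsGraph H → Connected G → Connected H → Connected J
    bridge-connected g h (x₀ , cG) (_ , cH) = inl s x₀ , λ i j → go (view s i) (view s j)
      where
      ll : ∀ {x y} → Reachable G x y → Reachable J (inl s x) (inl s y)
      ll = Reachable-map (inl s) λ {i} {j} e → trans (combine-ll s G H _ i j) e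
      rr : ∀ {x y} → Reachable H x y → Reachable J (inr s x) (inr s y)
      rr = Reachable-map (inr s) λ {i} {j} e → trans (combine-rr s G H _ i j) e
      go : ∀ {i j} → View s i → View s j → Reachable J i j
      go (isL x) (isL y) = ll (cG x y)
      go (isR x) (isR y) = rr (cH x y)
      go (isL x) (isR y) = Reachable-trans (ll (cG x v)) (step bridge-edge (rr (cH u y)))
      go (isR x) (isL y) = Reachable-trans (rr (cH x u))
        (step (trans (bridge-sym g h _ _) bridge-edge) (ll (cG v y)))

    -- Bridge-addability speaks of `addEdge`, whereas the counting works with `bridge`, whose
    -- entries are read off from the two sides.
    bridge≗addEdge : ∀ i j → addEdge D (inl s v) (inr s u) i j ≡ J i j
    bridge≗addEdge i j = go (view s i) (view s j)
      where
      L = inl-injective s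
      Rr = inr-injective s
      N : ∀ {x y} → ⌊ inl s x ≟ inr s y ⌋ ≡ false
      N = ≟-false (inl≢inr s)
      N' : ∀ {x y} → ⌊ inr s y ≟ inl s x ⌋ ≡ false
      N' = ≟-false (λ e → inl≢inr s (sym e))
      go : ∀ {i j} → View s i → View s j → addEdge D (inl s v) (inr s u) i j ≡ J i j
      go (isL x) (isL y) rewrite N {y} {u} | N {x} {u} | combine-ll s G H (λ _ _ → false) x y
        | combine-ll s G H (λ x y → ⌊ x ≟ v ⌋ ∧ ⌊ y ≟ u ⌋) x y
        | ∧-zeroʳ ⌊ inl s x ≟ inl s v ⌋ = ∨-identityʳ (G x y)
      go (isL x) (isR y) rewrite N {x} {u} | combine-lr s G H (λ _ _ → false) x y
        | combine-lr s G H (λ x y → ⌊ x ≟ v ⌋ ∧ ⌊ y ≟ u ⌋) x y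
        | ≟-cong {x = x} {v} L | ≟-cong {x = y} {u} Rr = ∨-identityʳ _
      go (isR x) (isL y) rewrite N' {v} {x} | combine-rl s G H (λ _ _ → false) y x
        | combine-rl s G H (λ x y → ⌊ x ≟ v ⌋ ∧ ⌊ y ≟ u ⌋) y x
        | ≟-cong {x = y} {v} L | ≟-cong {x = x} {u} Rr = ∧-comm ⌊ x ≟ u ⌋ ⌊ y ≟ v ⌋
      go (isR x) (isR y) rewrite N' {v} {x} | N' {v} {y} | combine-rr s G H (λ _ _ → false) x y
        | combine-rr s G H (λ x y → ⌊ x ≟ v ⌋ ∧ ⌊ y ≟ u ⌋) x y
        | ∧-zeroʳ ⌊ inr s x ≟ inr s u ⌋ = ∨-identityʳ (H x y)

-- Closure of the connected members under joining by a bridge.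

module Closure where
  open import Defs
  open Join
  open import Data.Nat using (ℕ; zero; suc)
  import Data.Nat.Properties as ℕ
  open import Data.Fin using (Fin; zero; suc)
  open import Data.Fin.Properties using (injective⇒≤)
  open import Data.Bool using (true; false)
  open import Data.Product using (Σ; _,_; proj₁; proj₂)
  open import Relation.Nullary using (¬_)
  open import Relation.Binary.PropositionalEquality using (_≡_; refl; cong; cong₂; sym; trans)
  open import Function using (id; mk↔ₛ′)
  open import Function.Definitions using (Injective)

  IsGraph-resp : ∀ {n} {G H : Adj n} → (∀ i j → G i j ≡ H i j) → IsGraph G → IsGraph H
  IsGraph-resp h (s , l) =
    (λ i j → trans (sym (h i j)) (trans (s i j) (h j i))) , λ i → trans (sym (h i i)) (l i)

  Connected-resp : ∀ {n} {G H : Adj n} → (∀ i j → G i j ≡ H i j) → Connected G → Connected H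
  Connected-resp h (x , c) = x , λ i j → Reachable-map id (λ {k} {l} e → trans (sym (h k l)) e) (c i j)

  module _ {C : Class} (iso : IsoClosed C) where
    C-resp : ∀ {n} {G H : Adj n} → IsGraph G → (∀ i j → G i j ≡ H i j) → C n G → C n H
    C-resp g h = iso _ _ _ (mk↔ₛ′ id id (λ _ → refl) (λ _ → refl)) g (λ i j → sym (h i j))

    InConn-resp : ∀ {n} {G H : Adj n} → (∀ i j → G i j ≡ H i j) → InConn C n G → InConn C n H
    InConn-resp h ((g , c) , k) = (IsGraph-resp h g , C-resp g h c) , Connected-resp h k

    -- `IsoClosed` concerns permutations of one `Fin n`, so a bijection between `Fin n` and `Fin m`
    -- is first used to identify `m` with `n`.
    C-iso : ∀ {m n} {G : Adj m} {H : Adj n} → IsGraph G → (f : Fin n → Fin m) → Injective _≡_ _≡_ f →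
      (∀ x → Σ (Fin n) λ y → f y ≡ x) → (∀ i j → H i j ≡ G (f i) (f j)) → C m G → C n H
    C-iso {m} {n} {G} {H} g f inj sur h c = go m≡n f inj sur h
      where
      f⁻¹ : Fin m → Fin n
      f⁻¹ x = proj₁ (sur x)
      m≡n : m ≡ n
      m≡n = ℕ.≤-antisym
        (injective⇒≤ {f = f⁻¹} λ {x} {y} e → trans (sym (proj₂ (sur x))) (trans (cong f e) (proj₂ (sur y))))
        (injective⇒≤ inj)
      go : ∀ {n} {H : Adj n} → m ≡ n → (f : Fin n → Fin m) → Injective _≡_ _≡_ f →
        (∀ x → Σ (Fin n) λ y → f y ≡ x) → (∀ i j → H i j ≡ G (f i) (f j)) → C n H
      go refl f inj sur h = iso m G _
        (mk↔ₛ′ (λ x → proj₁ (sur x)) f (λ y → inj (proj₂ (sur (f y)))) (λ x → proj₂ (sur x))) g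
        (λ i j → trans (h _ _) (cong₂ G (proj₂ (sur i)) (proj₂ (sur j)))) c

    -- The component and the copy of `G` are both connected and closed under adjacency. As they
    -- share a vertex, each contains the other.
    component : ∀ {a n} {D : Adj n} {G : Adj a} → IsGraph G → Connected G → C a G →
      (ι : Fin a → Fin n) → Injective _≡_ _≡_ ι → (∀ x y → D (ι x) (ι y) ≡ G x y) →
      (∀ x w → D (ι x) w ≡ true → Σ (Fin a) λ y → ι y ≡ w) →
      ∀ k (e : Fin (suc k) → Fin n) → IsComponentEmb D e → ∀ x → e zero ≡ ι x → C (suc k) (induced D e)
    component {a} {n} {D} {G} g (_ , cG) c ι ι-inj ιG closed k e (e-inj , (_ , ce) , e-closed) x₀ e₀ =
      C-iso g f (λ {i} {j} eq → e-inj (trans (sym (ιf i)) (trans (cong ι eq) (ιf j)))) f-sur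
        (λ i j → trans (cong₂ D (sym (ιf i)) (sym (ιf j))) (ιG (f i) (f j))) c
      where
      into : ∀ i → Σ (Fin a) λ x → ι x ≡ e i
      into i = Reachable-closed (λ i → Σ (Fin a) λ x → ι x ≡ e i)
        (λ { {i} {j} d (x , eq) → closed x (e j) (trans (cong (λ z → D z (e j)) eq) d) })
        (ce zero i) (x₀ , sym e₀)
      f : Fin (suc k) → Fin a
      f i = proj₁ (into i)
      ιf : ∀ i → ι (f i) ≡ e i
      ιf i = proj₂ (into i)
      f-sur : ∀ x → Σ (Fin (suc k)) λ i → f i ≡ x
      f-sur x with i , eq ← Reachable-closed (λ x → Σ (Fin (suc k)) λ i → e i ≡ ι x)
          (λ { {x} {y} d (i , eq) → e-closed i (ι y) (trans (cong (λ z → D z (ι y)) eq) (trans (ιG x y) d)) })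
          (cG x₀ x) (zero , e₀)
        = i , ι-inj (trans (ιf i) eq)

    -- The disjoint union belongs to `C` by decomposability, since its components are copies of `G`
    -- and `H`; the ends of the bridge lie in different components of it.
    bridge-InConn : Addable C → ∀ {a b n} (s : Shuffle a b n) {G : Adj a} {H : Adj b} v u →
      InConn C a G → InConn C b H → InConn C n (bridge s G H v u)
    bridge-InConn (dec , add) {a} {b} {n} s {G} {H} v u ((gG , cG) , kG) ((gH , cH) , kH) =
      (combine-isGraph s G H _ gG gH ,
       C-resp (IsGraph-resp (λ i j → sym (bridge≗addEdge s G H v u i j)) (combine-isGraph s G H _ gG gH))
         (bridge≗addEdge s G H v u) (add n D _ _ gD cD apart)) ,
      bridge-connected s G H v u gG gH kG kH
      where
      D = disjoint s G H
      gD : IsGraph D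
      gD = combine-isGraph s G H _ gG gH
      closedL : ∀ x w → D (inl s x) w ≡ true → Σ (Fin a) λ y → inl s y ≡ w
      closedL x w e with view s w
      ... | isL y = y , refl
      ... | isR y with () ← trans (sym (combine-lr s G H _ x y)) e
      closedR : ∀ x w → D (inr s x) w ≡ true → Σ (Fin b) λ y → inr s y ≡ w
      closedR x w e with view s w
      ... | isR y = y , refl
      ... | isL y with () ← trans (sym (combine-rl s G H _ y x)) e
      cD : C n D
      cD = proj₂ (dec n D gD) λ k e ce → comp k e ce (view s (e zero)) refl
        where
        comp : ∀ k e → IsComponentEmb D e → ∀ {i} → View s i → e zero ≡ i → C (suc k) (induced D e)
        comp k e ce (isL x) eq = component {D = D} gG kG cG (inl s) (inl-injective s) (combine-ll s G H (λ _ _ → false)) closedL k e ce x eq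
        comp k e ce (isR y) eq = component {D = D} gH kH cH (inr s) (inr-injective s) (combine-rr s G H (λ _ _ → false)) closedR k e ce y eq
      apart : ¬ Reachable D (inl s v) (inr s u)
      apart r with y , e ← Reachable-closed (λ w → Σ (Fin a) λ y → inl s y ≡ w)
          (λ { d (y , refl) → closedL y _ d }) r (v , refl) = inl≢inr s e

-- Pendant sets, their laminarity and the decoding of joined graphs.

module Pendant where
  open import Defs
  open Join
  open import Data.Nat using (ℕ; suc; _+_; _<_)
  import Data.Nat.Properties as ℕ
  open import Data.Fin using (Fin; _≟_; join; splitAt)
  open import Data.Fin.Properties using (any?; injective⇒≤; ¬∀⟶∃¬; splitAt-join)
  open import Data.Bool using (Bool; true; false)
  open import Data.Product using (Σ; _×_; _,_; proj₁; proj₂)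
  open import Data.Sum using (_⊎_; inj₁; inj₂; [_,_]′)
  open import Data.Empty using (⊥; ⊥-elim)
  open import Relation.Nullary using (¬_; Dec; yes; no; _⊎-dec_)
  open import Relation.Binary.PropositionalEquality using (_≡_; refl; cong; cong₂; subst; sym; trans)
  open import Function using (_∘_; id)
  open import Function.Definitions using (Injective)

  Image : ∀ {b n} → (Fin b → Fin n) → Fin n → Set
  Image {b} e x = Σ (Fin b) λ i → e i ≡ x

  image? : ∀ {b n} (e : Fin b → Fin n) x → Dec (Image e x)
  image? e x = any? λ i → e i ≟ x

  image-⊆ : ∀ {b n} {e e' : Fin b → Fin n} → Injective _≡_ _≡_ e → Injective _≡_ _≡_ e' →
    (∀ i → Image e' (e i)) → ∀ j → Image e (e' j)
  image-⊆ {e = e} {e'} inj inj' h j with i , eq ← injective⇒surjective {f = proj₁ ∘ h}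
      (λ {x} {y} eq → inj (trans (sym (proj₂ (h x))) (trans (cong e' eq) (proj₂ (h y))))) j
    = i , trans (sym (proj₂ (h i))) (cong e' eq)

  uncovered : ∀ {m n} (e : Fin m → Fin n) → m < n → Σ (Fin n) λ z → ¬ Image e z
  uncovered {m} {n} e lt = ¬∀⟶∃¬ n _ (image? e) λ h → ℕ.<⇒≱ lt
    (injective⇒≤ {f = proj₁ ∘ h} λ {x} {y} eq → trans (sym (proj₂ (h x))) (trans (cong e eq) (proj₂ (h y))))

  record Pend {n b} (G : Adj n) (e : Fin b → Fin n) (r : Fin b) (w : Fin n) : Set where
    field
      inj : Injective _≡_ _≡_ e
      conn : ∀ i j → Reachable (induced G e) i j
      outside : ¬ Image e w
      exit : G (e r) w ≡ true
      leave : ∀ i x → G (e i) x ≡ true → Image e x ⊎ (i ≡ r × x ≡ w)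
  open Pend public

  Pend-resp : ∀ {n b} {G G' : Adj n} {e : Fin b → Fin n} {r w} → (∀ i j → G i j ≡ G' i j) → Pend G e r w → Pend G' e r w
  Pend-resp {e = e} h p = record
    { inj = inj p ; outside = outside p ; exit = trans (sym (h _ _)) (exit p)
    ; conn = λ i j → Reachable-map id (λ {k} {l} x → trans (sym (h (e k) (e l))) x) (conn p i j)
    ; leave = λ i x d → leave p i x (trans (h _ _) d) }

  -- If the two sets overlapped properly, the exit edge of each would end in the other,
  -- so no edge could lead from their union to the rest of the graph.
  laminar : ∀ {n b} {G : Adj n} {e e' : Fin b → Fin n} {r r' w w'} → b + b < n → (∀ i j → Reachable G i j) →
    Pend G e r w → Pend G e' r' w' → ∀ {p p'} → e p ≡ e' p' → ∀ i → Image e' (e i)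
  laminar {n} {b} {G} {e} {e'} {r} {r'} {w} {w'} lt c P P' {p} {p'} meet i with image? e' (e i)
  ... | yes h = h
  ... | no ¬h = ⊥-elim absurd
    where
    exit-in : ∀ {e e' : Fin b → Fin n} {r r' w w'} → Pend G e r w → Pend G e' r' w' →
      ∀ {p p' i} → e p ≡ e' p' → ¬ Image e' (e i) → Image e w'
    exit-in {e} {e'} P P' {p} {p'} {i} meet ¬h
      with k , l , d , (k' , eq) , ¬l ← crossing (λ i → image? e' (e i)) (conn P p i) (p' , sym meet) ¬h
      with leave P' k' (e l) (trans (cong (λ z → G z (e l)) eq) d)
    ... | inj₁ q = ⊥-elim (¬l q)
    ... | inj₂ (_ , q) = l , q
    both : Fin (b + b) → Fin n
    both = [ e , e' ]′ ∘ splitAt b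
    in-both : ∀ {z} → Image e z ⊎ Image e' z → Image both z
    in-both (inj₁ (x , eq)) = join b b (inj₁ x) , trans (cong [ e , e' ]′ (splitAt-join b b (inj₁ x))) eq
    in-both (inj₂ (x , eq)) = join b b (inj₂ x) , trans (cong [ e , e' ]′ (splitAt-join b b (inj₂ x))) eq
    stuck : ∀ {y} → ¬ Image e (e' y) → ∀ {k l} → G k l ≡ true → Image e k ⊎ Image e' k → ¬ ¬ (Image e l ⊎ Image e' l)
    stuck ¬y {l = l} d (inj₁ (x , refl)) ¬l with leave P x l d
    ... | inj₁ q = ¬l (inj₁ q)
    ... | inj₂ (_ , refl) = ¬l (inj₂ (exit-in P' P (sym meet) ¬y))
    stuck ¬y {l = l} d (inj₂ (x , refl)) ¬l with leave P' x l d
    ... | inj₁ q = ¬l (inj₂ q)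
    ... | inj₂ (_ , refl) = ¬l (inj₁ (exit-in P P' meet ¬h))
    absurd : ⊥
    absurd
      -- By `b + b < n` some vertex is outside both sets, so connectedness demands an edge leaving
      -- their union.
      with z , ¬z ← uncovered both lt
      -- The sizes are equal: were the image of `e'` inside that of `e`, the two would coincide,
      -- against `¬h`. So the overlap is proper on both sides.
      with y , ¬y ← ¬∀⟶∃¬ b _ (λ j → image? e (e' j)) (λ h → ¬h (image-⊆ (inj P') (inj P) h i))
      with k , l , d , hk , ¬l ← crossing (λ x → image? e x ⊎-dec image? e' x) (c (e p) z) (inj₁ (p , refl)) (¬z ∘ in-both)
      = stuck ¬y d hk ¬l

  module _ {a b n : ℕ} (s : Shuffle a b n) (G : Adj a) (H : Adj b) (v : Fin a) (u : Fin b) where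
    bridge-pend : IsGraph G → IsGraph H → Connected H → Pend (bridge s G H v u) (inr s) u (inl s v)
    bridge-pend gG gH (_ , cH) = record
      { inj = inr-injective s
      ; conn = λ i j → Reachable-map id (λ {k} {l} e → trans (combine-rr s G H _ k l) e) (cH i j)
      ; outside = λ { (i , eq) → inl≢inr s (sym eq) }
      ; exit = trans (bridge-sym s G H v u gG gH _ _) (bridge-edge s G H v u)
      ; leave = lv }
      where
      lv : ∀ i x → bridge s G H v u (inr s i) x ≡ true → Image (inr s) x ⊎ (i ≡ u × x ≡ inl s v)
      lv i x e with view s x
      ... | isR y = inj₁ (y , refl)
      ... | isL y with bridge-edge⁻¹ s G H v u y i (trans (bridge-sym s G H v u gG gH _ _) e)
      ... | p , q = inj₂ (q , cong (inl s) p)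

  isRight-inl : ∀ {a b n} (s : Shuffle a b n) x → isRight s (inl s x) ≡ false
  isRight-inl s x = cong [ _ , _ ]′ (split-inl s x)

  isRight-inr : ∀ {a b n} (s : Shuffle a b n) x → isRight s (inr s x) ≡ true
  isRight-inr s x = cong [ _ , _ ]′ (split-inr s x)

  size : ∀ {a b n} → Shuffle a b n → a + b ≡ n
  size [] = refl
  size (left s) = cong suc (size s)
  size {a} (right {b = b} s) = trans (ℕ.+-suc a b) (cong suc (size s))

  2b<n : ∀ {a b n} → Shuffle a b n → b < a → b + b < n
  2b<n {a} {b} s lt = subst (b + b <_) (size s) (ℕ.+-monoˡ-< b lt)

  -- Both right parts are pendant in the same connected graph and contain the same marked root. By
  -- laminarity they are equal, so the shuffles agree, and the two graphs and the bridge are found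
  -- by restriction.
  bridge-injective : ∀ {a b n} (s s' : Shuffle a b n) {G G' : Adj a} {H H' : Adj b} {v v' u u'} → b < a →
    IsGraph G → IsGraph H → IsGraph G' → IsGraph H' → Connected G → Connected H → Connected G' → Connected H' →
    (∀ i j → bridge s G H v u i j ≡ bridge s' G' H' v' u' i j) → inr s u ≡ inr s' u' →
    s ≡ s' × (∀ i j → G i j ≡ G' i j) × (∀ i j → H i j ≡ H' i j) × v ≡ v' × u ≡ u'
  bridge-injective {a} {b} {n} s s' {G} {G'} {H} {H'} {v} {v'} {u} {u'} b<a gG gH gG' gH' kG kH kG' kH' h eq = go s' h eq same
    where
    P = bridge-pend s G H v u gG gH kH
    P' = Pend-resp (λ i j → sym (h i j)) (bridge-pend s' G' H' v' u' gG' gH' kH')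
    c = proj₂ (bridge-connected s G H v u gG gH kG kH)
    R⊆ : ∀ {s s' : Shuffle a b n} → (∀ i → Image (inr s') (inr s i)) → ∀ i → isRight s i ≡ true → isRight s' i ≡ true
    R⊆ {s} {s'} h i e with view s i
    ... | isL x with () ← trans (sym (isRight-inl s x)) e
    ... | isR y with z , q ← h y = trans (cong (isRight s') (sym q)) (isRight-inr s' z)
    bool : ∀ {x y : Bool} → (x ≡ true → y ≡ true) → (y ≡ true → x ≡ true) → x ≡ y
    bool {false} {false} f g = refl
    bool {false} {true} f g = g refl
    bool {true} {y} f g = sym (f refl)
    same : s ≡ s'
    same = shuffle-ext s s' λ i → bool
      (R⊆ {s} {s'} (laminar (2b<n s b<a) c P P' eq) i) (R⊆ {s'} {s} (laminar (2b<n s b<a) c P' P (sym eq)) i)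
    go : ∀ s' → (∀ i j → bridge s G H v u i j ≡ bridge s' G' H' v' u' i j) → inr s u ≡ inr s' u' → s ≡ s' →
      s ≡ s' × (∀ i j → G i j ≡ G' i j) × (∀ i j → H i j ≡ H' i j) × v ≡ v' × u ≡ u'
    go s' h eq refl = refl ,
      (λ i j → trans (sym (combine-ll s G H _ i j)) (trans (h _ _) (combine-ll s G' H' _ i j))) ,
      (λ i j → trans (sym (combine-rr s G H _ i j)) (trans (h _ _) (combine-rr s G' H' _ i j))) ,
      proj₁ (bridge-edge⁻¹ s G' H' v' u' v u (trans (sym (h _ _)) (bridge-edge s G H v u))) ,
      inr-injective s eq

  -- A copy is recorded by the vertex `u` alone: by laminarity, copies with the same root occupy the
  -- same set when `G` is connected and has more than 2b vertices.
  PendRoot : ∀ {b n} → Adj b → Fin b → Adj n → Fin n → Set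
  PendRoot {b} {n} H r G u = Σ (Fin b → Fin n) λ e → Σ (Fin n) λ w →
    Pend G e r w × e r ≡ u × (∀ i j → G (e i) (e j) ≡ H i j)

  PendRoot-resp : ∀ {n b} {H : Adj b} {r} {G G' : Adj n} {u} → (∀ i j → G i j ≡ G' i j) → PendRoot H r G u → PendRoot H r G' u
  PendRoot-resp h (e , w , P , q , f) = e , w , Pend-resp h P , q , λ i j → trans (sym (h _ _)) (f i j)

  -- A pendant copy in the joined graph that is not the attached one lies in the left part, by laminarity.
  bridge-PendRoot : ∀ {a b n} (s : Shuffle a b n) {G : Adj a} {H : Adj b} {v r u} → b < a →
    IsGraph G → IsGraph H → Connected G → Connected H →
    PendRoot H r (bridge s G H v r) u → u ≡ inr s r ⊎ Σ (Fin a) λ x → u ≡ inl s x × PendRoot H r G x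
  bridge-PendRoot {a} {b} {n} s {G} {H} {v} {r} b<a gG gH kG kH (e , w , P , refl , f) = cases (view s (e r)) refl
    where
    J = bridge s G H v r
    Q = bridge-pend s G H v r gG gH kH
    c = proj₂ (bridge-connected s G H v r gG gH kG kH)
    cases : ∀ {z} → View s z → e r ≡ z → (e r ≡ inr s r) ⊎ Σ (Fin a) λ x → e r ≡ inl s x × PendRoot H r G x
    cases (isR y) eq = inj₁ (root (leave Q y w (trans (cong (λ z → J z w) (sym eq)) (exit P))))
      where
      root : Image (inr s) w ⊎ (y ≡ r × w ≡ inl s v) → e r ≡ inr s r
      -- The right part lies inside the copy by laminarity, so `w`, which is outside the copy,
      -- cannot be on the right. The exit edge is then the bridge.
      root (inj₁ (z , q)) = ⊥-elim (outside P (proj₁ h , trans (proj₂ h) q))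
        where h = laminar (2b<n s b<a) c Q P (sym eq) z
      root (inj₂ (p , _)) = trans eq (cong (inr s) p)
    cases (isL x₀) eq = inj₂ (x₀ , eq , g , w' , pend , inl-injective s (trans (g-eq r) eq) ,
        λ i j → trans (sym (combine-ll s G H _ (g i) (g j))) (trans (cong₂ J (g-eq i) (g-eq j)) (f i j)))
      where
      into : ∀ i → Σ (Fin a) λ x → inl s x ≡ e i
      into i = go (view s (e i)) refl
        where
        go : ∀ {z} → View s z → e i ≡ z → Σ (Fin a) λ x → inl s x ≡ e i
        go (isL x) q = x , sym q
        go (isR y) q with z , q' ← laminar (2b<n s b<a) c P Q q r = ⊥-elim (inl≢inr s (trans (sym eq) (sym q')))
      g : Fin b → Fin a
      g i = proj₁ (into i)
      g-eq : ∀ i → inl s (g i) ≡ e i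
      g-eq i = proj₂ (into i)
      pull : ∀ {x} → Image e (inl s x) → Image g x
      pull (i , q) = i , inl-injective s (trans (g-eq i) q)
      leaveG : ∀ i x → G (g i) x ≡ true → Image g x ⊎ (i ≡ r × inl s x ≡ w)
      leaveG i x d with leave P i (inl s x) (trans (cong (λ z → J z (inl s x)) (sym (g-eq i))) (trans (combine-ll s G H _ _ _) d))
      ... | inj₁ q = inj₁ (pull q)
      ... | inj₂ q = inj₂ q
      w-left : Σ (Fin a) λ x → inl s x ≡ w
      w-left = go (view s w) refl
        where
        go : ∀ {z} → View s z → w ≡ z → Σ (Fin a) λ x → inl s x ≡ w
        go (isL x) q = x , sym q
        -- By `b < a` the copy misses a vertex of `G`, so an edge of `G` leaves it. This edge must
        -- be the exit edge, hence `w` is on the left.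
        go (isR y) q with z , ¬z ← uncovered g b<a
          with k , l , d , (i , refl) , ¬l ← crossing (image? g) (proj₂ kG (g r) z) (r , refl) ¬z
          with leaveG i l d
        ... | inj₁ h = ⊥-elim (¬l h)
        ... | inj₂ (_ , q') = ⊥-elim (inl≢inr s (trans q' q))
      w' = proj₁ w-left
      pend : Pend G g r w'
      pend = record
        { inj = λ {x} {y} q → inj P (trans (sym (g-eq x)) (trans (cong (inl s) q) (g-eq y)))
        ; conn = λ i j → Reachable-map id (λ {k} {l} d → trans (sym (combine-ll s G H _ (g k) (g l))) (trans (cong₂ J (g-eq k) (g-eq l)) d)) (conn P i j)
        ; outside = λ { (i , q) → outside P (i , trans (sym (g-eq i)) (trans (cong (inl s) q) (proj₂ w-left))) }
        ; exit = trans (sym (combine-ll s G H _ (g r) w')) (trans (cong₂ J (g-eq r) (proj₂ w-left)) (exit P))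
        ; leave = λ i x d → lv i x (leaveG i x d) }
        where
        lv : ∀ i x → Image g x ⊎ (i ≡ r × inl s x ≡ w) → Image g x ⊎ (i ≡ r × x ≡ w')
        lv i x (inj₁ q) = inj₁ q
        lv i x (inj₂ (p , q)) = inj₂ (p , inl-injective s (trans q (sym (proj₂ w-left))))

-- Counting by injections.

module Counting where
  open import Defs
  open DoubleNegation
  open Join
  open Closure
  open Pendant hiding (size)
  open import Data.Nat using (ℕ; zero; suc; _+_; _*_; _<_; _≤_; s≤s; z≤n)
  import Data.Nat.Properties as ℕ
  open import Data.Fin as Fin using (Fin; zero; suc)
  open import Data.Fin.Properties using (injective⇒≤; combine-injective; combine-remQuot)
  open import Data.Bool using (Bool; true; false)
  import Data.Vec.Functional as VF
  open import Data.List using (List; []; _∷_; map)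
  open import Data.List.Relation.Unary.Any using (Any; here; there)
  import Data.List.Relation.Unary.Any as Any
  import Data.List.Relation.Unary.Any.Properties as Any
  open import Data.List.Relation.Unary.All as All using (All; []; _∷_)
  import Data.List.Relation.Unary.All.Properties as All
  open import Data.List.Relation.Unary.AllPairs as AllPairs using (AllPairs; []; _∷_)
  import Data.List.Relation.Unary.AllPairs.Properties as AllPairs
  open import Data.Product using (Σ; _×_; _,_; proj₁; proj₂)
  open import Data.Sum using (_⊎_; inj₁; inj₂)
  open import Data.Empty using (⊥-elim)
  open import Relation.Nullary using (¬_; yes; no)
  open import Relation.Binary.PropositionalEquality using (_≡_; refl; cong; cong₂; sym; trans)
  open import Function using (_∘_; id)

  module _ {A : Set} (_≈_ : A → A → Set) where
    Distinct : List A → Set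
    Distinct = AllPairs (λ x y → ¬ x ≈ y)

    Complete : List A → Set
    Complete xs = ∀ a → Any (a ≈_) xs

    Pointwise : ∀ {m} → (Fin m → A) → (Fin m → A) → Set
    Pointwise f g = ∀ i → f i ≈ g i

  -- The relation on values is a parameter because the enumeration is nested: rows are compared
  -- pointwise up to `≡`, and matrices pointwise up to that relation on rows.
  allFuns-complete : ∀ {A : Set} (_≈_ : A → A → Set) {xs} → Complete _≈_ xs → ∀ m → Complete (Pointwise _≈_ {m}) (allFuns xs m)
  allFuns-complete _≈_ h zero f = here λ ()
  allFuns-complete _≈_ {xs} h (suc m) f = Any.concat⁺ (Any.map⁺ (Any.map
    (λ e → Any.map⁺ (Any.map (λ e' → λ { zero → e ; (suc i) → e' i }) (allFuns-complete _≈_ h m (f ∘ suc))))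
    (h (f zero))))

  allFuns-distinct : ∀ {A : Set} (_≈_ : A → A → Set) {xs} → Distinct _≈_ xs → ∀ m → Distinct (Pointwise _≈_ {m}) (allFuns xs m)
  allFuns-distinct _≈_ h zero = [] ∷ []
  allFuns-distinct {A} _≈_ {xs} h (suc m) = AllPairs.concat⁺
    (All.map⁺ (All.universal (λ x → AllPairs.map⁺ (AllPairs.map (λ n e → n (e ∘ suc)) (allFuns-distinct _≈_ h m))) xs))
    (AllPairs.map⁺ (AllPairs.map
      (λ n → All.map⁺ (All.universal (λ _ → All.map⁺ (All.universal (λ _ e → n (e zero)) (allFuns xs m))) (allFuns xs m))) h))

  infix 4 _≗₂_
  _≗₂_ : ∀ {n} → Adj n → Adj n → Set
  G ≗₂ H = ∀ i j → G i j ≡ H i j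

  allAdj-complete : ∀ n → Complete _≗₂_ (allAdj n)
  allAdj-complete n = allFuns-complete (Pointwise _≡_) (allFuns-complete _≡_ (λ { true → here refl ; false → there (here refl) }) n) n

  allAdj-distinct : ∀ n → Distinct _≗₂_ (allAdj n)
  allAdj-distinct n = allFuns-distinct (Pointwise _≡_) (allFuns-distinct _≡_ (((λ ()) ∷ []) ∷ [] ∷ []) n) n

  module _ {A : Set} {P : A → Set} where
    counted : ∀ {xs k} → CountIs P xs k → Fin k → A
    counted (cyes {x} p c) zero = x
    counted (cyes p c) (suc i) = counted c i
    counted (cno n c) i = counted c i

    counted-sound : ∀ {xs k} (c : CountIs P xs k) i → P (counted c i)
    counted-sound (cyes p c) zero = p
    counted-sound (cyes p c) (suc i) = counted-sound c i
    counted-sound (cno n c) i = counted-sound c i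

    counted-All : ∀ {Q : A → Set} {xs k} (c : CountIs P xs k) → All Q xs → ∀ i → Q (counted c i)
    counted-All (cyes p c) (q ∷ qs) zero = q
    counted-All (cyes p c) (q ∷ qs) (suc i) = counted-All c qs i
    counted-All (cno n c) (q ∷ qs) i = counted-All c qs i

    module _ {_≈_ : A → A → Set} (≈-sym : ∀ {x y : A} → x ≈ y → y ≈ x) where
      counted-injective : ∀ {xs k} (c : CountIs P xs k) → Distinct _≈_ xs → ∀ i j → counted c i ≈ counted c j → i ≡ j
      counted-injective (cyes p c) (n ∷ d) zero zero e = refl
      counted-injective (cyes p c) (n ∷ d) zero (suc j) e = ⊥-elim (counted-All c n j e)
      counted-injective (cyes p c) (n ∷ d) (suc i) zero e = ⊥-elim (counted-All c n i (≈-sym e))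
      counted-injective (cyes p c) (n ∷ d) (suc i) (suc j) e = cong suc (counted-injective c d i j e)
      counted-injective (cno _ c) (n ∷ d) i j e = counted-injective c d i j e

      counted-complete : (∀ {x y} → x ≈ y → P x → P y) → ∀ {xs k} (c : CountIs P xs k) {y} → P y → Any (y ≈_) xs →
        Σ (Fin k) λ i → y ≈ counted c i
      counted-complete resp (cyes _ c) p (here e) = zero , e
      counted-complete resp (cno n c) p (here e) = ⊥-elim (n (resp e p))
      counted-complete resp (cyes _ c) p (there a) with i , e ← counted-complete resp c p a = suc i , e
      counted-complete resp (cno n c) p (there a) = counted-complete resp c p a

    count-exists : ∀ xs → ¬ ¬ Σ ℕ (CountIs P xs)
    count-exists [] = pure (0 , cnil)
    count-exists (x ∷ xs) = do
      k , c ← count-exists xs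
      em >>= λ { (yes p) → pure (suc k , cyes p c) ; (no n) → pure (k , cno n c) }

  module _ {A : Set} {P Q S : A → Set} where
    -- A union bound. The hypothesis takes `¬ Q x`, not a disjunction, because it is the count of
    -- `Q` that supplies the decision at each element of the list.
    count-cover : (∀ {x} → P x → ¬ Q x → S x) → ∀ {xs k m s} → CountIs P xs k → CountIs Q xs m → CountIs S xs s → k ≤ m + s
    count-cover h cnil cnil cnil = ℕ.≤-refl
    count-cover h {m = suc m} (cyes p c) (cyes q d) (cyes _ e) = s≤s (ℕ.≤-trans (count-cover h c d e) (ℕ.+-monoʳ-≤ m (ℕ.n≤1+n _)))
    count-cover h (cyes p c) (cyes q d) (cno _ e) = s≤s (count-cover h c d e)
    count-cover h {m = m} (cyes p c) (cno _ d) (cyes _ e) = ℕ.≤-trans (s≤s (count-cover h c d e)) (ℕ.≤-reflexive (sym (ℕ.+-suc m _)))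
    count-cover h (cyes p c) (cno ¬q d) (cno ¬s e) = ⊥-elim (¬s (h p ¬q))
    count-cover h {m = suc m} (cno _ c) (cyes q d) (cyes _ e) = ℕ.m≤n⇒m≤1+n (ℕ.≤-trans (count-cover h c d e) (ℕ.+-monoʳ-≤ m (ℕ.n≤1+n _)))
    count-cover h (cno _ c) (cyes q d) (cno _ e) = ℕ.m≤n⇒m≤1+n (count-cover h c d e)
    count-cover h {m = m} (cno _ c) (cno _ d) (cyes _ e) = ℕ.≤-trans (count-cover h c d e) (ℕ.+-monoʳ-≤ m (ℕ.n≤1+n _))
    count-cover h (cno _ c) (cno _ d) (cno _ e) = count-cover h c d e

  count-mono : ∀ {A : Set} {P Q : A → Set} → (∀ {x} → P x → Q x) → ∀ {xs k m} → CountIs P xs k → CountIs Q xs m → k ≤ m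
  count-mono h cnil cnil = z≤n
  count-mono h (cyes p c) (cyes q d) = s≤s (count-mono h c d)
  count-mono h (cyes p c) (cno ¬q d) = ⊥-elim (¬q (h p))
  count-mono h (cno _ c) (cyes q d) = ℕ.m≤n⇒m≤1+n (count-mono h c d)
  count-mono h (cno _ c) (cno _ d) = count-mono h c d

  -- A lower bound `n` for the cardinality of `A`.
  Lower : Set → ℕ → Set
  Lower A n = Σ (Fin n → A) λ f → ∀ {i j} → f i ≡ f j → i ≡ j

  Lower-Fin : ∀ n → Lower (Fin n) n
  Lower-Fin n = id , id

  Lower-× : ∀ {A B m n} → Lower A m → Lower B n → Lower (A × B) (m * n)
  Lower-× {m = m} {n} (f , f-inj) (g , g-inj) = h , λ {i} {j} e →
    trans (sym (combine-remQuot {m} n i))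
      (trans (cong₂ Fin.combine (f-inj (cong proj₁ e)) (g-inj (cong proj₂ e))) (combine-remQuot {m} n j))
    where
    h : Fin (m * n) → _
    h i = f (proj₁ (Fin.remQuot {m} n i)) , g (proj₂ (Fin.remQuot {m} n i))

  Lower-≤ : ∀ {A n k l} → Lower A n → (f : A → Fin k × Fin l) → (∀ {x y} → f x ≡ f y → x ≡ y) → n ≤ k * l
  Lower-≤ (g , g-inj) f f-inj = injective⇒≤ {f = λ i → Fin.combine (proj₁ (f (g i))) (proj₂ (f (g i)))}
    λ e → let p , q = combine-injective _ _ _ _ e in g-inj (f-inj (cong₂ _,_ p q))

  module _ {n : ℕ} {P : Adj n → Set} {k : ℕ} (c : CountIs P (allAdj n) k) where
    nth : Fin k → Adj n
    nth = counted c

    nth-sound : ∀ i → P (nth i)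
    nth-sound = counted-sound c

    nth-injective : ∀ {i j} → nth i ≗₂ nth j → i ≡ j
    nth-injective {i} {j} = counted-injective (λ e i j → sym (e i j)) c (allAdj-distinct n) i j

    index : (∀ {G H} → G ≗₂ H → P G → P H) → ∀ {G} → P G → Σ (Fin k) λ i → G ≗₂ nth i
    index resp p = counted-complete (λ e i j → sym (e i j)) resp c p (allAdj-complete n _)

  module _ {C : Class} (iso : IsoClosed C) (add : Addable C) where

    -- The joined graph is stored with the root of its right part, one of `a + b` vertices, from
    -- which `bridge-injective` recovers all choices.
    join-count : ∀ {a b x y z} → b < a → CountIs (InConn C a) (allAdj a) x → CountIs (InConn C b) (allAdj b) y →
      CountIs (InConn C (a + b)) (allAdj (a + b)) z → (a * (x * (b * y))) * #shuffles (a + b) a b ≤ (a + b) * z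
    join-count {a} {b} {x} {y} {z} b<a cx cy cz = Lower-≤
      (Lower-× (Lower-× (Lower-Fin a) (Lower-× (Lower-Fin x) (Lower-× (Lower-Fin b) (Lower-Fin y))))
        (shuffle (a + b) a b , shuffle-injective (a + b) a b)) f f-inj
      where
      Dom = (Fin a × Fin x × Fin b × Fin y) × Shuffle a b (a + b)
      J : Dom → Adj (a + b)
      J ((v , i , u , j) , s) = bridge s (nth cx i) (nth cy j) v u
      J-in : ∀ d → InConn C (a + b) (J d)
      J-in ((v , i , u , j) , s) = bridge-InConn iso add s v u (nth-sound cx i) (nth-sound cy j)
      pos : ∀ d → Σ (Fin z) λ k → J d ≗₂ nth cz k
      pos d = index cz (InConn-resp iso) (J-in d)
      f : Dom → Fin (a + b) × Fin z
      f d@((v , i , u , j) , s) = inr s u , proj₁ (pos d)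
      f-inj : ∀ {d d'} → f d ≡ f d' → d ≡ d'
      f-inj {d@((v , i , u , j) , s)} {d'@((v' , i' , u' , j') , s')} e = finish (bridge-injective s s' b<a
          (proj₁ (proj₁ (nth-sound cx i))) (proj₁ (proj₁ (nth-sound cy j)))
          (proj₁ (proj₁ (nth-sound cx i'))) (proj₁ (proj₁ (nth-sound cy j')))
          (proj₂ (nth-sound cx i)) (proj₂ (nth-sound cy j)) (proj₂ (nth-sound cx i')) (proj₂ (nth-sound cy j'))
          (λ k l → trans (proj₂ (pos d) k l) (trans (cong (λ m → nth cz m k l) (cong proj₂ e)) (sym (proj₂ (pos d') k l))))
          (cong proj₁ e))
        where
        finish : s ≡ s' × nth cx i ≗₂ nth cx i' × nth cy j ≗₂ nth cy j' × v ≡ v' × u ≡ u' → d ≡ d'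
        finish (refl , p , q , refl , refl) = cong₂ (λ i j → (v , i , u , j) , s) (nth-injective cx p) (nth-injective cy q)

    module _ {b : ℕ} {H : Adj b} (r : Fin b) (H∈C : InConn C b H) where
      -- At most m pendant copies of H, witnessed by a list t of m vertices containing all their roots.
      Few : ℕ → (n : ℕ) → Adj n → Set
      Few m n G = InConn C n G × Σ (Fin m → Fin n) λ t → ∀ u → PendRoot H r G u → Σ (Fin m) λ i → t i ≡ u

      Few-resp : ∀ {m n} {G G' : Adj n} → G ≗₂ G' → Few m n G → Few m n G'
      Few-resp h (p , t , c) = InConn-resp iso h p , t , λ u q → c u (PendRoot-resp (λ i j → sym (h i j)) q)

      -- Every pendant copy in the new graph is the attached one or a copy already present in `G`,
      -- so a single root is added to the list.
      Few-bridge : ∀ {m a n} (s : Shuffle a b n) {G : Adj a} v → b < a → Few m a G → Few (suc m) n (bridge s G H v r)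
      Few-bridge {m} {a} {n} s {G} v b<a (p@((gG , _) , kG) , t , c) =
        bridge-InConn iso add s v r p H∈C , t' , λ u q → go u (bridge-PendRoot s b<a gG (proj₁ (proj₁ H∈C)) kG (proj₂ H∈C) q)
        where
        t' : Fin (suc m) → Fin n
        t' = inr s r VF.∷ (inl s ∘ t)
        go : ∀ u → u ≡ inr s r ⊎ Σ (Fin a) (λ x → u ≡ inl s x × PendRoot H r G x) → Σ (Fin (suc m)) λ i → t' i ≡ u
        go u (inj₁ e) = zero , sym e
        go u (inj₂ (x , e , q)) with i , e' ← c x q = suc i , trans (cong (inl s) e') (sym e)

      -- The attached root is stored as a position in the list of at most `suc m` roots, not as one
      -- of `n + b` vertices. The whole gain lies here: a step offers `n` places and is overcounted
      -- only `suc m` times.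
      pendant-count : ∀ {m n x z} → b < n → CountIs (Few m n) (allAdj n) x →
        CountIs (Few (suc m) (n + b)) (allAdj (n + b)) z → (n * x) * #shuffles (n + b) n b ≤ suc m * z
      pendant-count {m} {n} {x} {z} b<n cx cz = Lower-≤
        (Lower-× (Lower-× (Lower-Fin n) (Lower-Fin x)) (shuffle (n + b) n b , shuffle-injective (n + b) n b)) f f-inj
        where
        Dom = (Fin n × Fin x) × Shuffle n b (n + b)
        J : Dom → Adj (n + b)
        J ((v , i) , s) = bridge s (nth cx i) H v r
        pos : ∀ d → Σ (Fin z) λ k → J d ≗₂ nth cz k
        pos d@((v , i) , s) = index cz Few-resp (Few-bridge s v b<n (nth-sound cx i))
        cover : Fin z → Fin (suc m) → Fin (n + b)
        cover k = proj₁ (proj₂ (nth-sound cz k))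
        root : ∀ d → Σ (Fin (suc m)) λ i → cover (proj₁ (pos d)) i ≡ inr (proj₂ d) r
        root d@((v , i) , s) = proj₂ (proj₂ (nth-sound cz (proj₁ (pos d)))) (inr s r)
          (PendRoot-resp (proj₂ (pos d)) (inr s , inl s v ,
            bridge-pend s (nth cx i) H v r (proj₁ (proj₁ (proj₁ (nth-sound cx i)))) (proj₁ (proj₁ H∈C)) (proj₂ H∈C) ,
            refl , combine-rr s (nth cx i) H _))
        f : Dom → Fin (suc m) × Fin z
        f d = proj₁ (root d) , proj₁ (pos d)
        f-inj : ∀ {d d'} → f d ≡ f d' → d ≡ d'
        f-inj {d@((v , i) , s)} {d'@((v' , i') , s')} e = finish (bridge-injective s s' b<n
            (proj₁ (proj₁ (proj₁ (nth-sound cx i)))) (proj₁ (proj₁ H∈C))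
            (proj₁ (proj₁ (proj₁ (nth-sound cx i')))) (proj₁ (proj₁ H∈C))
            (proj₂ (proj₁ (nth-sound cx i))) (proj₂ H∈C) (proj₂ (proj₁ (nth-sound cx i'))) (proj₂ H∈C)
            (λ k l → trans (proj₂ (pos d) k l) (trans (cong (λ m → nth cz m k l) (cong proj₂ e)) (sym (proj₂ (pos d') k l))))
            (trans (sym (proj₂ (root d))) (trans (cong₂ cover (cong proj₂ e) (cong proj₁ e)) (proj₂ (root d')))))
          where
          finish : s ≡ s' × nth cx i ≗₂ nth cx i' × H ≗₂ H × v ≡ v' × r ≡ r → d ≡ d'
          finish (refl , p , _ , refl , _) = cong (λ i → (v , i) , s) (nth-injective cx p)

-- Powers, reciprocals and Bernoulli-type bounds in the rationals.

module Rationals where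
  open import Data.Nat as ℕ using (ℕ; zero; suc)
  import Data.Nat.Properties as ℕ
  open import Data.Rational using (ℚ; 0ℚ; 1ℚ; _+_; _*_; _≤_; _<_; 1/_; nonNegative; positive)
  open import Data.Rational.Properties
  open import Data.Rational.Solver using (module +-*-Solver)
  open +-*-Solver using (solve; _:*_; _:+_; _:=_; con)
  open import Algebra.Bundles using (CommutativeRing)
  import Algebra.Properties.CommutativeSemiring.Exp as Exp
  import Algebra.Properties.Semiring.Mult as Mult
  open import Data.Empty using (⊥-elim)
  open import Relation.Nullary using (¬_; yes; no)
  open import Relation.Binary.PropositionalEquality using (_≡_; refl; cong; cong₂; sym; trans; subst; module ≡-Reasoning)

  open Exp (CommutativeRing.commutativeSemiring +-*-commutativeRing) public
    using (_^_; ^-homo-*; ^-assocʳ; ^-distrib-*)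
  private module M = Mult (CommutativeRing.semiring +-*-commutativeRing)

  ι : ℕ → ℚ
  ι n = n M.× 1ℚ

  ι-+ : ∀ m n → ι (m ℕ.+ n) ≡ ι m + ι n
  ι-+ m n = M.×-homo-+ 1ℚ m n

  ι-* : ∀ m n → ι (m ℕ.* n) ≡ ι m * ι n
  ι-* = M.×1-homo-*

  ι-^ : ∀ m n → ι (m ℕ.^ n) ≡ ι m ^ n
  ι-^ m zero = +-identityʳ 1ℚ
  ι-^ m (suc n) = trans (ι-* m (m ℕ.^ n)) (cong (ι m *_) (ι-^ m n))

  0≤1 : 0ℚ ≤ 1ℚ
  0≤1 = nonNegative⁻¹ 1ℚ

  0<1 : 0ℚ < 1ℚ
  0<1 = positive⁻¹ 1ℚ

  0≤ι : ∀ n → 0ℚ ≤ ι n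
  0≤ι zero = ≤-refl
  0≤ι (suc n) = ≤-trans 0≤1 (≤-trans (≤-reflexive (sym (+-identityʳ 1ℚ))) (+-monoʳ-≤ 1ℚ (0≤ι n)))

  0<ι : ∀ n → 0ℚ < ι (suc n)
  0<ι n = <-≤-trans 0<1 (≤-trans (≤-reflexive (sym (+-identityʳ 1ℚ))) (+-monoʳ-≤ 1ℚ (0≤ι n)))

  ι-≤ : ∀ {m n} → m ℕ.≤ n → ι m ≤ ι n
  ι-≤ {n = n} ℕ.z≤n = 0≤ι n
  ι-≤ (ℕ.s≤s h) = +-monoʳ-≤ 1ℚ (ι-≤ h)

  ι-< : ∀ {m n} → m ℕ.< n → ι m < ι n
  ι-< {m} h = <-≤-trans (<-respˡ-≡ (+-identityˡ (ι m)) (+-monoˡ-< (ι m) 0<1)) (ι-≤ h)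

  <⇒≱ : ∀ {a b} → a < b → ¬ b ≤ a
  <⇒≱ ab ba = <-irrefl refl (<-≤-trans ab ba)

  ι-cancel-≤ : ∀ {m n} → ι m ≤ ι n → m ℕ.≤ n
  ι-cancel-≤ {m} {n} h with m ℕ.≤? n
  ... | yes p = p
  ... | no q = ⊥-elim (<⇒≱ (ι-< (ℕ.≰⇒> q)) h)

  mul-≤ : ∀ {a b c d} → 0ℚ ≤ a → a ≤ b → 0ℚ ≤ c → c ≤ d → a * c ≤ b * d
  mul-≤ {a} {b} {c} {d} 0a ab 0c cd = ≤-trans
    (*-monoʳ-≤-nonNeg c {{nonNegative 0c}} ab) (*-monoˡ-≤-nonNeg b {{nonNegative (≤-trans 0a ab)}} cd)

  mulˡ : ∀ {a b} c → 0ℚ ≤ c → a ≤ b → c * a ≤ c * b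
  mulˡ c 0c = *-monoˡ-≤-nonNeg c {{nonNegative 0c}}

  mulʳ : ∀ {a b} c → 0ℚ ≤ c → a ≤ b → a * c ≤ b * c
  mulʳ c 0c = *-monoʳ-≤-nonNeg c {{nonNegative 0c}}

  cancelˡ : ∀ {a b} c → 0ℚ < c → c * a ≤ c * b → a ≤ b
  cancelˡ c 0c = *-cancelˡ-≤-pos c {{positive 0c}}

  0≤* : ∀ {a b} → 0ℚ ≤ a → 0ℚ ≤ b → 0ℚ ≤ a * b
  0≤* {a} {b} p q = subst (_≤ a * b) (*-zeroˡ b) (mulʳ b q p)

  0<* : ∀ {a b} → 0ℚ < a → 0ℚ < b → 0ℚ < a * b
  0<* {a} {b} p q = subst (_< a * b) (*-zeroˡ b) (*-monoˡ-<-pos b {{positive q}} p)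

  0≤^ : ∀ {a} n → 0ℚ ≤ a → 0ℚ ≤ a ^ n
  0≤^ zero h = 0≤1
  0≤^ (suc n) h = 0≤* h (0≤^ n h)

  0<^ : ∀ {a} n → 0ℚ < a → 0ℚ < a ^ n
  0<^ zero h = 0<1
  0<^ (suc n) h = 0<* h (0<^ n h)

  ^-≤ : ∀ {a b} n → 0ℚ ≤ a → a ≤ b → a ^ n ≤ b ^ n
  ^-≤ zero 0a ab = ≤-refl
  ^-≤ (suc n) 0a ab = mul-≤ 0a ab (0≤^ n 0a) (^-≤ n 0a ab)

  ^-< : ∀ {a b} n → 0ℚ ≤ a → a < b → a ^ suc n < b ^ suc n
  ^-< {a} {b} n 0a ab = ≤-<-trans (mulˡ a 0a (^-≤ n 0a (<⇒≤ ab)))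
    (*-monoˡ-<-pos (b ^ n) {{positive (0<^ n (≤-<-trans 0a ab))}} ab)

  ^-cancel-≤ : ∀ {a b} n → 0ℚ ≤ b → a ^ suc n ≤ b ^ suc n → a ≤ b
  ^-cancel-≤ n 0b h = ≮⇒≥ λ lt → <⇒≱ (^-< n 0b lt) h

  1^ : ∀ n → 1ℚ ^ n ≡ 1ℚ
  1^ zero = refl
  1^ (suc n) = trans (*-identityˡ _) (1^ n)

  1≤^ : ∀ {a} n → 1ℚ ≤ a → 1ℚ ≤ a ^ n
  1≤^ {a} n h = subst (_≤ a ^ n) (1^ n) (^-≤ n 0≤1 h)

  ^-monoʳ : ∀ {a m n} → 1ℚ ≤ a → m ℕ.≤ n → a ^ m ≤ a ^ n
  ^-monoʳ {n = n} h ℕ.z≤n = 1≤^ n h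
  ^-monoʳ {a} h (ℕ.s≤s {m} {n} p) = mulˡ a (≤-trans 0≤1 h) (^-monoʳ h p)

  inv : ℕ → ℚ
  -- A default value that keeps `inv` nonnegative; the laws of reciprocals ask for positive
  -- arguments.
  inv zero = 0ℚ
  inv (suc n) = (1/ ι (suc n)) {{pos⇒nonZero (ι (suc n)) {{positive (0<ι n)}}}}

  inv-inverse : ∀ {n} → 0 ℕ.< n → ι n * inv n ≡ 1ℚ
  inv-inverse {suc n} _ = *-inverseʳ (ι (suc n)) {{pos⇒nonZero (ι (suc n)) {{positive (0<ι n)}}}}

  0<inv : ∀ {n} → 0 ℕ.< n → 0ℚ < inv n
  0<inv {suc n} _ = positive⁻¹ (inv (suc n)) {{1/pos⇒pos (ι (suc n)) {{positive (0<ι n)}}}}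

  0≤inv : ∀ n → 0ℚ ≤ inv n
  0≤inv zero = ≤-refl
  0≤inv (suc n) = <⇒≤ (0<inv {suc n} (ℕ.s≤s ℕ.z≤n))

  inv-* : ∀ {m n} → 0 ℕ.< m → 0 ℕ.< n → inv (m ℕ.* n) ≡ inv m * inv n
  inv-* {m} {n} 0m 0n = begin
    inv (m ℕ.* n)                                     ≡⟨ *-identityʳ _ ⟨
    inv (m ℕ.* n) * 1ℚ                                ≡⟨ cong (inv (m ℕ.* n) *_) (cong₂ _*_ (inv-inverse 0m) (inv-inverse 0n)) ⟨
    inv (m ℕ.* n) * ((ι m * inv m) * (ι n * inv n))   ≡⟨ rearrange (inv (m ℕ.* n)) (ι m) (inv m) (ι n) (inv n) ⟩
    ((ι m * ι n) * inv (m ℕ.* n)) * (inv m * inv n)   ≡⟨ cong (λ z → z * inv (m ℕ.* n) * (inv m * inv n)) (ι-* m n) ⟨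
    (ι (m ℕ.* n) * inv (m ℕ.* n)) * (inv m * inv n)   ≡⟨ cong (_* (inv m * inv n)) (inv-inverse (ℕ.*-mono-≤ 0m 0n)) ⟩
    1ℚ * (inv m * inv n)                              ≡⟨ *-identityˡ _ ⟩
    inv m * inv n                                     ∎
    where
    open ≡-Reasoning
    rearrange : ∀ a b c d e → a * ((b * c) * (d * e)) ≡ ((b * d) * a) * (c * e)
    rearrange = solve 5 (λ a b c d e → a :* ((b :* c) :* (d :* e)) := ((b :* d) :* a) :* (c :* e)) refl

  cross : ∀ {p r m n} → 0 ℕ.< m → 0 ℕ.< n → p ℕ.* n ℕ.≤ r ℕ.* m → ι p * inv m ≤ ι r * inv n
  cross {p} {r} {m} {n} 0m 0n h = begin
    ι p * inv m                      ≡⟨ *-identityʳ _ ⟨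
    ι p * inv m * 1ℚ                 ≡⟨ cong (ι p * inv m *_) (inv-inverse 0n) ⟨
    ι p * inv m * (ι n * inv n)      ≡⟨ rearrange (ι p) (inv m) (ι n) (inv n) ⟩
    (ι p * ι n) * (inv m * inv n)    ≡⟨ cong (_* (inv m * inv n)) (ι-* p n) ⟨
    ι (p ℕ.* n) * (inv m * inv n)    ≤⟨ mulʳ (inv m * inv n) (0≤* (0≤inv m) (0≤inv n)) (ι-≤ h) ⟩
    ι (r ℕ.* m) * (inv m * inv n)    ≡⟨ cong (_* (inv m * inv n)) (ι-* r m) ⟩
    (ι r * ι m) * (inv m * inv n)    ≡⟨ rearrange' (ι r) (ι m) (inv m) (inv n) ⟩
    ι r * inv n * (ι m * inv m)      ≡⟨ cong (ι r * inv n *_) (inv-inverse 0m) ⟩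
    ι r * inv n * 1ℚ                 ≡⟨ *-identityʳ _ ⟩
    ι r * inv n                      ∎
    where
    open ≤-Reasoning
    rearrange : ∀ a b c d → a * b * (c * d) ≡ (a * c) * (b * d)
    rearrange = solve 4 (λ a b c d → a :* b :* (c :* d) := (a :* c) :* (b :* d)) refl
    rearrange' : ∀ a b c d → (a * b) * (c * d) ≡ a * d * (b * c)
    rearrange' = solve 4 (λ a b c d → (a :* b) :* (c :* d) := a :* d :* (b :* c)) refl

  bernoulli : ∀ {u} → 0ℚ ≤ u → ∀ n → 1ℚ + ι n * u ≤ (1ℚ + u) ^ n
  bernoulli {u} 0u zero = ≤-reflexive (trans (cong (1ℚ +_) (*-zeroˡ u)) (+-identityʳ 1ℚ))
  bernoulli {u} 0u (suc n) = begin
    1ℚ + (1ℚ + ι n) * u            ≤⟨ p≤p+q ⟩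
    1ℚ + (1ℚ + ι n) * u + ι n * (u * u) ≡⟨ rearrange (ι n) u ⟩
    (1ℚ + u) * (1ℚ + ι n * u)      ≤⟨ mulˡ (1ℚ + u) (+-mono-≤ 0≤1 0u) (bernoulli 0u n) ⟩
    (1ℚ + u) * (1ℚ + u) ^ n        ∎
    where
    open ≤-Reasoning
    p≤p+q : 1ℚ + (1ℚ + ι n) * u ≤ 1ℚ + (1ℚ + ι n) * u + ι n * (u * u)
    p≤p+q = subst (_≤ 1ℚ + (1ℚ + ι n) * u + ι n * (u * u)) (+-identityʳ _)
      (+-monoʳ-≤ (1ℚ + (1ℚ + ι n) * u) (0≤* (0≤ι n) (0≤* 0u 0u)))
    rearrange : ∀ a u → 1ℚ + (1ℚ + a) * u + a * (u * u) ≡ (1ℚ + u) * (1ℚ + a * u)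
    rearrange = solve 2 (λ a u → con 1ℚ :+ (con 1ℚ :+ a) :* u :+ a :* (u :* u) := (con 1ℚ :+ u) :* (con 1ℚ :+ a :* u)) refl

  -- (1 + u)^n ≤ 1 + 2^n u for 0 ≤ u ≤ 1, hence ≤ 2 at u = 2^(-n); [w] stands for 2^n - 1.
  ^-upper : ∀ {u} → 0ℚ ≤ u → u ≤ 1ℚ → ∀ n w → suc w ≡ 2 ℕ.^ n → (1ℚ + u) ^ n ≤ 1ℚ + ι w * u
  ^-upper {u} 0u u1 zero zero e = ≤-reflexive (sym (trans (cong (1ℚ +_) (*-zeroˡ u)) (+-identityʳ 1ℚ)))
  ^-upper {u} 0u u1 (suc n) w e with 2 ℕ.^ n in eq
  ... | suc v = begin
    (1ℚ + u) * (1ℚ + u) ^ n              ≤⟨ mulˡ (1ℚ + u) (+-mono-≤ 0≤1 0u) (^-upper 0u u1 n v (sym eq)) ⟩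
    (1ℚ + u) * (1ℚ + ι v * u)            ≡⟨ rearrange (ι v) u ⟩
    1ℚ + (1ℚ + ι v) * u + ι v * u * u    ≤⟨ +-monoʳ-≤ (1ℚ + (1ℚ + ι v) * u) (mulˡ (ι v * u) (0≤* (0≤ι v) 0u) u1) ⟩
    1ℚ + (1ℚ + ι v) * u + ι v * u * 1ℚ   ≡⟨ rearrange' (ι v) u ⟩
    1ℚ + (ι v + (1ℚ + ι v)) * u          ≡⟨ cong (λ z → 1ℚ + z * u) (ι-+ v (suc v)) ⟨
    1ℚ + ι (v ℕ.+ suc v) * u             ≡⟨ cong (λ z → 1ℚ + ι z * u) (sym w≡) ⟩
    1ℚ + ι w * u                         ∎
    where
    open ≤-Reasoning
    w≡ : w ≡ v ℕ.+ suc v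
    w≡ = ℕ.suc-injective (trans e (cong (suc v ℕ.+_) (ℕ.+-identityʳ (suc v))))
    rearrange : ∀ a u → (1ℚ + u) * (1ℚ + a * u) ≡ 1ℚ + (1ℚ + a) * u + a * u * u
    rearrange = solve 2 (λ a u → (con 1ℚ :+ u) :* (con 1ℚ :+ a :* u) := con 1ℚ :+ (con 1ℚ :+ a) :* u :+ a :* u :* u) refl
    rearrange' : ∀ a u → 1ℚ + (1ℚ + a) * u + a * u * 1ℚ ≡ 1ℚ + (a + (1ℚ + a)) * u
    rearrange' = solve 2 (λ a u → con 1ℚ :+ (con 1ℚ :+ a) :* u :+ a :* u :* con 1ℚ := con 1ℚ :+ (a :+ (con 1ℚ :+ a)) :* u) refl

-- Growth rate of rooted connected graphs and rarity of graphs without a pendant copy.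

module Growth where
  open DoubleNegation
  open Rationals
  open import Data.Nat as ℕ using (ℕ; zero; suc; _!; NonZero)
  import Data.Nat.Properties as ℕ
  open import Data.Nat.DivMod using (_/_; _%_; m≡m%n+[m/n]*n; m%n<n; /-monoˡ-≤)
  open import Data.Nat.Tactic.RingSolver using (solve-∀)
  open import Data.Rational using (ℚ; 0ℚ; 1ℚ; _+_; _*_; _≤_; _<_)
  open import Data.Rational.Properties
  open import Data.Rational.Solver using (module +-*-Solver)
  open +-*-Solver using (solve; _:*_; _:+_; _:=_; con)
  open import Data.Product using (Σ; _×_; _,_)
  open import Data.Empty using (⊥-elim)
  open import Relation.Nullary using (¬_; yes; no; decidable-stable)
  open import Relation.Binary.PropositionalEquality using (_≡_; refl; cong; cong₂; sym; trans; subst; subst₂)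

  0<! : ∀ n → 0 ℕ.< n !
  0<! zero = ℕ.≤-refl
  0<! (suc n) = ℕ.≤-trans (0<! n) (ℕ.m≤m+n (n !) (n ℕ.* n !))

  n<2^n : ∀ n → n ℕ.< 2 ℕ.^ n
  n<2^n zero = ℕ.≤-refl
  n<2^n (suc n) = ℕ.≤-trans (ℕ.+-mono-≤ (ℕ.≤-trans (ℕ.s≤s ℕ.z≤n) (n<2^n n)) (n<2^n n))
    (ℕ.≤-reflexive (cong (2 ℕ.^ n ℕ.+_) (sym (ℕ.+-identityʳ (2 ℕ.^ n)))))

  ^-distribʳ-* : ∀ n a b → (a ℕ.* b) ℕ.^ n ≡ a ℕ.^ n ℕ.* b ℕ.^ n
  ^-distribʳ-* zero a b = refl
  ^-distribʳ-* (suc n) a b = trans (cong (a ℕ.* b ℕ.*_) (^-distribʳ-* n a b)) (interchange a b (a ℕ.^ n) (b ℕ.^ n))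
    where
    interchange : ∀ a b x y → a ℕ.* b ℕ.* (x ℕ.* y) ≡ a ℕ.* x ℕ.* (b ℕ.* y)
    interchange = solve-∀

  n!≤n^n : ∀ n → n ! ℕ.≤ n ℕ.^ n
  n!≤n^n n = go n n ℕ.≤-refl
    where
    go : ∀ k n → k ℕ.≤ n → k ! ℕ.≤ n ℕ.^ k
    go zero n h = ℕ.≤-refl
    go (suc k) n h = ℕ.*-mono-≤ h (go k n (ℕ.<⇒≤ h))

  -- The number of vertices allotted to each attached copy. Apart from the 4, which becomes the
  -- final gain, it is the cost of a copy: `b !` for its labels, `(2 * suc d) ^ b` for the growth on
  -- its `b` vertices, and 2 for the tolerance in the growth rate.
  spacing : ℕ → ℕ → ℕ
  spacing d b = 4 ℕ.* (2 ℕ.* (b ! ℕ.* (2 ℕ.* suc d) ℕ.^ b))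

  module _ (c : ℕ → ℕ → Set) (d : ℕ)
    (c-exists : ∀ (n : ℕ) → ¬ ¬ Σ ℕ (c n))
    (c-unique : ∀ {n k l : ℕ} → c n k → c n l → k ≡ l)
    (c-small : ∀ {n k : ℕ} → c n k → k ℕ.≤ d ℕ.^ n ℕ.* n !)
    (c-join : ∀ {a b x y z : ℕ} → b ℕ.< a → c a x → c b y → c (a ℕ.+ b) z →
      (a ℕ.* (x ℕ.* (b ℕ.* y))) ℕ.* (a ℕ.+ b) ! ℕ.≤ (a ℕ.+ b) ℕ.* z ℕ.* (a ! ℕ.* b !))
    where

    -- The powers of 2 absorb the `n` choices of a root, and `suc d` instead of `d` makes the base
    -- positive.
    D : ℕ
    D = 2 ℕ.* suc d

    -- With k the number of connected graphs on [n], n k counts the rooted ones.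
    F : ℕ → ℕ → ℚ
    F n k = ι (n ℕ.* k) * inv (n !)

    0≤F : ∀ n k → 0ℚ ≤ F n k
    0≤F n k = 0≤* (0≤ι (n ℕ.* k)) (0≤inv (n !))

    F-upper : ∀ {n k} → c n k → F n k ≤ ι D ^ n
    F-upper {n} {k} h = begin
      ι (n ℕ.* k) * inv (n !)                ≤⟨ mulʳ (inv (n !)) (0≤inv (n !)) (ι-≤ nat) ⟩
      ι (D ℕ.^ n ℕ.* n !) * inv (n !)        ≡⟨ cong (_* inv (n !)) (ι-* (D ℕ.^ n) (n !)) ⟩
      ι (D ℕ.^ n) * ι (n !) * inv (n !)      ≡⟨ *-assoc (ι (D ℕ.^ n)) (ι (n !)) (inv (n !)) ⟩
      ι (D ℕ.^ n) * (ι (n !) * inv (n !))    ≡⟨ cong₂ _*_ (ι-^ D n) (inv-inverse (0<! n)) ⟩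
      ι D ^ n * 1ℚ                           ≡⟨ *-identityʳ _ ⟩
      ι D ^ n                                ∎
      where
      open ≤-Reasoning
      nat : n ℕ.* k ℕ.≤ D ℕ.^ n ℕ.* n !
      nat = ℕ.≤-trans (ℕ.*-mono-≤ (ℕ.<⇒≤ (n<2^n n)) (ℕ.≤-trans (c-small h) (ℕ.*-monoˡ-≤ (n !) (ℕ.^-monoˡ-≤ n (ℕ.n≤1+n d)))))
        (ℕ.≤-reflexive (trans (sym (ℕ.*-assoc (2 ℕ.^ n) (suc d ℕ.^ n) (n !)))
          (cong (ℕ._* n !) (sym (^-distribʳ-* n 2 (suc d))))))

    F-join : ∀ {a b x y z} → b ℕ.< a → c a x → c b y → c (a ℕ.+ b) z → F a x * F b y ≤ F (a ℕ.+ b) z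
    F-join {a} {b} {x} {y} {z} lt ca cb cab = begin
      ι (a ℕ.* x) * inv (a !) * (ι (b ℕ.* y) * inv (b !))
        ≡⟨ rearrange (ι (a ℕ.* x)) (inv (a !)) (ι (b ℕ.* y)) (inv (b !)) ⟩
      ι (a ℕ.* x) * ι (b ℕ.* y) * (inv (a !) * inv (b !))
        ≡⟨ cong₂ _*_ (ι-* (a ℕ.* x) (b ℕ.* y)) (inv-* (0<! a) (0<! b)) ⟨
      ι ((a ℕ.* x) ℕ.* (b ℕ.* y)) * inv (a ! ℕ.* b !)
        ≤⟨ cross {p = (a ℕ.* x) ℕ.* (b ℕ.* y)} {r = (a ℕ.+ b) ℕ.* z} (ℕ.*-mono-≤ (0<! a) (0<! b)) (0<! (a ℕ.+ b))
             (ℕ.≤-trans (ℕ.≤-reflexive (cong (ℕ._* (a ℕ.+ b) !) (ℕ.*-assoc a x (b ℕ.* y)))) (c-join lt ca cb cab)) ⟩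
      F (a ℕ.+ b) z ∎
      where
      open ≤-Reasoning
      rearrange : ∀ a b c d → a * b * (c * d) ≡ a * c * (b * d)
      rearrange = solve 4 (λ a b c d → a :* b :* (c :* d) := a :* c :* (b :* d)) refl

    -- A rational substitute for the supremum of the n-th roots of `F`: reached from below at one
    -- order `m`, and bounding all orders from above up to the factor `x`.
    record Rate (x : ℚ) : Set where
      field
        γ : ℚ
        0<γ : 0ℚ < γ
        γ≤D : γ ≤ ι D
        m k : ℕ
        1≤m : 1 ℕ.≤ m
        cm₀ : c m k
        γ-lower : γ ^ m ≤ F m k
        γ-upper : ∀ {n k} → 1 ℕ.≤ n → c n k → F n k ≤ (x * γ) ^ n

    last-true : ∀ (Q : ℕ → Set) T → Q 0 → ¬ Q T → ¬ ¬ Σ ℕ λ t → Q t × ¬ Q (suc t)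
    last-true Q zero q n = ⊥-elim (n q)
    last-true Q (suc T) q n = em {A = Q T} >>= λ
      { (yes q') → pure (T , q' , n) ; (no n') → last-true Q T q n' }

    -- The candidates for `γ` form the geometric sequence `x ^ t * β`. The last one whose n-th power
    -- is at most `F` at some order n is taken; maximality of `t` is exactly the upper bound with
    -- the factor `x`. The start `β`, the reciprocal of `m !`, qualifies since one graph on `m`
    -- vertices exists.
    rate : ∀ {m k W} → 1 ℕ.≤ m → c m (suc k) → 0 ℕ.< W → ¬ ¬ Rate (1ℚ + inv W)
    rate {m₀@(suc p)} {k₀} {W} _ c₀ 0W = do
      t , (m , k , 1m , cm , low) , max ← last-true Q T Q0 ¬QT
      pure (record
        { γ = x ^ t * β ; 0<γ = 0<* (0<^ t 0<x) 0<β
        ; γ≤D = γ≤D t m k 1m cm low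
        ; m = m ; k = k ; 1≤m = 1m ; cm₀ = cm ; γ-lower = low
        ; γ-upper = λ {n} {k'} 1n cn → ≮⇒≥ λ lt → max (n , k' , 1n , cn ,
            <⇒≤ (subst (λ z → z ^ n < F n k') (sym (*-assoc x (x ^ t) β)) lt)) })
      where
      open ≤-Reasoning
      u = inv W
      x = 1ℚ + u
      0<x : 0ℚ < x
      0<x = <-≤-trans 0<1 (≤-trans (≤-reflexive (sym (+-identityʳ 1ℚ))) (+-monoʳ-≤ 1ℚ (0≤inv W)))
      β = inv (m₀ !)
      0<β : 0ℚ < β
      0<β = 0<inv (0<! m₀)
      β≤1 : β ≤ 1ℚ
      β≤1 = begin
        β              ≡⟨ *-identityˡ β ⟨
        1ℚ * β         ≤⟨ mulʳ β (<⇒≤ 0<β) (≤-trans (≤-reflexive (sym (+-identityʳ 1ℚ))) (ι-≤ (0<! m₀))) ⟩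
        ι (m₀ !) * β   ≡⟨ inv-inverse (0<! m₀) ⟩
        1ℚ             ∎
      Q : ℕ → Set
      Q t = Σ ℕ λ n → Σ ℕ λ k → 1 ℕ.≤ n × c n k × (x ^ t * β) ^ n ≤ F n k
      γ≤D : ∀ t m k → 1 ℕ.≤ m → c m k → (x ^ t * β) ^ m ≤ F m k → x ^ t * β ≤ ι D
      γ≤D t (suc m) k _ cm low = ^-cancel-≤ m (0≤ι D) (≤-trans low (F-upper cm))
      Q0 : Q 0
      Q0 = m₀ , suc k₀ , ℕ.s≤s ℕ.z≤n , c₀ , (begin
        (1ℚ * β) ^ m₀            ≡⟨ cong (_^ m₀) (*-identityˡ β) ⟩
        β * β ^ p                ≤⟨ mulˡ β (<⇒≤ 0<β) (≤-trans (^-≤ p (<⇒≤ 0<β) β≤1) (≤-reflexive (1^ p))) ⟩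
        β * 1ℚ                   ≡⟨ *-comm β 1ℚ ⟩
        1ℚ * β                   ≤⟨ mulʳ β (<⇒≤ 0<β) (≤-trans (≤-reflexive (sym (+-identityʳ 1ℚ))) (ι-≤ {1} {m₀ ℕ.* suc k₀} (ℕ.s≤s ℕ.z≤n))) ⟩
        F m₀ (suc k₀)            ∎)
      -- Chosen so that `ι T * u * β` is `D`: Bernoulli's inequality then puts `x ^ T * β` above the
      -- bound of `F-upper`.
      T = W ℕ.* (D ℕ.* m₀ !)
      T-value : ι T * u * β ≡ ι D
      T-value = begin-equality
        ι T * u * β                           ≡⟨ cong (λ z → z * u * β) (trans (ι-* W _) (cong (ι W *_) (ι-* D (m₀ !)))) ⟩
        ι W * (ι D * ι (m₀ !)) * u * β        ≡⟨ rearrange (ι W) (ι D) (ι (m₀ !)) u β ⟩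
        ι D * ((ι W * u) * (ι (m₀ !) * β))    ≡⟨ cong (ι D *_) (cong₂ _*_ (inv-inverse 0W) (inv-inverse (0<! m₀))) ⟩
        ι D * (1ℚ * 1ℚ)                       ≡⟨ cong (ι D *_) (*-identityʳ 1ℚ) ⟩
        ι D * 1ℚ                              ≡⟨ *-identityʳ _ ⟩
        ι D                                   ∎
        where
        rearrange : ∀ w d f u b → w * (d * f) * u * b ≡ d * ((w * u) * (f * b))
        rearrange = solve 5 (λ w d f u b → w :* (d :* f) :* u :* b := d :* ((w :* u) :* (f :* b))) refl
      ¬QT : ¬ Q T
      ¬QT (n , k , 1n , cn , low) = <⇒≱ big (γ≤D T n k 1n cn low)
        where
        big : ι D < x ^ T * β
        big = begin-strict
          ι D                     ≡⟨ +-identityˡ _ ⟨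
          0ℚ + ι D                <⟨ +-monoˡ-< (ι D) 0<β ⟩
          β + ι D                 ≡⟨ cong₂ _+_ (*-identityˡ β) T-value ⟨
          1ℚ * β + ι T * u * β    ≡⟨ *-distribʳ-+ β 1ℚ (ι T * u) ⟨
          (1ℚ + ι T * u) * β      ≤⟨ mulʳ β (<⇒≤ 0<β) (bernoulli (0≤inv W) T) ⟩
          x ^ T * β               ∎

    module _ {γ : ℚ} (0≤γ : 0ℚ ≤ γ) (γ≤D : γ ≤ ι D) {m k : ℕ} (cm : c m k) (low : γ ^ m ≤ F m k) where
      -- Graphs on `m` vertices are attached one after the other; the host never has fewer than `s`
      -- vertices, so `m < s` meets the condition of `F-join` at each step.
      lower-step : ∀ {s y} → m ℕ.< s → c s y → ∀ q {n z} → n ≡ q ℕ.* m ℕ.+ s → c n z → F s y * γ ^ (q ℕ.* m) ≤ F n z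
      lower-step {s} {y} ms cs zero refl cn = ≤-reflexive (trans (*-identityʳ _) (cong (F s) (c-unique cs cn)))
      lower-step {s} {y} ms cs (suc q) {n} {z} e cn = decidable-stable (_ ≤? _) do
        z' , cz ← c-exists (q ℕ.* m ℕ.+ s)
        pure (begin
          F s y * γ ^ (m ℕ.+ q ℕ.* m)           ≡⟨ cong (F s y *_) (^-homo-* γ m (q ℕ.* m)) ⟩
          F s y * (γ ^ m * γ ^ (q ℕ.* m))       ≡⟨ rearrange (F s y) (γ ^ m) (γ ^ (q ℕ.* m)) ⟩
          F s y * γ ^ (q ℕ.* m) * γ ^ m         ≤⟨ mul-≤ (0≤* (0≤F s y) (0≤^ (q ℕ.* m) 0≤γ)) (lower-step ms cs q refl cz) (0≤^ m 0≤γ) low ⟩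
          F (q ℕ.* m ℕ.+ s) z' * F m k          ≤⟨ F-join (ℕ.≤-trans ms (ℕ.m≤n+m s _)) cz cm (subst (λ n → c n z) e' cn) ⟩
          F (q ℕ.* m ℕ.+ s ℕ.+ m) z             ≡⟨ cong (λ n → F n z) e' ⟨
          F n z                                 ∎)
        where
        open ≤-Reasoning
        e' : n ≡ q ℕ.* m ℕ.+ s ℕ.+ m
        e' = trans e (trans (ℕ.+-assoc m (q ℕ.* m) s) (ℕ.+-comm m _))
        rearrange : ∀ a b c → a * (b * c) ≡ a * c * b
        rearrange = solve 3 (λ a b c → a :* (b :* c) := a :* c :* b) refl

      -- Only nonzero counts are bounded, since whole residue classes of orders may have no
      -- connected graph in the class.
      LowerAt : (n₀ K n : ℕ) → Set
      LowerAt n₀ K n = ∀ y → n₀ ℕ.≤ n → c n (suc y) → γ ^ n ≤ ι K * F n (suc y)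

      LowerAt-mono : ∀ {n₀ n₁ K L n} → n₀ ℕ.≤ n₁ → K ℕ.≤ L → LowerAt n₀ K n → LowerAt n₁ L n
      LowerAt-mono {n = n} h h' l y le cn = ≤-trans (l y (ℕ.≤-trans h le) cn) (mulʳ (F n (suc y)) (0≤F n (suc y)) (ι-≤ h'))

      -- If some `s` above `m` in the residue class carries a graph, every later order in the class
      -- is reached from it in steps of `m`, and `K` has only to compare `D ^ s` with `F` at `s`,
      -- which is at least the reciprocal of `s !`. Otherwise the claim is vacuous beyond `m`.
      lower-residue : .{{_ : NonZero m}} → ∀ i → ¬ ¬ Σ ℕ λ n₀ → Σ ℕ λ K → ∀ n → n % m ≡ i → LowerAt n₀ K n
      lower-residue i = em {A = Σ ℕ λ s → Σ ℕ λ y → m ℕ.< s × c s (suc y) × s % m ≡ i} >>= λ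
        { (yes (s , y , ms , cs , e)) → pure (s , D ℕ.^ s ℕ.* s ! , λ n e' z le cn → from s y ms cs n (trans e' (sym e)) z le cn)
        ; (no none) → pure (suc m , 0 , λ n e z le cn → ⊥-elim (none (n , z , le , cn , e))) }
        where
        open ≤-Reasoning
        from : ∀ s y → m ℕ.< s → c s (suc y) → ∀ n → n % m ≡ s % m → LowerAt s (D ℕ.^ s ℕ.* s !) n
        from s y ms cs n e z le cn = begin
          γ ^ n                                                    ≡⟨ cong (γ ^_) n≡ ⟩
          γ ^ (q ℕ.* m ℕ.+ s)                                      ≡⟨ ^-homo-* γ (q ℕ.* m) s ⟩
          γ ^ (q ℕ.* m) * γ ^ s                                    ≤⟨ mulˡ (γ ^ (q ℕ.* m)) (0≤^ (q ℕ.* m) 0≤γ) (≤-trans (^-≤ s 0≤γ γ≤D) base) ⟩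
          γ ^ (q ℕ.* m) * (ι (D ℕ.^ s ℕ.* s !) * F s (suc y))      ≡⟨ rearrange (γ ^ (q ℕ.* m)) (ι (D ℕ.^ s ℕ.* s !)) (F s (suc y)) ⟩
          ι (D ℕ.^ s ℕ.* s !) * (F s (suc y) * γ ^ (q ℕ.* m))      ≤⟨ mulˡ (ι (D ℕ.^ s ℕ.* s !)) (0≤ι (D ℕ.^ s ℕ.* s !)) (lower-step ms cs q n≡ cn) ⟩
          ι (D ℕ.^ s ℕ.* s !) * F n (suc z)                        ∎
          where
          q = n / m ℕ.∸ s / m
          n≡ : n ≡ q ℕ.* m ℕ.+ s
          n≡ = trans (m≡m%n+[m/n]*n n m) (trans (cong₂ (λ a b → a ℕ.+ b ℕ.* m) e (sym (ℕ.m∸n+n≡m (/-monoˡ-≤ m le))))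
            (trans (shuffle (s % m) q (s / m) m) (cong (q ℕ.* m ℕ.+_) (sym (m≡m%n+[m/n]*n s m)))))
            where
            shuffle : ∀ r q p m → r ℕ.+ (q ℕ.+ p) ℕ.* m ≡ q ℕ.* m ℕ.+ (r ℕ.+ p ℕ.* m)
            shuffle = solve-∀
          rearrange : ∀ a b c → a * (b * c) ≡ b * (c * a)
          rearrange = solve 3 (λ a b c → a :* (b :* c) := b :* (c :* a)) refl
          1≤sy : 1 ℕ.≤ s ℕ.* suc y
          1≤sy = ℕ.*-mono-≤ (ℕ.≤-trans (ℕ.s≤s ℕ.z≤n) ms) (ℕ.s≤s (ℕ.z≤n {y}))
          base : ι D ^ s ≤ ι (D ℕ.^ s ℕ.* s !) * F s (suc y)
          base = begin
            ι D ^ s                                      ≡⟨ *-identityʳ _ ⟨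
            ι D ^ s * 1ℚ                                 ≡⟨ cong₂ _*_ (ι-^ D s) (inv-inverse (0<! s)) ⟨
            ι (D ℕ.^ s) * (ι (s !) * inv (s !))          ≡⟨ *-assoc (ι (D ℕ.^ s)) (ι (s !)) (inv (s !)) ⟨
            ι (D ℕ.^ s) * ι (s !) * inv (s !)            ≡⟨ cong (_* inv (s !)) (ι-* (D ℕ.^ s) (s !)) ⟨
            ι (D ℕ.^ s ℕ.* s !) * inv (s !)              ≡⟨ cong (ι (D ℕ.^ s ℕ.* s !) *_) (*-identityˡ (inv (s !))) ⟨
            ι (D ℕ.^ s ℕ.* s !) * (1ℚ * inv (s !))       ≤⟨ mulˡ (ι (D ℕ.^ s ℕ.* s !)) (0≤ι (D ℕ.^ s ℕ.* s !))
                (mulʳ (inv (s !)) (0≤inv (s !)) (≤-trans (≤-reflexive (sym (+-identityʳ 1ℚ))) (ι-≤ 1≤sy))) ⟩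
            ι (D ℕ.^ s ℕ.* s !) * F s (suc y)            ∎

      lower : 1 ℕ.≤ m → ¬ ¬ Σ ℕ λ n₀ → Σ ℕ λ K → ∀ n → LowerAt n₀ K n
      lower (ℕ.s≤s _) = do
        n₀ , K , l ← below m
        pure (n₀ , K , λ n → l (n % m) (m%n<n n m) n refl)
        where
        below : ∀ r → ¬ ¬ Σ ℕ λ n₀ → Σ ℕ λ K → ∀ i → i ℕ.< r → ∀ n → n % m ≡ i → LowerAt n₀ K n
        below zero = pure (0 , 0 , λ _ ())
        below (suc r) = do
          n₀ , K , l ← below r
          n₁ , L , l' ← lower-residue r
          pure (n₀ ℕ.+ n₁ , K ℕ.+ L , λ i lt n e → both n₀ K l n₁ L l' i lt n e)
          where
          both : ∀ n₀ K → (∀ i → i ℕ.< r → ∀ n → n % m ≡ i → LowerAt n₀ K n) → ∀ n₁ L → (∀ n → n % m ≡ r → LowerAt n₁ L n) →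
            ∀ i → i ℕ.< suc r → ∀ n → n % m ≡ i → LowerAt (n₀ ℕ.+ n₁) (K ℕ.+ L) n
          both n₀ K l n₁ L l' i lt n e with i ℕ.≟ r
          ... | yes refl = LowerAt-mono (ℕ.m≤n+m n₁ n₀) (ℕ.m≤n+m L K) (l' n e)
          ... | no neq = LowerAt-mono (ℕ.m≤m+n n₀ n₁) (ℕ.m≤m+n K L) (l i (ℕ.≤∧≢⇒< (ℕ.≤-pred lt) neq) n e)

    module _ {b : ℕ} (B : ℕ → ℕ → ℕ → Set)
      (B-exists : ∀ (m n : ℕ) → ¬ ¬ Σ ℕ (B m n))
      (B-unique : ∀ {m n x y : ℕ} → B m n x → B m n y → x ≡ y)
      (B≤c : ∀ {m n x y : ℕ} → B m n x → c n y → x ℕ.≤ y)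
      (B-step : ∀ {m n x z : ℕ} → b ℕ.< n → B m n x → B (suc m) (n ℕ.+ b) z →
        (n ℕ.* x) ℕ.* (n ℕ.+ b) ! ℕ.≤ suc m ℕ.* z ℕ.* (n ! ℕ.* b !))
      where

      module _ {n x : ℕ} (b<n : b ℕ.< n) (Bn : B 0 n x) where
        private
          X = ι x * inv (n !)
          w : ℕ → ℕ
          w j = j ! ℕ.* (b !) ℕ.^ j

        -- In `B-step` iterated `j` times, each host has at least `n` vertices, and the i-th
        -- attachment is overcounted i times and contributes `b !`: hence `ι n ^ j` against `j !`
        -- and the power of `b !`.
        chain : ∀ j N z → N ≡ j ℕ.* b ℕ.+ n → B j N z → ι n ^ j * X ≤ ι (w j) * (ι z * inv (N !))
        chain zero N z refl Bz = ≤-reflexive (trans (*-identityˡ X)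
          (trans (cong (λ y → ι y * inv (n !)) (B-unique Bn Bz)) (sym (trans (cong (_* (ι z * inv (n !))) (+-identityʳ 1ℚ)) (*-identityˡ _)))))
        chain (suc j) N z e Bz = decidable-stable (_ ≤? _) do
          y , By ← B-exists j M
          pure (begin
            ι n * ι n ^ j * X                                   ≡⟨ *-assoc (ι n) (ι n ^ j) X ⟩
            ι n * (ι n ^ j * X)                                 ≤⟨ mulˡ (ι n) (0≤ι n) (chain j M y refl By) ⟩
            ι n * (ι (w j) * (ι y * inv (M !)))                 ≤⟨ mulʳ (ι (w j) * (ι y * inv (M !)))
                (0≤* (0≤ι (w j)) (0≤* (0≤ι y) (0≤inv (M !)))) (ι-≤ (ℕ.m≤n+m n (j ℕ.* b))) ⟩
            ι M * (ι (w j) * (ι y * inv (M !)))                 ≡⟨ rearrange (ι M) (ι (w j)) (ι y) (inv (M !)) ⟩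
            ι (w j) * (ι M * ι y * inv (M !))                   ≡⟨ cong (λ z → ι (w j) * (z * inv (M !))) (ι-* M y) ⟨
            ι (w j) * (ι (M ℕ.* y) * inv (M !))                 ≤⟨ mulˡ (ι (w j)) (0≤ι (w j)) (cross {p = M ℕ.* y} {r = suc j ℕ.* b ! ℕ.* z} (0<! M) (0<! N) (count y By)) ⟩
            ι (w j) * (ι (suc j ℕ.* b ! ℕ.* z) * inv (N !))     ≡⟨ cong (λ z → ι (w j) * (z * inv (N !))) (ι-* (suc j ℕ.* b !) z) ⟩
            ι (w j) * (ι (suc j ℕ.* b !) * ι z * inv (N !))     ≡⟨ rearrange' (ι (w j)) (ι (suc j ℕ.* b !)) (ι z) (inv (N !)) ⟩
            ι (w j) * ι (suc j ℕ.* b !) * (ι z * inv (N !))     ≡⟨ cong (_* (ι z * inv (N !))) (ι-* (w j) (suc j ℕ.* b !)) ⟨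
            ι (w j ℕ.* (suc j ℕ.* b !)) * (ι z * inv (N !))     ≡⟨ cong (λ v → ι v * (ι z * inv (N !))) (w-suc (j !) ((b !) ℕ.^ j) (suc j) (b !)) ⟩
            ι (w (suc j)) * (ι z * inv (N !))                   ∎)
          where
          open ≤-Reasoning
          M = j ℕ.* b ℕ.+ n
          N≡ : N ≡ M ℕ.+ b
          N≡ = trans e (trans (ℕ.+-assoc b (j ℕ.* b) n) (ℕ.+-comm b M))
          count : ∀ y → B j M y → M ℕ.* y ℕ.* N ! ℕ.≤ suc j ℕ.* b ! ℕ.* z ℕ.* M !
          count y By = subst (λ N → M ℕ.* y ℕ.* N ! ℕ.≤ suc j ℕ.* b ! ℕ.* z ℕ.* M !) (sym N≡)
            (ℕ.≤-trans (B-step (ℕ.≤-trans b<n (ℕ.m≤n+m n (j ℕ.* b))) By (subst (λ N → B (suc j) N z) N≡ Bz))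
              (ℕ.≤-reflexive (swap (suc j) z (M !) (b !))))
            where
            swap : ∀ j z m b → j ℕ.* z ℕ.* (m ℕ.* b) ≡ j ℕ.* b ℕ.* z ℕ.* m
            swap = solve-∀
          w-suc : ∀ f p j b → f ℕ.* p ℕ.* (j ℕ.* b) ≡ j ℕ.* f ℕ.* (b ℕ.* p)
          w-suc = solve-∀
          rearrange : ∀ m w y i → m * (w * (y * i)) ≡ w * (m * y * i)
          rearrange = solve 4 (λ m w y i → m :* (w :* (y :* i)) := w :* (m :* y :* i)) refl
          rearrange' : ∀ w a z i → w * (a * z * i) ≡ w * a * (z * i)
          rearrange' = solve 4 (λ w a z i → w :* (a :* z :* i) := w :* a :* (z :* i)) refl

      P = 2 ℕ.* (b ! ℕ.* D ℕ.^ b)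
      E = spacing d b

      -- Graphs of order `n` without copies are turned into graphs of order N = jb + n, where the
      -- rate bounds all connected graphs from above; `lower` brings the bound back to order `n`.
      -- Both `n₀` and `K` are fixed before `n` and `j`.
      rare : ∀ {m k} → 1 ℕ.≤ m → c m (suc k) → ¬ ¬ Σ ℕ λ n₀ → Σ ℕ λ K → ∀ n j x y →
        n₀ ℕ.≤ n → 1 ℕ.≤ j → j ℕ.* E ℕ.≤ n → n ℕ.≤ 2 ℕ.* (j ℕ.* E) → B 0 n x → c n (suc y) →
        4 ℕ.^ j ℕ.* x ℕ.≤ K ℕ.* (n ℕ.* suc y)
      rare 1m cm = do
        r ← rate 1m cm 0<W
        let open Rate r
        n₀ , K , l ← lower (<⇒≤ 0<γ) γ≤D cm₀ γ-lower 1≤m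
        pure (suc b ℕ.+ n₀ , K , λ n j x y le 1j h h' Bx cy → conclude n j x y K r
          (ℕ.≤-trans (ℕ.m≤m+n _ n₀) le) 1j h h' Bx cy (l n y (ℕ.≤-trans (ℕ.m≤n+m n₀ (suc b)) le) cy))
        where
        -- For `n` at most `2 * (j * E)` the enlarged order is at most `M * j`, and `W = 2 ^ M`
        -- gives `x₀ ^ M` at most 2. So the tolerance costs no more than 2 per copy.
        M = 2 ℕ.* E ℕ.+ b
        W = 2 ℕ.^ M
        0<W : 0 ℕ.< W
        0<W = ℕ.≤-trans (ℕ.s≤s ℕ.z≤n) (n<2^n M)
        x₀ = 1ℚ + inv W
        open ≤-Reasoning

        1≤x₀ : 1ℚ ≤ x₀
        1≤x₀ = ≤-trans (≤-reflexive (sym (+-identityʳ 1ℚ))) (+-monoʳ-≤ 1ℚ (0≤inv W))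

        x₀^M≤2 : x₀ ^ M ≤ ι 2
        x₀^M≤2 = begin
          x₀ ^ M                          ≤⟨ ^-upper (0≤inv W) inv≤1 M (ℕ.pred W) (ℕ.suc-pred W {{ℕ.>-nonZero 0<W}}) ⟩
          1ℚ + ι (ℕ.pred W) * inv W       ≤⟨ +-monoʳ-≤ 1ℚ (mulʳ (inv W) (0≤inv W) (ι-≤ (ℕ.pred[n]≤n {W}))) ⟩
          1ℚ + ι W * inv W                ≡⟨ cong (1ℚ +_) (trans (inv-inverse 0<W) (sym (+-identityʳ 1ℚ))) ⟩
          ι 2                             ∎
          where
          inv≤1 : inv W ≤ 1ℚ
          inv≤1 = begin
            inv W          ≡⟨ *-identityˡ _ ⟨
            1ℚ * inv W     ≤⟨ mulʳ (inv W) (0≤inv W) (≤-trans (≤-reflexive (sym (+-identityʳ 1ℚ))) (ι-≤ 0<W)) ⟩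
            ι W * inv W    ≡⟨ inv-inverse 0<W ⟩
            1ℚ             ∎

        conclude : ∀ n j x y K (r : Rate x₀) → b ℕ.< n → 1 ℕ.≤ j → j ℕ.* E ℕ.≤ n → n ℕ.≤ 2 ℕ.* (j ℕ.* E) →
          B 0 n x → c n (suc y) → Rate.γ r ^ n ≤ ι K * F n (suc y) → 4 ℕ.^ j ℕ.* x ℕ.≤ K ℕ.* (n ℕ.* suc y)
        conclude n j@(suc j′) x y K r b<n _ jE≤n n≤2jE Bx cy low =
          decidable-stable (_ ℕ.≤? _) do
            z , Bz ← B-exists j N
            y' , cN ← c-exists N
            pure (ι-cancel-≤ (cancelˡ (inv (n !)) (0<inv (0<! n)) (finish (cancelˡ (ι j ^ j * ι P ^ j)
              (0<* (0<^ j (0<ι j′)) (0<^ j 0<P)) (main z y' Bz cN)))))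
          where
          open Rate r using (γ; 0<γ; γ≤D; γ-upper)
          N = j ℕ.* b ℕ.+ n
          X = ι x * inv (n !)
          L = ι K * F n (suc y)
          0≤X : 0ℚ ≤ X
          0≤X = 0≤* (0≤ι x) (0≤inv (n !))
          0<P : 0ℚ < ι P
          0<P = <-≤-trans 0<1 (≤-trans (≤-reflexive (sym (+-identityʳ 1ℚ)))
            (ι-≤ {1} {P} (ℕ.*-mono-≤ {1} {2} (ℕ.s≤s ℕ.z≤n) (ℕ.*-mono-≤ (0<! b) (ℕ.m^n>0 D b)))))

          N≤jM : N ℕ.≤ M ℕ.* j
          N≤jM = ℕ.≤-trans (ℕ.+-monoʳ-≤ (j ℕ.* b) n≤2jE) (ℕ.≤-reflexive (collect j b E))
            where
            collect : ∀ j b e → j ℕ.* b ℕ.+ 2 ℕ.* (j ℕ.* e) ≡ (2 ℕ.* e ℕ.+ b) ℕ.* j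
            collect = solve-∀

          x₀^N : x₀ ^ N ≤ ι 2 ^ j
          x₀^N = begin
            x₀ ^ N            ≤⟨ ^-monoʳ 1≤x₀ N≤jM ⟩
            x₀ ^ (M ℕ.* j)    ≡⟨ ^-assocʳ x₀ M j ⟨
            (x₀ ^ M) ^ j      ≤⟨ ^-≤ j (0≤^ M (≤-trans 0≤1 1≤x₀)) x₀^M≤2 ⟩
            ι 2 ^ j           ∎

          γ^N : γ ^ N ≤ ι (D ℕ.^ b) ^ j * L
          γ^N = begin
            γ ^ N                         ≡⟨ ^-homo-* γ (j ℕ.* b) n ⟩
            γ ^ (j ℕ.* b) * γ ^ n         ≤⟨ mul-≤ (0≤^ (j ℕ.* b) (<⇒≤ 0<γ)) (^-≤ (j ℕ.* b) (<⇒≤ 0<γ) γ≤D) (0≤^ n (<⇒≤ 0<γ)) low ⟩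
            ι D ^ (j ℕ.* b) * L           ≡⟨ cong (λ e → ι D ^ e * L) (ℕ.*-comm j b) ⟩
            ι D ^ (b ℕ.* j) * L           ≡⟨ cong (_* L) (^-assocʳ (ι D) b j) ⟨
            (ι D ^ b) ^ j * L             ≡⟨ cong (λ z → z ^ j * L) (ι-^ D b) ⟨
            ι (D ℕ.^ b) ^ j * L           ∎

          upper : ∀ z y' → B j N z → c N y' → ι z * inv (N !) ≤ ι 2 ^ j * (ι (D ℕ.^ b) ^ j * L)
          upper z y' Bz cN = begin
            ι z * inv (N !)                       ≤⟨ mulʳ (inv (N !)) (0≤inv (N !)) (ι-≤ (ℕ.≤-trans (B≤c Bz cN) (ℕ.m≤n*m y' N {{ℕ.>-nonZero 1≤N}}))) ⟩
            F N y'                                ≤⟨ γ-upper 1≤N cN ⟩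
            (x₀ * γ) ^ N                          ≡⟨ ^-distrib-* x₀ γ N ⟩
            x₀ ^ N * γ ^ N                        ≤⟨ mul-≤ (0≤^ N (≤-trans 0≤1 1≤x₀)) x₀^N (0≤^ N (<⇒≤ 0<γ)) γ^N ⟩
            ι 2 ^ j * (ι (D ℕ.^ b) ^ j * L)       ∎
            where
            1≤N : 1 ℕ.≤ N
            1≤N = ℕ.≤-trans (ℕ.≤-trans (ℕ.s≤s ℕ.z≤n) b<n) (ℕ.m≤n+m n (j ℕ.* b))

          P^j : ι (b !) ^ j * (ι 2 ^ j * ι (D ℕ.^ b) ^ j) ≡ ι P ^ j
          P^j = begin-equality
            ι (b !) ^ j * (ι 2 ^ j * ι (D ℕ.^ b) ^ j)   ≡⟨ swap (ι (b !) ^ j) (ι 2 ^ j) (ι (D ℕ.^ b) ^ j) ⟩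
            ι 2 ^ j * (ι (b !) ^ j * ι (D ℕ.^ b) ^ j)   ≡⟨ cong (ι 2 ^ j *_) (^-distrib-* (ι (b !)) (ι (D ℕ.^ b)) j) ⟨
            ι 2 ^ j * (ι (b !) * ι (D ℕ.^ b)) ^ j       ≡⟨ ^-distrib-* (ι 2) (ι (b !) * ι (D ℕ.^ b)) j ⟨
            (ι 2 * (ι (b !) * ι (D ℕ.^ b))) ^ j         ≡⟨ cong (_^ j) (trans (ι-* 2 (b ! ℕ.* D ℕ.^ b)) (cong (ι 2 *_) (ι-* (b !) (D ℕ.^ b)))) ⟨
            ι P ^ j                                     ∎
            where
            swap : ∀ a b c → a * (b * c) ≡ b * (a * c)
            swap = solve 3 (λ a b c → a :* (b :* c) := b :* (a :* c)) refl

          main : ∀ z y' → B j N z → c N y' → ι j ^ j * ι P ^ j * (ι (4 ℕ.^ j) * X) ≤ ι j ^ j * ι P ^ j * L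
          main z y' Bz cN = begin
            ι j ^ j * ι P ^ j * (ι (4 ℕ.^ j) * X)       ≡⟨ cong (λ q → ι j ^ j * ι P ^ j * (q * X)) (ι-^ 4 j) ⟩
            ι j ^ j * ι P ^ j * (ι 4 ^ j * X)           ≡⟨ rearrange (ι j ^ j) (ι P ^ j) (ι 4 ^ j) X ⟩
            -- `E` is `4 * P` by definition; the power of `P` pays for the copies and the power of 4
            -- is left over.
            ι j ^ j * (ι 4 ^ j * ι P ^ j) * X           ≡⟨ cong (λ q → ι j ^ j * q * X) (trans (cong (_^ j) (ι-* 4 P)) (^-distrib-* (ι 4) (ι P) j)) ⟨
            ι j ^ j * ι E ^ j * X                       ≡⟨ cong (_* X) (trans (cong (_^ j) (ι-* j E)) (^-distrib-* (ι j) (ι E) j)) ⟨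
            ι (j ℕ.* E) ^ j * X                         ≤⟨ mulʳ X 0≤X (^-≤ j (0≤ι (j ℕ.* E)) (ι-≤ jE≤n)) ⟩
            ι n ^ j * X                                 ≤⟨ chain b<n Bx j N z refl Bz ⟩
            ι (j ! ℕ.* (b !) ℕ.^ j) * (ι z * inv (N !))   ≤⟨ mul-≤ (0≤ι (j ! ℕ.* (b !) ℕ.^ j)) (ι-≤ (ℕ.*-monoˡ-≤ ((b !) ℕ.^ j) (n!≤n^n j)))
                                                             (0≤* (0≤ι z) (0≤inv (N !))) (upper z y' Bz cN) ⟩
            ι (j ℕ.^ j ℕ.* (b !) ℕ.^ j) * (ι 2 ^ j * (ι (D ℕ.^ b) ^ j * L))
              ≡⟨ cong (_* (ι 2 ^ j * (ι (D ℕ.^ b) ^ j * L))) (trans (ι-* (j ℕ.^ j) ((b !) ℕ.^ j)) (cong₂ _*_ (ι-^ j j) (ι-^ (b !) j))) ⟩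
            ι j ^ j * ι (b !) ^ j * (ι 2 ^ j * (ι (D ℕ.^ b) ^ j * L))
              ≡⟨ regroup (ι j ^ j) (ι (b !) ^ j) (ι 2 ^ j) (ι (D ℕ.^ b) ^ j) L ⟩
            ι j ^ j * (ι (b !) ^ j * (ι 2 ^ j * ι (D ℕ.^ b) ^ j)) * L
              ≡⟨ cong (λ q → ι j ^ j * q * L) P^j ⟩
            ι j ^ j * ι P ^ j * L ∎
            where
            rearrange : ∀ a p q x → a * p * (q * x) ≡ a * (q * p) * x
            rearrange = solve 4 (λ a p q x → a :* p :* (q :* x) := a :* (q :* p) :* x) refl
            regroup : ∀ a b c d l → a * b * (c * (d * l)) ≡ a * (b * (c * d)) * l
            regroup = solve 5 (λ a b c d l → a :* b :* (c :* (d :* l)) := a :* (b :* (c :* d)) :* l) refl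

          finish : ι (4 ℕ.^ j) * X ≤ L → inv (n !) * ι (4 ℕ.^ j ℕ.* x) ≤ inv (n !) * ι (K ℕ.* (n ℕ.* suc y))
          finish h = subst₂ _≤_
            (trans (rearrange (ι (4 ℕ.^ j)) (ι x) (inv (n !))) (cong (inv (n !) *_) (sym (ι-* (4 ℕ.^ j) x))))
            (trans (rearrange (ι K) (ι (n ℕ.* suc y)) (inv (n !))) (cong (inv (n !) *_) (sym (ι-* K (n ℕ.* suc y))))) h
            where
            rearrange : ∀ a b c → a * (b * c) ≡ c * (a * b)
            rearrange = solve 3 (λ a b c → a :* (b :* c) := c :* (a :* b)) refl

-- Graphs as rooted structures, and the theory of a graph with a pendant copy.

module Theory where
  open import Defs
  open DoubleNegation
  open Game
  open Logic
  open Join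
  open Closure
  open Pendant using (PendRoot; Image; image?; inj; exit; leave)
  open import Data.Nat using (ℕ; zero; suc; _+_)
  open import Data.Fin using (Fin; zero; suc)
  open import Data.Bool using (Bool; true; false)
  import Data.Bool as Bool
  open import Axiom.UniquenessOfIdentityProofs using (module Decidable⇒UIP)
  open import Data.Product using (Σ; _×_; _,_; proj₁; proj₂)
  open import Data.Sum as Sum using (_⊎_; inj₁; inj₂; [_,_]′)
  open import Data.Empty using (⊥; ⊥-elim)
  open import Relation.Nullary using (¬_; Dec; yes; no; ⌊_⌋)
  open import Relation.Binary.PropositionalEquality using (_≡_; refl; cong; subst; subst₂; sym; trans)

  rooted : ∀ {n} → Adj n → Fin n → Str 0
  rooted G r = graph G (_≡ r) (λ ())

  module _ {x y : Str 0} (to : V x → V y) (from : V y → V x)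
    (to-from : ∀ (a : V y) → to (from a) ≡ a) (from-to : ∀ (v : V x) → from (to v) ≡ v)
    (E⇒ : ∀ (a b : V y) → E x (from a) (from b) → E y a b) (E⇐ : ∀ (a b : V y) → E y a b → E x (from a) (from b))
    (R⇒ : ∀ (a : V y) → R x (from a) → R y a) (R⇐ : ∀ (a : V y) → R y a → R x (from a)) where
    iso-along : Iso x y
    iso-along = record
      { to = to ; from = from ; to-from = to-from ; from-to = from-to
      ; E⇒ = λ {v} {w} p → E⇒ _ _ (subst₂ (E x) (sym (from-to v)) (sym (from-to w)) p)
      ; E⇐ = λ {a} {b} → E⇐ a b
      ; R⇒ = λ {v} p → R⇒ _ (subst (R x) (sym (from-to v)) p)
      ; R⇐ = λ {a} → R⇐ a ; σ⇒ = λ () }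

  bridge-iso : ∀ {a b n} (s : Shuffle a b n) (G : Adj a) (H : Adj b) v u →
    IsGraph G → IsGraph H → Iso (rooted (bridge s G H v u) (inl s v)) (rooted G v ⊕ rooted H u)
  bridge-iso {a} {b} {n} s G H v u gG gH = iso-along (split s) from to-from (λ i → from-to (view s i)) e⇒ e⇐ r⇒ r⇐
    where
    J = bridge s G H v u
    Y = rooted G v ⊕ rooted H u
    from : Fin a ⊎ Fin b → Fin n
    from = [ inl s , inr s ]′
    to-from : ∀ z → split s (from z) ≡ z
    to-from (inj₁ x) = split-inl s x
    to-from (inj₂ y) = split-inr s y
    from-to : ∀ {i} → View s i → from (split s i) ≡ i
    from-to (isL x) = cong from (split-inl s x)
    from-to (isR y) = cong from (split-inr s y)
    J-sym = bridge-sym s G H v u gG gH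
    e⇒ : ∀ z w → J (from z) (from w) ≡ true → E Y z w
    e⇒ (inj₁ x) (inj₁ y) p = trans (sym (combine-ll s G H _ x y)) p
    e⇒ (inj₂ x) (inj₂ y) p = trans (sym (combine-rr s G H _ x y)) p
    e⇒ (inj₁ x) (inj₂ y) p = bridge-edge⁻¹ s G H v u x y p
    e⇒ (inj₂ y) (inj₁ x) p = bridge-edge⁻¹ s G H v u x y (trans (J-sym _ _) p)
    e⇐ : ∀ z w → E Y z w → J (from z) (from w) ≡ true
    e⇐ (inj₁ x) (inj₁ y) p = trans (combine-ll s G H _ x y) p
    e⇐ (inj₂ x) (inj₂ y) p = trans (combine-rr s G H _ x y) p
    e⇐ (inj₁ x) (inj₂ y) (refl , refl) = bridge-edge s G H v u
    e⇐ (inj₂ y) (inj₁ x) (refl , refl) = trans (J-sym _ _) (bridge-edge s G H v u)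
    r⇒ : ∀ z → from z ≡ inl s v → R Y z
    r⇒ (inj₁ x) p = inl-injective s p
    r⇒ (inj₂ y) p = inl≢inr s (sym p)
    r⇐ : ∀ z → R Y z → from z ≡ inl s v
    r⇐ (inj₁ x) p = cong (inl s) p

  pendant-iso : ∀ {b n} {H : Adj b} {r} {G : Adj n} {u} → IsGraph G → PendRoot H r G u →
    Σ (Str 0) λ rest → Iso (rooted G u) (rooted H r ⊕ rest)
  pendant-iso {b} {n} {H} {r} {G} {u} gG (e , w , P , refl , eH) = rest ,
    iso-along (λ x → to x (image? e x)) from to-from (λ x → from-to x (image? e x)) e⇒ e⇐ r⇒ r⇐
    where
    off : ∀ {x} (d : Dec (Image e x)) → ¬ Image e x → ⌊ d ⌋ ≡ false
    off (yes p) n = ⊥-elim (n p)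
    off (no _) n = refl
    off⁻¹ : ∀ {x} (d : Dec (Image e x)) → ⌊ d ⌋ ≡ false → ¬ Image e x
    off⁻¹ (no n) _ = n
    rest : Str 0
    -- Lying outside the copy is a Boolean equation because its proofs are unique, as the round trip
    -- in `to-from` requires.
    rest = record { V = Σ (Fin n) λ x → ⌊ image? e x ⌋ ≡ false ; E = λ x y → G (proj₁ x) (proj₁ y) ≡ true
                  ; R = λ x → proj₁ x ≡ w ; σ = λ () }
    Y = rooted H r ⊕ rest
    to : ∀ x → Dec (Image e x) → V Y
    to x (yes (i , _)) = inj₁ i
    to x (no n) = inj₂ (x , off (image? e x) n)
    from : V Y → Fin n
    from (inj₁ i) = e i
    from (inj₂ (x , _)) = x
    from-to : ∀ x d → from (to x d) ≡ x
    from-to x (yes (i , p)) = p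
    from-to x (no n) = refl
    to-from : ∀ z → to (from z) (image? e (from z)) ≡ z
    to-from (inj₁ i) with image? e (e i)
    ... | yes (j , p) = cong inj₁ (inj P p)
    ... | no n = ⊥-elim (n (i , refl))
    to-from (inj₂ (x , q)) = go (image? e x)
      where
      go : ∀ d → to x d ≡ inj₂ (x , q)
      go (yes p) = ⊥-elim (off⁻¹ (image? e x) q p)
      go (no n) = cong (λ q → inj₂ (x , q)) (Decidable⇒UIP.≡-irrelevant Bool._≟_ _ q)
    exits : ∀ i x → ⌊ image? e x ⌋ ≡ false → G (e i) x ≡ true → i ≡ r × x ≡ w
    exits i x q p with leave P i x p
    ... | inj₁ h = ⊥-elim (off⁻¹ (image? e x) q h)
    ... | inj₂ h = h
    e⇒ : ∀ z z' → G (from z) (from z') ≡ true → E Y z z'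
    e⇒ (inj₁ i) (inj₁ j) p = trans (sym (eH i j)) p
    e⇒ (inj₁ i) (inj₂ (x , q)) p = exits i x q p
    e⇒ (inj₂ (x , q)) (inj₁ i) p = exits i x q (trans (proj₁ gG _ _) p)
    e⇒ (inj₂ _) (inj₂ _) p = p
    e⇐ : ∀ z z' → E Y z z' → G (from z) (from z') ≡ true
    e⇐ (inj₁ i) (inj₁ j) p = trans (eH i j) p
    e⇐ (inj₁ i) (inj₂ (x , q)) (refl , refl) = exit P
    e⇐ (inj₂ (x , q)) (inj₁ i) (refl , refl) = trans (proj₁ gG _ _) (exit P)
    e⇐ (inj₂ _) (inj₂ _) p = p
    r⇒ : ∀ z → from z ≡ e r → R Y z
    r⇒ (inj₁ i) p = inj P p
    r⇒ (inj₂ (x , q)) p = off⁻¹ (image? e x) q (r , sym p)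
    r⇐ : ∀ z → R Y z → from z ≡ e r
    r⇐ (inj₁ i) p = cong e p

  -- `x ⊕ y` and `y ⊕ x` differ only in the position of the root, which sentences cannot see.
  -- Without roots, a graph that absorbs `h` and a graph `h` that absorbs it are equivalent: κ, κ ⊕
  -- h, h ⊕ κ, h.
  unroot : ∀ {b} → Str b → Str b
  unroot x = record { V = V x ; E = E x ; R = λ _ → ⊥ ; σ = σ x }

  Eq-unroot : ∀ {b} q {x y : Str b} → Eq q x y → Eq q (unroot x) (unroot y)
  Eq-unroot {b} zero (f , g) = forget f , forget g
    where
    forget : ∀ {x y : Str b} → Imp x y → Imp (unroot x) (unroot y)
    forget f = record { meets = Imp.meets f ; linked = Imp.linked f ; many = Imp.many f ; rooted = λ _ () }
  Eq-unroot {b} (suc q) (e , f , g) = Eq-unroot q e , forth f , forth g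
    where
    forth : ∀ {x y : Str b} → Forth q x y → Forth q (unroot x) (unroot y)
    forth f S = do
      S' , e ← f S
      pure (S' , Eq-unroot q e)

  ⊕-comm : ∀ (x y : Str 0) → unroot (x ⊕ y) ≅ unroot (y ⊕ x)
  ⊕-comm x y = Iso⇒≅ (iso-along Sum.swap Sum.swap inv inv (flip y x) (flip' y x) (λ _ ()) (λ _ ()))
    where
    inv : ∀ {A B : Set} (z : A ⊎ B) → Sum.swap (Sum.swap z) ≡ z
    inv (inj₁ _) = refl
    inv (inj₂ _) = refl
    flip' : ∀ (x y : Str 0) a b → E (x ⊕ y) a b → E (y ⊕ x) (Sum.swap a) (Sum.swap b)
    flip' x y (inj₁ _) (inj₁ _) p = p
    flip' x y (inj₁ _) (inj₂ _) (p , q) = q , p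
    flip' x y (inj₂ _) (inj₁ _) (p , q) = q , p
    flip' x y (inj₂ _) (inj₂ _) p = p
    flip : ∀ (x y : Str 0) a b → E (y ⊕ x) (Sum.swap a) (Sum.swap b) → E (x ⊕ y) a b
    flip x y a b p = subst₂ (E (x ⊕ y)) (inv a) (inv b) (flip' y x (Sum.swap a) (Sum.swap b) p)

  leftsFirst : ∀ a b → Shuffle a b (a + b)
  leftsFirst zero zero = []
  leftsFirst zero (suc b) = right (leftsFirst zero b)
  leftsFirst (suc a) b = left (leftsFirst a b)

  module _ {C : Class} (iso : IsoClosed C) (add : Addable C) where
    -- Equivalence to a rooted graph, not equality: the vertices of `x ⊕ y` form a sum type and not
    -- a `Fin n`.
    Member : Str 0 → Set
    Member x = Σ ℕ λ n → Σ (Adj n) λ G → Σ (Fin n) λ r → InConn C n G × x ≅ rooted G r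

    Member-⊕ : ∀ {x y} → Member x → Member y → Member (x ⊕ y)
    Member-⊕ (a , G , v , kG , eG) (b , H , u , kH , eH) =
      a + b , bridge s G H v u , inl s v , bridge-InConn iso add s v u kG kH ,
      λ q → Eq-trans q (Eq-⊕ q (eG q) (eH q))
        (Eq-sym q (Iso⇒≅ (bridge-iso s G H v u (proj₁ (proj₁ kG)) (proj₁ (proj₁ kH))) q))
      where s = leftsFirst a b

    Universal : ∀ q {b} (H : Adj b) (r : Fin b) → Set₁
    Universal q H r = ∀ x → Member x → ¬ ¬ Eq q (rooted H r ⊕ x) (rooted H r)

    universal-graph : ∀ q {n} {G : Adj n} → InConn C n G →
      ¬ ¬ Σ ℕ λ b → Σ (Adj b) λ H → Σ (Fin b) λ r → InConn C b H × Universal q H r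
    universal-graph q {n} {G} k = do
      h , (b , H , r , kH , e) , abs ← universal q Member Member-⊕ (rooted G (proj₁ (proj₂ k)))
        (n , G , proj₁ (proj₂ k) , k , λ q → Eq-refl q)
      pure (b , H , r , kH , λ x mx → do
        e' ← abs x mx
        pure (Eq-trans q (Eq-⊕ q (Eq-sym q (e q)) (Eq-refl q)) (Eq-trans q e' (e q))))

    -- Write G as H ⊕ rest. Then G, rooted like H, inherits from H that it absorbs every member, in particular H;
    -- and H absorbs G. The rest itself need not belong to the class.
    pendant-Eq : ∀ q {b n} {H : Adj b} {r} {G : Adj n} {u} → InConn C b H → InConn C n G → Universal q H r →
      PendRoot H r G u → ¬ ¬ Eq q (unroot (rooted G u)) (unroot (rooted H r))
    pendant-Eq q {b} {n} {H} {r} {G} {u} kH kG univ pend = do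
      absH ← univ h (b , H , r , kH , λ q → Eq-refl q)
      absG ← univ κ (n , G , u , kG , λ q → Eq-refl q)
      let rest , i = pendant-iso (proj₁ (proj₁ kG)) pend
          κ≈ = Iso⇒≅ i q
          κh = Eq-trans q (Eq-⊕ q κ≈ (Eq-refl q)) (Eq-trans q (⊕-swap h rest h q)
                 (Eq-trans q (Eq-⊕ q absH (Eq-refl q)) (Eq-sym q κ≈)))
      pure (Eq-trans q (Eq-unroot q (Eq-sym q κh)) (Eq-trans q (⊕-comm κ h q) (Eq-unroot q absG)))
      where
      κ = rooted G u
      h = rooted H r

-- Distance of a fraction from 0 and from 1.

module Limit where
  open import Data.Nat as ℕ using (ℕ; suc)
  import Data.Nat.Properties as ℕ
  open import Data.Integer as ℤ using (+_)
  import Data.Integer.Properties as ℤ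
  open import Data.Rational using (ℚ; mkℚ; 0ℚ; 1ℚ; _/_; _+_; _-_; -_; ∣_∣; _<_; Positive; ↧ₙ_; NonNegative)
  open import Data.Rational.Properties
  open import Data.Rational.Unnormalised as ℚᵘ using (mkℚᵘ; *<*; *≡*)
  import Data.Rational.Unnormalised.Properties as ℚᵘ
  open import Relation.Binary.PropositionalEquality using (_≡_; cong; sym; trans; subst; module ≡-Reasoning)

  frac : ℕ → ℕ → ℚ
  frac t k = + t / suc k

  -- A positive `ε` has numerator at least 1, hence is no smaller than the reciprocal of its
  -- denominator.
  frac-< : ∀ ε → Positive ε → ∀ t k → ↧ₙ ε ℕ.* t ℕ.< suc k → frac t k < ε
  frac-< ε@(mkℚ (+ suc a) d-1 _) _ t k h = toℚᵘ-cancel-<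
    (ℚᵘ.<-respˡ-≃ (ℚᵘ.≃-sym (toℚᵘ-fromℚᵘ (mkℚᵘ (+ t) k))) (*<* (ℤ.≤-<-trans (ℤ.≤-reflexive e) (ℤ.+<+ lt))))
    where
    e : + t ℤ.* + suc d-1 ≡ + (t ℕ.* suc d-1)
    e = sym (ℤ.pos-* t (suc d-1))
    lt : t ℕ.* suc d-1 ℕ.< suc a ℕ.* suc k
    lt = ℕ.≤-trans (subst (ℕ._< suc k) (ℕ.*-comm (suc d-1) t) h) (ℕ.m≤m+n (suc k) (a ℕ.* suc k))

  frac-nonNeg : ∀ t k → NonNegative (frac t k)
  frac-nonNeg t k = normalize-nonNeg t (suc k)

  near-0 : ∀ t k → ∣ frac t k - 0ℚ ∣ ≡ frac t k
  near-0 t k = trans (cong ∣_∣ (+-identityʳ (frac t k))) (0≤p⇒∣p∣≡p (nonNegative⁻¹ (frac t k) {{frac-nonNeg t k}}))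

  frac-sum : ∀ s t k → s ℕ.+ t ≡ suc k → frac s k + frac t k ≡ 1ℚ
  frac-sum s t k h = toℚᵘ-injective (ℚᵘ.≃-trans (toℚᵘ-homo-+ (frac s k) (frac t k))
    (ℚᵘ.≃-trans (ℚᵘ.+-cong (toℚᵘ-fromℚᵘ (mkℚᵘ (+ s) k)) (toℚᵘ-fromℚᵘ (mkℚᵘ (+ t) k))) (*≡* eq)))
    where
    eq : (+ s ℤ.* + suc k ℤ.+ + t ℤ.* + suc k) ℤ.* ℤ.1ℤ ≡ ℤ.1ℤ ℤ.* + (suc k ℕ.* suc k)
    eq = trans (ℤ.*-identityʳ _) (trans (sym (ℤ.*-distribʳ-+ (+ suc k) (+ s) (+ t)))
      (trans (cong (λ n → + n ℤ.* + suc k) h) (trans (sym (ℤ.pos-* (suc k) (suc k))) (sym (ℤ.*-identityˡ _)))))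

  near-1 : ∀ s t k → s ℕ.+ t ≡ suc k → ∣ frac s k - 1ℚ ∣ ≡ frac t k
  near-1 s t k h = begin
    ∣ frac s k - 1ℚ ∣                          ≡⟨ cong (λ z → ∣ frac s k - z ∣) (frac-sum s t k h) ⟨
    ∣ frac s k - (frac s k + frac t k) ∣       ≡⟨ cong (λ z → ∣ frac s k + z ∣) (neg-distrib-+ (frac s k) (frac t k)) ⟩
    ∣ frac s k + (- frac s k - frac t k) ∣     ≡⟨ cong ∣_∣ (+-assoc (frac s k) (- frac s k) (- frac t k)) ⟨
    ∣ frac s k - frac s k - frac t k ∣         ≡⟨ cong (λ z → ∣ z - frac t k ∣) (+-inverseʳ (frac s k)) ⟩
    ∣ 0ℚ - frac t k ∣                          ≡⟨ cong ∣_∣ (+-identityˡ (- frac t k)) ⟩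
    ∣ - frac t k ∣                             ≡⟨ ∣-p∣≡∣p∣ (frac t k) ⟩
    ∣ frac t k ∣                               ≡⟨ 0≤p⇒∣p∣≡p (nonNegative⁻¹ (frac t k) {{frac-nonNeg t k}}) ⟩
    frac t k                                   ∎
    where open ≡-Reasoning

-- Application to the class, and the zero-one law.

open import Defs
open DoubleNegation
open Logic
open Join
open Closure
open Pendant using (PendRoot)
open Counting
open Growth
open Theory
open Limit
open import Data.Nat as ℕ using (ℕ; zero; suc; _!)
import Data.Nat.Properties as ℕ
open import Data.Nat.DivMod using (_/_; _%_; m≡m%n+[m/n]*n; m%n<n; m/n*n≤m; /-monoˡ-≤; m*n/n≡m)
open import Data.Nat.Tactic.RingSolver using (solve-∀)
open import Data.Fin using (Fin; zero; suc)
open import Data.Rational using (ℚ; 0ℚ; 1ℚ; _<_; ↧ₙ_)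
open import Data.Rational.Properties using (_<?_)
open import Data.Product using (Σ; _×_; _,_; proj₁; proj₂)
open import Data.Sum using (_⊎_; inj₁; inj₂)
open import Data.Empty using (⊥; ⊥-elim)
open import Relation.Nullary using (¬_; yes; no; decidable-stable)
open import Relation.Binary.PropositionalEquality using (_≡_; refl; cong; sym; trans; subst)

Cnt : (∀ n → Adj n → Set) → ℕ → ℕ → Set
Cnt P n = CountIs (P n) (allAdj n)

count-unique : ∀ {A : Set} {P : A → Set} {xs k l} → CountIs P xs k → CountIs P xs l → k ≡ l
count-unique c c' = ℕ.≤-antisym (count-mono (λ p → p) c c') (count-mono (λ p → p) c' c)

shuffle-count : ∀ a b L R → L ℕ.* #shuffles (a ℕ.+ b) a b ℕ.≤ R →
  L ℕ.* (a ℕ.+ b) ! ℕ.≤ R ℕ.* (a ! ℕ.* b !)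
shuffle-count a b L R h = ℕ.≤-trans
  (ℕ.≤-reflexive (trans (cong (L ℕ.*_) (sym (#shuffles-! (a ℕ.+ b) a b refl))) (sym (ℕ.*-assoc L _ (a ! ℕ.* b !)))))
  (ℕ.*-monoˡ-≤ (a ! ℕ.* b !) h)

-- Of the two factors `2 ^ j` in `4 ^ j`, one cancels the `j` that comes from the order of the
-- graph, and the other exceeds the remaining constant because it exceeds `j`.
small-ratio : ∀ j x K E e y → 4 ℕ.^ j ℕ.* x ℕ.≤ K ℕ.* (2 ℕ.* (j ℕ.* E) ℕ.* suc y) → 2 ℕ.* (K ℕ.* E) ℕ.* e ℕ.< j → e ℕ.* x ℕ.< suc y
small-ratio j x K E e y h lt = ℕ.≰⇒> λ big → contra x h big
  where
  contra : ∀ x → 4 ℕ.^ j ℕ.* x ℕ.≤ K ℕ.* (2 ℕ.* (j ℕ.* E) ℕ.* suc y) → suc y ℕ.≤ e ℕ.* x → ⊥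
  contra zero h big with () ← ℕ.≤-trans big (ℕ.≤-reflexive (ℕ.*-zeroʳ e))
  contra x@(suc _) h big = ℕ.<⇒≱ (ℕ.*-monoˡ-< x lt) (begin
    j ℕ.* x                          ≤⟨ ℕ.*-monoˡ-≤ x (ℕ.<⇒≤ (n<2^n j)) ⟩
    2 ℕ.^ j ℕ.* x                    ≤⟨ ℕ.*-cancelˡ-≤ (2 ℕ.^ j) {{ℕ.m^n≢0 2 j}} halve ⟩
    2 ℕ.* (K ℕ.* E) ℕ.* suc y        ≤⟨ ℕ.*-monoʳ-≤ (2 ℕ.* (K ℕ.* E)) big ⟩
    2 ℕ.* (K ℕ.* E) ℕ.* (e ℕ.* x)    ≡⟨ ℕ.*-assoc (2 ℕ.* (K ℕ.* E)) e x ⟨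
    2 ℕ.* (K ℕ.* E) ℕ.* e ℕ.* x      ∎)
    where
    open ℕ.≤-Reasoning
    halve : 2 ℕ.^ j ℕ.* (2 ℕ.^ j ℕ.* x) ℕ.≤ 2 ℕ.^ j ℕ.* (2 ℕ.* (K ℕ.* E) ℕ.* suc y)
    halve = begin
      2 ℕ.^ j ℕ.* (2 ℕ.^ j ℕ.* x)                 ≡⟨ ℕ.*-assoc (2 ℕ.^ j) (2 ℕ.^ j) x ⟨
      2 ℕ.^ j ℕ.* 2 ℕ.^ j ℕ.* x                   ≡⟨ cong (ℕ._* x) (^-distribʳ-* j 2 2) ⟨
      4 ℕ.^ j ℕ.* x                               ≤⟨ h ⟩
      K ℕ.* (2 ℕ.* (j ℕ.* E) ℕ.* suc y)           ≡⟨ rearrange K j E (suc y) ⟩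
      j ℕ.* (2 ℕ.* (K ℕ.* E) ℕ.* suc y)           ≤⟨ ℕ.*-monoˡ-≤ (2 ℕ.* (K ℕ.* E) ℕ.* suc y) (ℕ.<⇒≤ (n<2^n j)) ⟩
      2 ℕ.^ j ℕ.* (2 ℕ.* (K ℕ.* E) ℕ.* suc y)     ∎
      where
      rearrange : ∀ K j E y → K ℕ.* (2 ℕ.* (j ℕ.* E) ℕ.* y) ≡ j ℕ.* (2 ℕ.* (K ℕ.* E) ℕ.* y)
      rearrange = solve-∀

n≤2[n/E]E : ∀ n E .{{_ : ℕ.NonZero E}} → 1 ℕ.≤ n / E → n ℕ.≤ 2 ℕ.* (n / E ℕ.* E)
n≤2[n/E]E n E h = begin
  n                                  ≡⟨ m≡m%n+[m/n]*n n E ⟩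
  n % E ℕ.+ n / E ℕ.* E              ≤⟨ ℕ.+-monoˡ-≤ (n / E ℕ.* E) (ℕ.<⇒≤ (m%n<n n E)) ⟩
  E ℕ.+ n / E ℕ.* E                  ≤⟨ ℕ.+-monoˡ-≤ (n / E ℕ.* E) (ℕ.≤-trans (ℕ.≤-reflexive (sym (ℕ.+-identityʳ E))) (ℕ.*-monoˡ-≤ E h)) ⟩
  n / E ℕ.* E ℕ.+ n / E ℕ.* E        ≡⟨ cong (n / E ℕ.* E ℕ.+_) (ℕ.+-identityʳ _) ⟨
  2 ℕ.* (n / E ℕ.* E)                ∎
  where open ℕ.≤-Reasoning

module _ {C : Class} (iso : IsoClosed C) (add : Addable C) (small : Small C) where
  c : ℕ → ℕ → Set
  c = Cnt (InConn C)

  c-small : ∀ {n k} → c n k → k ℕ.≤ proj₁ small ℕ.^ n ℕ.* n !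
  c-small {n} {k} h = decidable-stable (_ ℕ.≤? _) do
    l , h' ← count-exists {P = InClass C n} (allAdj n)
    pure (ℕ.≤-trans (count-mono proj₁ h h') (proj₂ small n l h'))

  c-join : ∀ {a b x y z} → b ℕ.< a → c a x → c b y → c (a ℕ.+ b) z →
    (a ℕ.* (x ℕ.* (b ℕ.* y))) ℕ.* (a ℕ.+ b) ! ℕ.≤ (a ℕ.+ b) ℕ.* z ℕ.* (a ! ℕ.* b !)
  c-join {a} {b} {x} {y} {z} lt cx cy cz = shuffle-count a b (a ℕ.* (x ℕ.* (b ℕ.* y))) ((a ℕ.+ b) ℕ.* z) (join-count iso add lt cx cy cz)

  module _ {b : ℕ} {H : Adj b} (r : Fin b) (kH : InConn C b H) where
    few : ℕ → ℕ → ℕ → Set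
    few m = Cnt (Few iso add r kH m)

    few-step : ∀ {m n x z} → b ℕ.< n → few m n x → few (suc m) (n ℕ.+ b) z →
      (n ℕ.* x) ℕ.* (n ℕ.+ b) ! ℕ.≤ suc m ℕ.* z ℕ.* (n ! ℕ.* b !)
    few-step {m} {n} {x} {z} lt cx cz = shuffle-count n b (n ℕ.* x) (suc m ℕ.* z) (pendant-count iso add r kH lt cx cz)

    member-count : ¬ ¬ Σ ℕ λ k → c b (suc k)
    member-count = do
      k , ck ← count-exists (allAdj b)
      pure (positive k ck)
      where
      positive : ∀ k → c b k → Σ ℕ λ k → c b (suc k)
      positive zero ck with () ← proj₁ (index ck (InConn-resp iso) kH)
      positive (suc k) ck = k , ck

    1≤b : 1 ℕ.≤ b
    1≤b = go r
      where
      go : ∀ {b} → Fin b → 1 ℕ.≤ b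
      go {suc b} _ = ℕ.s≤s ℕ.z≤n

    -- The double negation stands outside `N`, so a single function serves every `t`, later the
    -- denominator of ε.
    few-rare : ¬ ¬ Σ (ℕ → ℕ) λ N → ∀ t n x y → N t ℕ.≤ n → few 0 n x → c n (suc y) → t ℕ.* x ℕ.< suc y
    few-rare = do
      k , ck ← member-count
      n₀ , K , bound ← rare c (proj₁ small) (λ n → count-exists (allAdj n)) count-unique c-small c-join few
        (λ m n → count-exists (allAdj n)) count-unique (count-mono proj₁) few-step 1≤b ck
      pure ((λ t → n₀ ℕ.+ threshold K t ℕ.* e) , λ t n x y le fx cy → conclude n₀ K bound t n x y le fx cy)
      where
      e = spacing (proj₁ small) b
      threshold : ℕ → ℕ → ℕ
      threshold K t = suc (2 ℕ.* (K ℕ.* e) ℕ.* t)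
      instance
        e≢0 : ℕ.NonZero e
        e≢0 = ℕ.>-nonZero (ℕ.*-mono-≤ {1} {4} (ℕ.s≤s ℕ.z≤n) (ℕ.*-mono-≤ {1} {2} (ℕ.s≤s ℕ.z≤n)
          (ℕ.*-mono-≤ (0<! b) (ℕ.m^n>0 (2 ℕ.* suc (proj₁ small)) b))))
      conclude : ∀ n₀ K → (∀ n j x y → n₀ ℕ.≤ n → 1 ℕ.≤ j → j ℕ.* e ℕ.≤ n → n ℕ.≤ 2 ℕ.* (j ℕ.* e) → few 0 n x → c n (suc y) →
          4 ℕ.^ j ℕ.* x ℕ.≤ K ℕ.* (n ℕ.* suc y)) →
        ∀ t n x y → n₀ ℕ.+ threshold K t ℕ.* e ℕ.≤ n → few 0 n x → c n (suc y) → t ℕ.* x ℕ.< suc y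
      conclude n₀ K bound t n x y le fx cy = small-ratio j x K e t y
        (ℕ.≤-trans (bound n j x y (ℕ.≤-trans (ℕ.m≤m+n n₀ _) le) 1≤j (m/n*n≤m n e) n≤ fx cy)
          (ℕ.*-monoʳ-≤ K (ℕ.*-monoˡ-≤ (suc y) n≤))) large
        where
        -- As many copies as the condition `j * e ≤ n` admits; rounding down loses at most a factor
        -- 2.
        j = n / e
        large : threshold K t ℕ.≤ j
        large = ℕ.≤-trans (ℕ.≤-reflexive (sym (m*n/n≡m (threshold K t) e)))
          (/-monoˡ-≤ e (ℕ.≤-trans (ℕ.m≤n+m (threshold K t ℕ.* e) n₀) le))
        1≤j : 1 ℕ.≤ j
        1≤j = ℕ.≤-trans (ℕ.s≤s ℕ.z≤n) large
        n≤ : n ℕ.≤ 2 ℕ.* (j ℕ.* e)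
        n≤ = n≤2[n/E]E n e 1≤j

  module _ (φ : Sentence) {b : ℕ} {H : Adj b} (r : Fin b) (kH : InConn C b H) (univ : Universal iso add (rank φ) H r) where
    pendant⇒ : ∀ {n} {G : Adj n} {u} → InConn C n G → PendRoot H r G u → Models H φ → Models G φ
    pendant⇒ {G = G} kG p h = decidable-stable (Sat? G (λ ()) (λ ()) φ) do
      e ← pendant-Eq iso add (rank φ) kH kG univ p
      pure (Eq-models φ (Game.Eq-sym (rank φ) e) h)

    pendant⇐ : ∀ {n} {G : Adj n} {u} → InConn C n G → PendRoot H r G u → Models G φ → Models H φ
    pendant⇐ kG p h = decidable-stable (Sat? H (λ ()) (λ ()) φ) do
      e ← pendant-Eq iso add (rank φ) kH kG univ p
      pure (Eq-models φ e h)

    no-pendant : ∀ {n} {G : Adj n} → InConn C n G → (∀ u → ¬ PendRoot H r G u) → Few iso add r kH 0 n G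
    no-pendant kG none = kG , (λ ()) , λ u p → ⊥-elim (none u p)

    -- The limit is the truth value of `φ` in `H`, and this is decidable. Graphs with a pendant copy
    -- of `H` agree with `H` on `φ`, so only those counted by `few` with no copies can deviate.
    limit : (N : ℕ → ℕ) → (∀ t n x y → N t ℕ.≤ n → few r kH 0 n x → c n (suc y) → t ℕ.* x ℕ.< suc y) →
      Σ ℚ λ L → (L ≡ 0ℚ ⊎ L ≡ 1ℚ) × ProbConvergesTo C φ L
    limit N bound with Sat? H (λ ()) (λ ()) φ
    ... | yes h = 1ℚ , inj₂ refl , λ ε pos → N (↧ₙ ε) , λ n le k m ck cm →
      decidable-stable (_ <? ε) do
        x , fx ← count-exists {P = Few iso add r kH 0 n} (allAdj n)
        let m≤k = count-mono proj₁ cm ck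
            k≤m+x = count-cover (λ kG ns → no-pendant kG (λ u p → ns (kG , pendant⇒ kG p h))) ck cm fx
            t≤x = ℕ.≤-trans (ℕ.∸-monoˡ-≤ m k≤m+x) (ℕ.≤-reflexive (ℕ.m+n∸m≡n m x))
        pure (subst (_< ε) (sym (near-1 m (suc k ℕ.∸ m) k (ℕ.m+[n∸m]≡n m≤k)))
          (frac-< ε pos (suc k ℕ.∸ m) k (ℕ.≤-<-trans (ℕ.*-monoʳ-≤ (↧ₙ ε) t≤x) (bound (↧ₙ ε) n x k le fx ck))))
    ... | no ¬h = 0ℚ , inj₁ refl , λ ε pos → N (↧ₙ ε) , λ n le k m ck cm →
      decidable-stable (_ <? ε) do
        x , fx ← count-exists {P = Few iso add r kH 0 n} (allAdj n)
        let m≤x = count-mono (λ s → no-pendant (proj₁ s) (λ u p → ¬h (pendant⇐ (proj₁ s) p (proj₂ s)))) cm fx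
        pure (subst (_< ε) (sym (near-0 m k))
          (frac-< ε pos m k (ℕ.≤-<-trans (ℕ.*-monoʳ-≤ (↧ₙ ε) m≤x) (bound (↧ₙ ε) n x k le fx ck))))

theorem17 : (C : Class) → IsoClosed C → Small C → Addable C → (φ : Sentence) →
    ¬ ¬ (Σ ℚ λ L → (L ≡ 0ℚ ⊎ L ≡ 1ℚ) × ProbConvergesTo C φ L)
theorem17 C iso small add φ = do
  -- If the class has no connected graph, no count is positive and convergence is vacuous; 0 is then
  -- an arbitrary choice.
  yes (n , G , kG) ← em {A = Σ ℕ λ n → Σ (Adj n) (InConn C n)}
    where no empty → pure (0ℚ , inj₁ refl , λ ε pos → 0 , λ n _ k m ck _ →
            ⊥-elim (empty (n , counted ck zero , counted-sound ck zero)))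
  b , H , r , kH , univ ← universal-graph iso add (rank φ) kG
  N , bound ← few-rare iso add small r kH
  pure (limit iso add small φ r kH univ N bound)
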